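{- Let $G$ be a connected graph of order $n\geq 9$. Then $m(-1)=n-4$ if and only if $G\in\{K_{n-3}\vee(K_2\cup K_1),\ K_{n-3}\vee 3K_1\}$. In addition, each such $G$ is determined by its $\mathcal{A}$-spectrum.
   Context: $K_m$ is the complete graph on $m$ vertices, $3K_1$ three isolated vertices, $\cup$ disjoint union, $\vee$ join. For a connected graph $G$, $d(u,v)$ is the distance and $\varepsilon(v)=\max_u d(u,v)$ the eccentricity. The eccentricity matrix $\mathcal{A}(G)$ is indexed by $V(G)$ with $(u,v)$-entry $d(u,v)$ if $d(u,v)=\min\{\varepsilon(u),\varepsilon(v)\}$ and $0$ otherwise; its $\mathcal{A}$-spectrum is the multiset of its eigenvalues. $m(-1)$ is the multiplicity of $-1$ in the $\mathcal{A}$-spectrum. A graph $G$ is determined by its $\mathcal{A}$-spectrum if every connected graph with the same $\mathcal{A}$-spectrum is isomorphic to $G$. -}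

module Defs where

open import Data.Bool using (Bool; true; false; _∧_; _∨_; not; if_then_else_)
open import Data.Bool.Properties using (∧-comm; ∨-comm)
open import Data.Nat using (ℕ; zero; suc; _∸_; _⊔_; _⊓_; _≡ᵇ_; _≤ᵇ_; _+_)
open import Data.Integer using (ℤ; +_; -_) renaming (_+_ to _+ℤ_; _*_ to _*ℤ_)
open import Data.Fin using (Fin; toℕ; punchIn) renaming (zero to fz; suc to fs)
open import Data.List using (List; []; _∷_; map)
open import Data.Product using (Σ; _×_; _,_)
open import Relation.Binary.PropositionalEquality using (_≡_; refl; cong₂)

record Graph (n : ℕ) : Set where
  field
    adj    : Fin n → Fin n → Bool
    sym    : ∀ u v → adj u v ≡ adj v u
    irrefl : ∀ u → adj u u ≡ false
open Graph public

anyFin : ∀ {n} → (Fin n → Bool) → Bool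
anyFin {zero}  f = false
anyFin {suc n} f = f fz ∨ anyFin (λ i → f (fs i))

maxFin : ∀ {n} → (Fin n → ℕ) → ℕ
maxFin {zero}  f = 0
maxFin {suc n} f = f fz ⊔ maxFin (λ i → f (fs i))

_≡ᶠ_ : ∀ {n} → Fin n → Fin n → Bool
u ≡ᶠ v = toℕ u ≡ᵇ toℕ v

within : ∀ {n} → Graph n → ℕ → Fin n → Fin n → Bool
within G zero    u v = u ≡ᶠ v
within G (suc k) u v = within G k u v ∨ anyFin (λ w → adj G u w ∧ within G k w v)

Connected : ∀ {n} → Graph n → Set
Connected {n} G = ∀ u v → within G n u v ≡ true

-- distance d(u,v): least k with a walk of length ≤ k (meaningful for connected G)
dist : ∀ {n} → Graph n → Fin n → Fin n → ℕ
dist {n} G u v = go n 0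
  where
  go : ℕ → ℕ → ℕ
  go zero    k = k
  go (suc f) k = if within G k u v then k else go f (suc k)

ecc : ∀ {n} → Graph n → Fin n → ℕ
ecc G u = maxFin (λ v → dist G u v)

eccMatrix : ∀ {n} → Graph n → Fin n → Fin n → ℤ
eccMatrix G u v =
  if dist G u v ≡ᵇ (ecc G u ⊓ ecc G v) then + dist G u v else + 0

-- Integer polynomials as coefficient lists (lowest degree first)

Poly : Set
Poly = List ℤ

_+p_ : Poly → Poly → Poly
[]      +p q       = q
(a ∷ p) +p []      = a ∷ p
(a ∷ p) +p (b ∷ q) = (a +ℤ b) ∷ (p +p q)

scalep : ℤ → Poly → Poly
scalep a p = map (a *ℤ_) p

_*p_ : Poly → Poly → Poly
[]      *p q = []
(a ∷ p) *p q = scalep a q +p (+ 0 ∷ (p *p q))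

_^p_ : Poly → ℕ → Poly
p ^p zero  = + 1 ∷ []
p ^p suc k = p *p (p ^p k)

coeff : Poly → ℕ → ℤ
coeff []      i       = + 0
coeff (a ∷ p) zero    = a
coeff (a ∷ p) (suc i) = coeff p i

-- equality of polynomials (coefficientwise, ignoring trailing zeros)
_≈p_ : Poly → Poly → Set
p ≈p q = ∀ i → coeff p i ≡ coeff q i

sumP : ∀ {n} → (Fin n → Poly) → Poly
sumP {zero}  f = []
sumP {suc n} f = f fz +p sumP (λ i → f (fs i))

signP : ℕ → Poly
signP zero          = + 1 ∷ []
signP (suc zero)    = - (+ 1) ∷ []
signP (suc (suc k)) = signP k

det : ∀ n → (Fin n → Fin n → Poly) → Poly
det zero    M = + 1 ∷ []
det (suc n) M =
  sumP (λ j → signP (toℕ j) *p (M fz j *p det n (λ i k → M (fs i) (punchIn j k))))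

charPoly : ∀ n → (Fin n → Fin n → ℤ) → Poly
charPoly n A = det n (λ u v →
  if u ≡ᶠ v then (- A u v) ∷ (+ 1 ∷ []) else (- A u v) ∷ [])

-- 𝓐-characteristic polynomial of G; its roots with multiplicity form the 𝓐-spectrum
eccCharPoly : ∀ {n} → Graph n → Poly
eccCharPoly {n} G = charPoly n (eccMatrix G)

_∣p_ : Poly → Poly → Set
d ∣p p = Σ Poly (λ q → p ≈p (q *p d))

RootMult : ℤ → Poly → ℕ → Set
RootMult r p k = (((- r) ∷ (+ 1 ∷ [])) ^p k) ∣p p
               × ((((- r) ∷ (+ 1 ∷ [])) ^p suc k) ∣p p → Empty)
  where open import Data.Empty renaming (⊥ to Empty)

MultMinusOne : ∀ {n} → Graph n → ℕ → Set
MultMinusOne G k = RootMult (- (+ 1)) (eccCharPoly G) k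

record Iso {n m : ℕ} (G : Graph n) (H : Graph m) : Set where
  field
    to      : Fin n → Fin m
    from    : Fin m → Fin n
    from-to : ∀ u → from (to u) ≡ u
    to-from : ∀ v → to (from v) ≡ v
    preserves : ∀ u v → adj G u v ≡ adj H (to u) (to v)

DeterminedByEccSpectrum : ∀ {n} → Graph n → Set
DeterminedByEccSpectrum {n} G =
  ∀ m (H : Graph m) → Connected H → eccCharPoly H ≈p eccCharPoly G → Iso H G

-- The graphs K_{n-3} ∨ (K_2 ∪ K_1) and K_{n-3} ∨ 3K_1 on Fin n.
-- Vertices 0..n-4 form K_{n-3}; vertices n-3, n-2, n-1 are the other part;
-- in the first graph n-3 and n-2 are adjacent (the K_2).

≡ᵇ-sym : ∀ a b → (a ≡ᵇ b) ≡ (b ≡ᵇ a)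
≡ᵇ-sym zero zero = refl
≡ᵇ-sym zero (suc b) = refl
≡ᵇ-sym (suc a) zero = refl
≡ᵇ-sym (suc a) (suc b) = ≡ᵇ-sym a b

≡ᵇ-refl : ∀ a → (a ≡ᵇ a) ≡ true
≡ᵇ-refl zero = refl
≡ᵇ-refl (suc a) = ≡ᵇ-refl a

module _ (n : ℕ) where
  big : Fin n → Bool
  big u = (n ∸ 3) ≤ᵇ toℕ u

  special : Fin n → Fin n → Bool
  special u v = ((toℕ u ≡ᵇ (n ∸ 3)) ∧ (toℕ v ≡ᵇ (n ∸ 2)))
              ∨ ((toℕ v ≡ᵇ (n ∸ 3)) ∧ (toℕ u ≡ᵇ (n ∸ 2)))

  adjJoin : Bool → Fin n → Fin n → Bool
  adjJoin withEdge u v =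
    not (u ≡ᶠ v) ∧ (not (big u ∧ big v) ∨ (withEdge ∧ special u v))

  adjJoin-sym : ∀ e u v → adjJoin e u v ≡ adjJoin e v u
  adjJoin-sym e u v
    rewrite ≡ᵇ-sym (toℕ u) (toℕ v) | ∧-comm (big u) (big v)
          | ∨-comm ((toℕ u ≡ᵇ (n ∸ 3)) ∧ (toℕ v ≡ᵇ (n ∸ 2)))
                   ((toℕ v ≡ᵇ (n ∸ 3)) ∧ (toℕ u ≡ᵇ (n ∸ 2))) = refl

  adjJoin-irrefl : ∀ e u → adjJoin e u u ≡ false
  adjJoin-irrefl e u rewrite ≡ᵇ-refl (toℕ u) = refl

  KjoinK2K1 : Graph n
  KjoinK2K1 = record { adj = adjJoin true ; sym = adjJoin-sym true ; irrefl = adjJoin-irrefl true }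

  Kjoin3K1 : Graph n
  Kjoin3K1 = record { adj = adjJoin false ; sym = adjJoin-sym false ; irrefl = adjJoin-irrefl false }

{-# OPTIONS --safe #-}
module Submission where

-- Put M = A + I for the eccentricity matrix A. As M is symmetric, the multiplicity of -1 is n minus
-- the rank of M: for S positive definite and M x = 0, multiplying row and column i of t S - M by x
-- (where xᵢ ≠ 0) splits off a factor t and leaves t S′ - s M′ with S′ positive definite, s > 0 and M′ the
-- matrix M without row and column i. Iterating down to a nonsingular principal block yields the
-- multiplicity and the sign of the lowest coefficient at -1.
--
-- If the rank is 4, all 5 × 5 principal minors of M vanish. When all eccentricities are at least 3, a path
-- on 5 vertices gives a nonzero one; when c has eccentricity 2 and z, z′ are at distance 4, so do
-- z, z′, c and the two vertices between. Otherwise, if there is no dominating vertex, all eccentricities are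
-- 2 or 3, and M restricted to the vertices of eccentricity e is the identity modulo e, so that n ≤ 4 + 4.
-- If there is a dominating vertex, four non-dominating ones together with it have an odd minor, so there
-- are exactly three non-dominating vertices. The two resulting graphs differ in the sign of the lowest
-- coefficient at -1.

open import Defs hiding (det) renaming (sym to adj-sym)
import Defs
open import Data.Bool using (Bool; true; false; _∧_; _∨_; if_then_else_)
open import Data.Nat as ℕ using (ℕ; zero; suc)
import Data.Nat.Properties as ℕ
open import Data.Fin using (Fin; toℕ; fromℕ<; punchIn; punchOut; splitAt; _↑ˡ_; _↑ʳ_) renaming (zero to fz; suc to fs)
open import Data.Product using (Σ; ∃-syntax; _×_; _,_; proj₁; proj₂)
open import Data.Sum using (_⊎_; inj₁; inj₂; [_,_]′)
open import Data.Empty using (⊥; ⊥-elim)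
open import Function using (_∘_; id)
open import Function.Bundles using (_⇔_; mk⇔; Equivalence)
open import Relation.Nullary using (¬_; yes; no; ¬?)
open import Relation.Nullary.Decidable using (toWitness; toWitnessFalse; decidable-stable)
open import Relation.Binary.PropositionalEquality
  using (_≡_; _≢_; refl; sym; trans; cong; cong₂; subst; module ≡-Reasoning)

-- No eigenvalue or eigenvector ever appears: multiplicity is divisibility of an integer polynomial,
-- so diagonalisation is replaced by elimination on the pencil t S - d M over the integers. Deleting
-- a row and a column spoils the identity matrix, which forces a general S. Its positive
-- definiteness is what rules out Jordan blocks: the pivot xᵀSx cannot vanish, so each kernel vector
-- contributes exactly one factor t. Division is avoided throughout, and the identities between
-- determinants hold only up to integer scalars. These scalars are kept positive, since the two
-- extremal graphs have the same multiplicity of -1 and only a sign tells them apart. Identities are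
-- proved between values at integers, not between coefficients. Powers of x + 1 are cancelled at
-- positive x, and the result is then carried over to x = -1.

module Determinant where

  open import Data.Integer renaming (+_ to pos) using (ℤ; -_; _+_; _*_; 0ℤ; 1ℤ; _≟_)
  open import Data.Integer.Properties using (+-*-semiring; *-zeroʳ; *-identityˡ; *-identityʳ; +-identityʳ; *-assoc;
      neg-distribˡ-*; i*j≡0⇒i≡0∨j≡0)
  open import Data.Integer.Tactic.RingSolver using (solve-∀)
  open import Data.Fin.Properties using (punchIn-punchOut; punchOut-punchIn; punchInᵢ≢i; punchOut-cong; any?) renaming
      (_≟_ to _≟ᶠ_)
  open import Data.Vec.Functional using (Vector; _∷_)
  open import Relation.Nullary using (contradiction)
  open import Algebra.Properties.Semiring.Sum +-*-semiring using
      (sum; sum-cong-≗; sum-replicate-zero; *-distribˡ-sum; ∑-distrib-+; ∑-comm; sum-remove)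

  -- Determinants over the integers: row operations, transposition, kernels.

  Matrix : ℕ → ℕ → Set
  Matrix m n = Fin m → Fin n → ℤ

  sum-zero : ∀ {n} (f : Vector ℤ n) → (∀ i → f i ≡ 0ℤ) → sum f ≡ 0ℤ
  sum-zero {n} f f≡0 = trans (sum-cong-≗ f≡0) (sum-replicate-zero n)

  sum-neg : ∀ {n} (f : Vector ℤ n) → sum (λ i → - f i) ≡ - sum f
  sum-neg {zero}  f = refl
  sum-neg {suc n} f = trans (cong ((- f fz) +_) (sum-neg (f ∘ fs))) (lemma (f fz) (sum (f ∘ fs)))
    where
    lemma : ∀ a b → - a + - b ≡ - (a + b)
    lemma = solve-∀

  sgn : ℕ → ℤ
  sgn zero    = 1ℤ
  sgn (suc k) = - sgn k

  sgn² : ∀ k → sgn k * sgn k ≡ 1ℤ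
  sgn² zero    = refl
  sgn² (suc k) = trans (lemma (sgn k)) (sgn² k)
    where
    lemma : ∀ a → - a * - a ≡ a * a
    lemma = solve-∀

  detℤ  : ∀ {n} → Matrix n n → ℤ
  -- Keeps the first row `r` apart from the other rows `R`, so that linearity, exchange and addition
  -- of rows can be stated for one distinguished row.
  expand : ∀ {n} → Vector ℤ (suc n) → Matrix n (suc n) → ℤ

  detℤ {zero}  M = 1ℤ
  detℤ {suc n} M = expand (M fz) (M ∘ fs)

  expand r R = sum λ j → sgn (toℕ j) * (r j * detℤ (λ i k → R i (punchIn j k)))

  detℤ-cong : ∀ {n} {M N : Matrix n n} → (∀ i j → M i j ≡ N i j) → detℤ M ≡ detℤ N
  expand-cong : ∀ {n} {r s : Vector ℤ (suc n)} {R T : Matrix n (suc n)} →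
    (∀ j → r j ≡ s j) → (∀ i j → R i j ≡ T i j) → expand r R ≡ expand s T

  detℤ-cong {zero}  eq = refl
  detℤ-cong {suc n} {M} {N} eq = expand-cong {r = M fz} {N fz} {M ∘ fs} {N ∘ fs} (eq fz) (λ i → eq (fs i))

  expand-cong r≡s R≡T = sum-cong-≗ λ j →
    cong (sgn (toℕ j) *_) (cong₂ _*_ (r≡s j) (detℤ-cong λ i k → R≡T i (punchIn j k)))

  expand-congʳ : ∀ {n} (r : Vector ℤ (suc n)) (R T : Matrix n (suc n)) →
    (∀ i j → R i j ≡ T i j) → expand r R ≡ expand r T
  expand-congʳ r R T = expand-cong {r = r} {r} {R} {T} (λ _ → refl)

  ∷-head-tail : ∀ {m n} (R : Matrix (suc m) n) → ∀ i j → R i j ≡ (R fz ∷ (R ∘ fs)) i j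
  ∷-head-tail R fz     j = refl
  ∷-head-tail R (fs i) j = refl

  cofactor : ∀ {n} → Matrix n (suc n) → Fin (suc n) → ℤ
  cofactor R j = detℤ (λ i k → R i (punchIn j k))

  expand-+ : ∀ {n} (r s : Vector ℤ (suc n)) (R : Matrix n (suc n)) →
    expand (λ j → r j + s j) R ≡ expand r R + expand s R
  expand-+ r s R =
    trans (sum-cong-≗ λ j → lemma (sgn (toℕ j)) (r j) (s j) (cofactor R j))
          (∑-distrib-+ (λ j → sgn (toℕ j) * (r j * cofactor R j)) (λ j → sgn (toℕ j) * (s j * cofactor R j)))
    where
    lemma : ∀ a x y d → a * ((x + y) * d) ≡ a * (x * d) + a * (y * d)
    lemma = solve-∀

  expand-* : ∀ {n} c (r : Vector ℤ (suc n)) (R : Matrix n (suc n)) →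
    expand (λ j → c * r j) R ≡ c * expand r R
  expand-* c r R =
    trans (sum-cong-≗ λ j → lemma (sgn (toℕ j)) c (r j) (cofactor R j))
          (sym (*-distribˡ-sum c (λ j → sgn (toℕ j) * (r j * cofactor R j))))
    where
    lemma : ∀ a c x d → a * ((c * x) * d) ≡ c * (a * (x * d))
    lemma = solve-∀

  expand-0 : ∀ {n} (r : Vector ℤ (suc n)) (R : Matrix n (suc n)) → (∀ j → r j ≡ 0ℤ) → expand r R ≡ 0ℤ
  expand-0 r R r≡0 = sum-zero (λ j → sgn (toℕ j) * (r j * cofactor R j)) λ j →
    trans (cong (λ x → sgn (toℕ j) * (x * cofactor R j)) (r≡0 j)) (*-zeroʳ (sgn (toℕ j)))

  expand-sum : ∀ {n m} (r : Fin m → Vector ℤ (suc n)) (R : Matrix n (suc n)) →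
    expand (λ j → sum λ l → r l j) R ≡ sum λ l → expand (r l) R
  expand-sum {m = zero}  r R = expand-0 (λ _ → 0ℤ) R (λ _ → refl)
  expand-sum {m = suc m} r R =
    trans (expand-+ (r fz) (λ j → sum λ l → r (fs l) j) R)
          (cong (expand (r fz) R +_) (expand-sum (r ∘ fs) R))

  lift : ∀ {m n} → (Fin m → Fin n) → Fin (suc m) → Fin (suc n)
  lift g fz     = fz
  lift g (fs i) = fs (g i)

  -- The Laplace expansion along the first two rows r and s, with the complementary minors left
  -- abstract: F receives the selection of the remaining columns.
  expand₂ : ∀ n → Vector ℤ (suc (suc n)) → Vector ℤ (suc (suc n)) → ((Fin n → Fin (suc (suc n))) → ℤ) → ℤ
  expand₂ n r s F = sum λ j → sgn (toℕ j) *
    (r j * sum λ k → sgn (toℕ k) * (s (punchIn j k) * F (punchIn j ∘ punchIn k)))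

  -- Column selections arise as different composites of `punchIn` that agree only pointwise; an
  -- extensional `F` cannot tell them apart.
  Extensional : ∀ {m n} → ((Fin m → Fin n) → ℤ) → Set
  Extensional F = ∀ {g h} → (∀ i → g i ≡ h i) → F g ≡ F h

  -- Sorts the terms by the use of column 0: in row `r`, in row `s`, or in neither. Exchanging the
  -- rows swaps the first two groups with a sign, and the third is the same expansion with one
  -- column fewer, which sets up the induction for `expand₂-swap`.
  expand₂-split : ∀ n r s F → Extensional F → expand₂ (suc n) r s F ≡
    (r fz * sum (λ k → sgn (toℕ k) * (s (fs k) * F (fs ∘ punchIn k)))
     + - (s fz * sum (λ k → sgn (toℕ k) * (r (fs k) * F (fs ∘ punchIn k)))))
    + expand₂ n (r ∘ fs) (s ∘ fs) (F ∘ lift)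
  expand₂-split n r s F ext = begin
    1ℤ * (r fz * A s) + sum (λ j → - sgn (toℕ j) *
        (r (fs j) * (1ℤ * (s fz * G j) + sum (λ k → - sgn (toℕ k) * (s (fs (punchIn j k)) * H j k)))))
      ≡⟨ cong₂ _+_ (*-identityˡ (r fz * A s)) (trans (sum-cong-≗ tail)
          (∑-distrib-+ (λ j → - s fz * (sgn (toℕ j) * (r (fs j) * G j)))
                       (λ j → sgn (toℕ j) * (r (fs j) * sum λ k → sgn (toℕ k) *
                           (s (fs (punchIn j k)) * F (lift (punchIn j ∘ punchIn k))))))) ⟩
    r fz * A s + (sum (λ j → - s fz * (sgn (toℕ j) * (r (fs j) * G j))) + expand₂ n (r ∘ fs) (s ∘ fs) (F ∘ lift))
      ≡⟨ cong (λ z → r fz * A s + (z + expand₂ n (r ∘ fs) (s ∘ fs) (F ∘ lift)))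
          (sym (*-distribˡ-sum (- s fz) (λ j → sgn (toℕ j) * (r (fs j) * G j)))) ⟩
    r fz * A s + (- s fz * A r + expand₂ n (r ∘ fs) (s ∘ fs) (F ∘ lift))
      ≡⟨ assemble (r fz) (s fz) (A r) (A s) (expand₂ n (r ∘ fs) (s ∘ fs) (F ∘ lift)) ⟩
    (r fz * A s + - (s fz * A r)) + expand₂ n (r ∘ fs) (s ∘ fs) (F ∘ lift) ∎
    where
    open ≡-Reasoning
    G : Fin (suc (suc n)) → ℤ
    G j = F (fs ∘ punchIn j)
    A : Vector ℤ (suc (suc (suc n))) → ℤ
    A t = sum λ k → sgn (toℕ k) * (t (fs k) * G k)
    H : Fin (suc (suc n)) → Fin (suc n) → ℤ
    H j k = F (punchIn (fs j) ∘ punchIn (fs k))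
    assemble : ∀ a b c d e → a * d + (- b * c + e) ≡ (a * d + - (b * c)) + e
    assemble = solve-∀
    rearrange : ∀ σ x y g z → - σ * (x * (1ℤ * (y * g) + - z)) ≡ - y * (σ * (x * g)) + σ * (x * z)
    rearrange = solve-∀
    negate : ∀ σ y h → - σ * (y * h) ≡ - (σ * (y * h))
    negate = solve-∀
    lifted : ∀ j k i → (punchIn (fs j) ∘ punchIn (fs k)) i ≡ lift (punchIn j ∘ punchIn k) i
    lifted j k fz     = refl
    lifted j k (fs i) = refl
    inner : ∀ j → sum (λ k → - sgn (toℕ k) * (s (fs (punchIn j k)) * H j k)) ≡
      - sum (λ k → sgn (toℕ k) * (s (fs (punchIn j k)) * F (lift (punchIn j ∘ punchIn k))))
    inner j = trans
      (sum-cong-≗ λ k → trans (negate (sgn (toℕ k)) (s (fs (punchIn j k))) (H j k))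
        (cong (λ h → - (sgn (toℕ k) * (s (fs (punchIn j k)) * h))) (ext (lifted j k))))
      (sum-neg (λ k → sgn (toℕ k) * (s (fs (punchIn j k)) * F (lift (punchIn j ∘ punchIn k)))))
    tail : ∀ j → - sgn (toℕ j) * (r (fs j) * (1ℤ * (s fz * G j) + sum
        (λ k → - sgn (toℕ k) * (s (fs (punchIn j k)) * H j k)))) ≡
      - s fz * (sgn (toℕ j) * (r (fs j) * G j)) + sgn (toℕ j) *
          (r (fs j) * sum (λ k → sgn (toℕ k) * (s (fs (punchIn j k)) * F (lift (punchIn j ∘ punchIn k)))))
    tail j = trans
      (cong (λ z → - sgn (toℕ j) * (r (fs j) * (1ℤ * (s fz * G j) + z))) (inner j))
      (rearrange (sgn (toℕ j)) (r (fs j)) (s fz) (G j)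
        (sum (λ k → sgn (toℕ k) * (s (fs (punchIn j k)) * F (lift (punchIn j ∘ punchIn k))))))

  expand₂-swap : ∀ n r s F → Extensional F → expand₂ n r s F ≡ - expand₂ n s r F
  expand₂-swap zero r s F ext =
    trans (cong (λ z → 1ℤ * (r fz * (1ℤ * (s (fs fz) * F (fs ∘ punchIn fz)) + 0ℤ)) +
        (- 1ℤ * (r (fs fz) * (1ℤ * (s fz * z) + 0ℤ)) + 0ℤ)) (ext (λ ())))
    (trans (lemma (r fz) (r (fs fz)) (s fz) (s (fs fz)) (F (fs ∘ punchIn fz)))
    (cong (λ z → - (1ℤ * (s fz * (1ℤ * (r (fs fz) * F (fs ∘ punchIn fz)) + 0ℤ)) +
        (- 1ℤ * (s (fs fz) * (1ℤ * (r fz * z) + 0ℤ)) + 0ℤ))) (ext (λ ()))))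
    where
    lemma : ∀ a b c d f → 1ℤ * (a * (1ℤ * (d * f) + 0ℤ)) + (- 1ℤ * (b * (1ℤ * (c * f) + 0ℤ)) + 0ℤ) ≡
      - (1ℤ * (c * (1ℤ * (b * f) + 0ℤ)) + (- 1ℤ * (d * (1ℤ * (a * f) + 0ℤ)) + 0ℤ))
    lemma = solve-∀
  expand₂-swap (suc n) r s F ext =
    trans (expand₂-split n r s F ext)
    (trans (cong (λ z → (a + - b) + z) (expand₂-swap n (r ∘ fs) (s ∘ fs) (F ∘ lift) ext′))
    (trans (lemma a b (expand₂ n (s ∘ fs) (r ∘ fs) (F ∘ lift))) (cong -_ (sym (expand₂-split n s r F ext)))))
    where
    a = r fz * sum (λ k → sgn (toℕ k) * (s (fs k) * F (fs ∘ punchIn k)))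
    b = s fz * sum (λ k → sgn (toℕ k) * (r (fs k) * F (fs ∘ punchIn k)))
    ext′ : Extensional (F ∘ lift)
    ext′ eq = ext λ { fz → refl ; (fs i) → cong fs (eq i) }
    lemma : ∀ a b c → (a + - b) + - c ≡ - ((b + - a) + c)
    lemma = solve-∀

  expand-swap : ∀ {n} (r s : Vector ℤ (suc (suc n))) (R : Matrix n (suc (suc n))) →
    expand r (s ∷ R) ≡ - expand s (r ∷ R)
  expand-swap {n} r s R = expand₂-swap n r s (λ g → detℤ (λ i l → R i (g l)))
    (λ eq → detℤ-cong (λ i l → cong (R i) (eq l)))

  x≡-x⇒x≡0 : ∀ x → x ≡ - x → x ≡ 0ℤ
  x≡-x⇒x≡0 (pos zero)  eq = refl

  -- If the copy is the first row of `R`, exchanging the two rows negates the determinant without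
  -- changing it. Otherwise an exchange with the first row of `R` pushes `r` and its copy into every
  -- minor, and induction applies.
  expand-dup : ∀ {n} (r : Vector ℤ (suc n)) (R : Matrix n (suc n)) k → (∀ j → r j ≡ R k j) → expand r R ≡ 0ℤ
  expand-dup {suc n} r R fz r≡ = x≡-x⇒x≡0 _
    (trans step (trans (expand-swap r r (R ∘ fs)) (cong -_ (sym step))))
    where
    step : expand r R ≡ expand r (r ∷ (R ∘ fs))
    step = expand-congʳ r R (r ∷ (R ∘ fs)) λ { fz j → sym (r≡ j) ; (fs i) j → refl }
  expand-dup {suc n} r R (fs k) r≡ = begin
    expand r R                        ≡⟨ expand-congʳ r R (R fz ∷ (R ∘ fs)) (∷-head-tail R) ⟩
    expand r (R fz ∷ (R ∘ fs))        ≡⟨ expand-swap r (R fz) (R ∘ fs) ⟩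
    - expand (R fz) (r ∷ (R ∘ fs))    ≡⟨ cong -_ (sum-zero (λ j → sgn (toℕ j) * (R fz j * cofactor (r ∷ (R ∘ fs)) j))
        λ j → trans (cong (λ d → sgn (toℕ j) * (R fz j * d)) (minor j)) (lemma (sgn (toℕ j)) (R fz j))) ⟩
    - 0ℤ                              ≡⟨⟩
    0ℤ ∎
    where
    open ≡-Reasoning
    lemma : ∀ a b → a * (b * 0ℤ) ≡ 0ℤ
    lemma = solve-∀
    minor : ∀ j → detℤ (λ i l → (r ∷ (R ∘ fs)) i (punchIn j l)) ≡ 0ℤ
    minor j = expand-dup (λ l → r (punchIn j l)) (λ i l → R (fs i) (punchIn j l)) k (λ l → r≡ (punchIn j l))

  detℤ-zero-minors : ∀ {n} (M : Matrix (suc n) (suc n)) →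
    (∀ j → detℤ (λ i k → M (fs i) (punchIn j k)) ≡ 0ℤ) → detℤ M ≡ 0ℤ
  detℤ-zero-minors M minors = sum-zero (λ j → sgn (toℕ j) * (M fz j * cofactor (M ∘ fs) j)) λ j →
    trans (cong (λ d → sgn (toℕ j) * (M fz j * d)) (minors j)) (lemma (sgn (toℕ j)) (M fz j))
    where
    lemma : ∀ a b → a * (b * 0ℤ) ≡ 0ℤ
    lemma = solve-∀

  detℤ-dup : ∀ {n} (M : Matrix n n) i k → i ≢ k → (∀ j → M i j ≡ M k j) → detℤ M ≡ 0ℤ
  detℤ-dup M fz     fz     i≢k eq = ⊥-elim (i≢k refl)
  detℤ-dup M fz     (fs k) i≢k eq = expand-dup (M fz) (M ∘ fs) k eq
  detℤ-dup M (fs i) fz     i≢k eq = expand-dup (M fz) (M ∘ fs) i (λ j → sym (eq j))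
  detℤ-dup M (fs i) (fs k) i≢k eq = detℤ-zero-minors M λ j →
    detℤ-dup (λ i l → M (fs i) (punchIn j l)) i k (i≢k ∘ cong fs) (λ l → eq (punchIn j l))

  detℤ-zero-row : ∀ {n} (M : Matrix n n) i → (∀ j → M i j ≡ 0ℤ) → detℤ M ≡ 0ℤ
  detℤ-zero-row M fz     eq = expand-0 (M fz) (M ∘ fs) eq
  detℤ-zero-row M (fs i) eq = detℤ-zero-minors M λ j → detℤ-zero-row (λ i l → M (fs i) (punchIn j l)) i
      (λ l → eq (punchIn j l))

  _^ℤ_ : ℤ → ℕ → ℤ
  x ^ℤ zero  = 1ℤ
  x ^ℤ suc k = x * (x ^ℤ k)

  detℤ-scale : ∀ {n} c (M : Matrix n n) → detℤ (λ i j → c * M i j) ≡ (c ^ℤ n) * detℤ M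
  detℤ-scale {zero}  c M = refl
  detℤ-scale {suc n} c M = trans
    (sum-cong-≗ λ j → trans
      (cong (λ d → sgn (toℕ j) * (c * M fz j * d)) (detℤ-scale c (λ i k → M (fs i) (punchIn j k))))
      (lemma (sgn (toℕ j)) c (M fz j) (c ^ℤ n) (cofactor (M ∘ fs) j)))
    (sym (*-distribˡ-sum (c ^ℤ suc n) (λ j → sgn (toℕ j) * (M fz j * cofactor (M ∘ fs) j))))
    where
    lemma : ∀ a c x p d → a * ((c * x) * (p * d)) ≡ (c * p) * (a * (x * d))
    lemma = solve-∀

  -- Exchanging `r` with the first altered row makes the determinant linear in that row; the part c₀
  -- r then meets its copy and vanishes. The remaining alterations sit in the minors, where `r` is
  -- again the top row.
  expand-add : ∀ {n} (r : Vector ℤ (suc n)) (R : Matrix n (suc n)) (c : Vector ℤ n) →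
    expand r (λ i j → R i j + c i * r j) ≡ expand r R
  expand-add {zero}  r R c = expand-congʳ r (λ i j → R i j + c i * r j) R (λ ())
  expand-add {suc n} r R c = begin
    expand r (λ i j → R i j + c i * r j)
      ≡⟨ expand-congʳ r (λ i j → R i j + c i * r j) ((λ j → R fz j + c fz * r j) ∷ R′)
          (λ { fz j → refl ; (fs i) j → refl }) ⟩
    expand r ((λ j → R fz j + c fz * r j) ∷ R′)
      ≡⟨ expand-swap r (λ j → R fz j + c fz * r j) R′ ⟩
    - expand (λ j → R fz j + c fz * r j) (r ∷ R′)
      ≡⟨ cong -_ (sum-cong-≗ λ j → cong (λ d → sgn (toℕ j) * ((R fz j + c fz * r j) * d)) (minor j)) ⟩
    - expand (λ j → R fz j + c fz * r j) (r ∷ (R ∘ fs))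
      ≡⟨ cong -_ (expand-+ (R fz) (λ j → c fz * r j) (r ∷ (R ∘ fs))) ⟩
    - (expand (R fz) (r ∷ (R ∘ fs)) + expand (λ j → c fz * r j) (r ∷ (R ∘ fs)))
      ≡⟨ cong (λ z → - (expand (R fz) (r ∷ (R ∘ fs)) + z))
          (trans (expand-* (c fz) r (r ∷ (R ∘ fs)))
          (trans (cong (c fz *_) (expand-dup r (r ∷ (R ∘ fs)) fz (λ _ → refl))) (*-zeroʳ (c fz)))) ⟩
    - (expand (R fz) (r ∷ (R ∘ fs)) + 0ℤ)
      ≡⟨ cong -_ (+-identityʳ (expand (R fz) (r ∷ (R ∘ fs)))) ⟩
    - expand (R fz) (r ∷ (R ∘ fs))
      ≡⟨ sym (expand-swap r (R fz) (R ∘ fs)) ⟩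
    expand r (R fz ∷ (R ∘ fs))
      ≡⟨ sym (expand-congʳ r R (R fz ∷ (R ∘ fs)) (∷-head-tail R)) ⟩
    expand r R ∎
    where
    open ≡-Reasoning
    R′ : Matrix n (suc (suc n))
    R′ i j = R (fs i) j + c (fs i) * r j
    minor : ∀ j → detℤ (λ i k → (r ∷ R′) i (punchIn j k)) ≡ detℤ (λ i k → (r ∷ (R ∘ fs)) i (punchIn j k))
    minor j = expand-add (λ k → r (punchIn j k)) (λ i k → R (fs i) (punchIn j k)) (c ∘ fs)

  -- Chiò's condensation without division: the n lower rows are scaled by the pivot, then multiples
  -- of row 0 clear column 0 below it.
  detℤ-pivot : ∀ {n} (M : Matrix (suc n) (suc n)) →
    (M fz fz ^ℤ n) * detℤ M ≡
    M fz fz * detℤ (λ i j → M fz fz * M (fs i) (fs j) + - (M (fs i) fz) * M fz (fs j))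
  detℤ-pivot {n} M = begin
    (a ^ℤ n) * detℤ M
      ≡⟨ trans (*-distribˡ-sum (a ^ℤ n) (λ j → sgn (toℕ j) * (M fz j * cofactor (M ∘ fs) j)))
           (sum-cong-≗ λ j → trans (lemma (a ^ℤ n) (sgn (toℕ j)) (M fz j) (cofactor (M ∘ fs) j))
           (cong (λ d → sgn (toℕ j) * (M fz j * d)) (sym (detℤ-scale a (λ i k → M (fs i) (punchIn j k)))))) ⟩
    expand (M fz) (λ i j → a * M (fs i) j)
      ≡⟨ sym (expand-add (M fz) (λ i j → a * M (fs i) j) (λ i → - M (fs i) fz)) ⟩
    expand (M fz) N
      ≡⟨ cong (_+ sum λ j → sgn (toℕ (fs j)) * (M fz (fs j) * cofactor N (fs j)))
          (*-identityˡ (a * detℤ (λ i j → N i (fs j)))) ⟩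
    a * detℤ (λ i j → N i (fs j)) + sum (λ j → sgn (toℕ (fs j)) *
        (M fz (fs j) * detℤ (λ i k → N i (punchIn (fs j) k))))
      ≡⟨ cong (a * detℤ (λ i j → N i (fs j)) +_) (sum-zero
          (λ j → sgn (toℕ (fs j)) * (M fz (fs j) * cofactor N (fs j))) λ j → trans
          (cong (λ d → sgn (toℕ (fs j)) * (M fz (fs j) * d)) (vanish n N col j))
          (lemma₂ (sgn (toℕ (fs j))) (M fz (fs j)))) ⟩
    a * detℤ (λ i j → N i (fs j)) + 0ℤ
      ≡⟨ +-identityʳ (a * detℤ (λ i j → N i (fs j))) ⟩
    a * detℤ (λ i j → N i (fs j)) ∎
    where
    open ≡-Reasoning
    a = M fz fz
    N : Matrix n (suc n)
    N i j = a * M (fs i) j + - M (fs i) fz * M fz j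
    lemma : ∀ p s x d → p * (s * (x * d)) ≡ s * (x * (p * d))
    lemma = solve-∀
    lemma₂ : ∀ a b → a * (b * 0ℤ) ≡ 0ℤ
    lemma₂ = solve-∀
    lemma₃ : ∀ x y → x * y + - y * x ≡ 0ℤ
    lemma₃ = solve-∀
    col : ∀ i → N i fz ≡ 0ℤ
    col i = lemma₃ a (M (fs i) fz)
    zero-column : ∀ {m} (P : Matrix (suc m) (suc m)) → (∀ i → P i fz ≡ 0ℤ) → detℤ P ≡ 0ℤ
    vanish : ∀ m (P : Matrix m (suc m)) → (∀ i → P i fz ≡ 0ℤ) → ∀ j → detℤ (λ i k → P i (punchIn (fs j) k)) ≡ 0ℤ
    vanish (suc m) P eq j = zero-column (λ i k → P i (punchIn (fs j) k)) eq
    zero-column {m} P eq = trans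
      (cong₂ _+_ (trans (cong (λ x → 1ℤ * (x * detℤ (λ i k → P (fs i) (fs k)))) (eq fz)) refl)
         (sum-zero (λ j → sgn (toℕ (fs j)) * (P fz (fs j) * cofactor (P ∘ fs) (fs j))) λ j → trans
             (cong (λ d → sgn (toℕ (fs j)) * (P fz (fs j) * d)) (vanish m (P ∘ fs) (eq ∘ fs) j))
             (lemma₂ (sgn (toℕ (fs j))) (P fz (fs j)))))
      refl

  -- By induction the minors of the row expansion are expanded along their first column, and the two
  -- summations are exchanged. Invariance under transposition follows.
  detℤ-first-column : ∀ {n} (M : Matrix (suc n) (suc n)) →
    detℤ M ≡ sum λ i → sgn (toℕ i) * (M i fz * detℤ (λ k l → M (punchIn i k) (fs l)))
  detℤ-first-column {zero}  M = refl
  detℤ-first-column {suc n} M = cong (1ℤ * (M fz fz * detℤ (λ k l → M (fs k) (fs l))) +_) (begin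
    sum (λ j → - sgn (toℕ j) * (M fz (fs j) * detℤ (λ i k → M (fs i) (punchIn (fs j) k))))
      ≡⟨ sum-cong-≗ (λ j → cong (λ d → - sgn (toℕ j) * (M fz (fs j) * d))
          (detℤ-first-column (λ i k → M (fs i) (punchIn (fs j) k)))) ⟩
    sum (λ j → - sgn (toℕ j) * (M fz (fs j) * sum λ i → sgn (toℕ i) * (M (fs i) fz * D i j)))
      ≡⟨ sum-cong-≗ (λ j → trans (assoc (- sgn (toℕ j)) (M fz (fs j)) (sum λ i → sgn (toℕ i) * (M (fs i) fz * D i j)))
           (*-distribˡ-sum (- sgn (toℕ j) * M fz (fs j)) (λ i → sgn (toℕ i) * (M (fs i) fz * D i j)))) ⟩
    sum (λ j → sum λ i → (- sgn (toℕ j) * M fz (fs j)) * (sgn (toℕ i) * (M (fs i) fz * D i j)))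
      ≡⟨ ∑-comm (λ j i → (- sgn (toℕ j) * M fz (fs j)) * (sgn (toℕ i) * (M (fs i) fz * D i j))) ⟩
    sum (λ i → sum λ j → (- sgn (toℕ j) * M fz (fs j)) * (sgn (toℕ i) * (M (fs i) fz * D i j)))
      ≡⟨ sum-cong-≗ (λ i → trans (sum-cong-≗ λ j → rearrange (sgn (toℕ j)) (M fz (fs j)) (sgn (toℕ i)) (M (fs i) fz)
          (D i j)) (sym (*-distribˡ-sum (- sgn (toℕ i) * M (fs i) fz) (λ j → sgn (toℕ j) * (M fz (fs j) * D i j))))) ⟩
    sum (λ i → (- sgn (toℕ i) * M (fs i) fz) * sum λ j → sgn (toℕ j) * (M fz (fs j) * D i j))
      ≡⟨ sum-cong-≗ (λ i → sym (assoc (- sgn (toℕ i)) (M (fs i) fz) (sum λ j → sgn (toℕ j) * (M fz (fs j) * D i j))))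
          ⟩
    sum (λ i → - sgn (toℕ i) * (M (fs i) fz * sum λ j → sgn (toℕ j) * (M fz (fs j) * D i j))) ∎)
    where
    open ≡-Reasoning
    D : Fin (suc n) → Fin (suc n) → ℤ
    D i j = detℤ λ k l → M (fs (punchIn i k)) (fs (punchIn j l))
    assoc : ∀ a b c → a * (b * c) ≡ (a * b) * c
    assoc = solve-∀
    rearrange : ∀ a b c d e → (- a * b) * (c * (d * e)) ≡ (- c * d) * (a * (b * e))
    rearrange = solve-∀

  detℤ-transpose : ∀ {n} (M : Matrix n n) → detℤ (λ i j → M j i) ≡ detℤ M
  detℤ-transpose {zero}  M = refl
  detℤ-transpose {suc n} M = trans
    (sum-cong-≗ λ j → cong (λ d → sgn (toℕ j) * (M j fz * d)) (detℤ-transpose (λ k l → M (punchIn j k) (fs l))))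
    (sym (detℤ-first-column M))

  -- The cyclic permutation that brings `i` to the front and keeps the order of the rest; it moves a
  -- nonzero entry or coordinate to position 0.
  rot : ∀ {n} → Fin (suc n) → Fin (suc n) → Fin (suc n)
  rot i fz     = i
  rot i (fs k) = punchIn i k

  unrot : ∀ {n} → Fin (suc n) → Fin (suc n) → Fin (suc n)
  unrot i l with i ≟ᶠ l
  ... | yes _  = fz
  ... | no i≢l = fs (punchOut i≢l)

  rot-unrot : ∀ {n} (i l : Fin (suc n)) → rot i (unrot i l) ≡ l
  rot-unrot i l with i ≟ᶠ l
  ... | yes i≡l = i≡l
  ... | no i≢l  = punchIn-punchOut i≢l

  unrot-rot : ∀ {n} (i l : Fin (suc n)) → unrot i (rot i l) ≡ l
  unrot-rot i fz with i ≟ᶠ i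
  ... | yes _  = refl
  ... | no i≢i = ⊥-elim (i≢i refl)
  unrot-rot i (fs k) with i ≟ᶠ punchIn i k
  ... | yes i≡  = ⊥-elim (punchInᵢ≢i i k (sym i≡))
  ... | no  i≢  = cong fs (trans (punchOut-cong i refl) (punchOut-punchIn i))

  sum-rot : ∀ {n} (i : Fin (suc n)) (f : Vector ℤ (suc n)) → sum (f ∘ rot i) ≡ sum f
  sum-rot i f = sym (sum-remove {i = i} f)

  detℤ-rot-rows : ∀ {n} (i : Fin (suc n)) (M : Matrix (suc n) (suc n)) →
    detℤ (λ k l → M (rot i k) l) ≡ sgn (toℕ i) * detℤ M
  detℤ-rot-rows fz M = trans (detℤ-cong {M = λ k l → M (rot fz k) l} {N = M} λ { fz j → refl ; (fs k) j → refl })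
      (sym (*-identityˡ (detℤ M)))
  detℤ-rot-rows {suc n} (fs i) M = begin
    detℤ (λ k l → M (rot (fs i) k) l)
      ≡⟨ expand-congʳ (M (fs i)) (λ k → M (punchIn (fs i) k)) (M fz ∷ λ k → M (fs (punchIn i k)))
          (λ { fz j → refl ; (fs k) j → refl }) ⟩
    expand (M (fs i)) (M fz ∷ (λ k l → M (fs (punchIn i k)) l))
      ≡⟨ expand-swap (M (fs i)) (M fz) (λ k → M (fs (punchIn i k))) ⟩
    - expand (M fz) (M (fs i) ∷ (λ k l → M (fs (punchIn i k)) l))
      ≡⟨ cong -_ (expand-congʳ (M fz) (M (fs i) ∷ λ k → M (fs (punchIn i k))) (λ k → M (fs (rot i k)))
          (λ { fz j → refl ; (fs k) j → refl })) ⟩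
    - expand (M fz) (λ k l → M (fs (rot i k)) l)
      ≡⟨ cong -_ (sum-cong-≗ λ j → trans
           (cong (λ d → sgn (toℕ j) * (M fz j * d)) (detℤ-rot-rows i (λ k l → M (fs k) (punchIn j l))))
           (rearrange (sgn (toℕ j)) (M fz j) (sgn (toℕ i)) (cofactor (M ∘ fs) j))) ⟩
    - sum (λ j → sgn (toℕ i) * (sgn (toℕ j) * (M fz j * detℤ (λ k l → M (fs k) (punchIn j l)))))
      ≡⟨ cong -_ (sym (*-distribˡ-sum (sgn (toℕ i)) (λ j → sgn (toℕ j) * (M fz j * cofactor (M ∘ fs) j)))) ⟩
    - (sgn (toℕ i) * detℤ M)
      ≡⟨ neg-distribˡ-* (sgn (toℕ i)) (detℤ M) ⟩
    - sgn (toℕ i) * detℤ M ∎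
    where
    open ≡-Reasoning
    rearrange : ∀ a b c d → a * (b * (c * d)) ≡ c * (a * (b * d))
    rearrange = solve-∀

  -- The row rotation and the column rotation have the same sign, so the two signs cancel.
  detℤ-rot : ∀ {n} (i : Fin (suc n)) (M : Matrix (suc n) (suc n)) → detℤ (λ k l → M (rot i k) (rot i l)) ≡ detℤ M
  detℤ-rot i M = begin
    detℤ (λ k l → M (rot i k) (rot i l))               ≡⟨ detℤ-rot-rows i (λ k l → M k (rot i l)) ⟩
    σ * detℤ (λ k l → M k (rot i l))                   ≡⟨ cong (σ *_) (sym (detℤ-transpose (λ k l → M k (rot i l)))) ⟩
    σ * detℤ (λ k l → M l (rot i k))                   ≡⟨ cong (σ *_) (detℤ-rot-rows i (λ k l → M l k)) ⟩
    σ * (σ * detℤ (λ k l → M l k))                     ≡⟨ sym (*-assoc σ σ (detℤ λ k l → M l k)) ⟩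
    (σ * σ) * detℤ (λ k l → M l k)                     ≡⟨ cong₂ _*_ (sgn² (toℕ i)) (detℤ-transpose M) ⟩
    1ℤ * detℤ M                                        ≡⟨ *-identityˡ (detℤ M) ⟩
    detℤ M ∎
    where
    open ≡-Reasoning
    σ = sgn (toℕ i)

  -- By linearity only the multiple of row 0 itself counts; every other summand repeats a lower row.
  detℤ-combine-row₀ : ∀ {n} (M : Matrix (suc n) (suc n)) (x : Vector ℤ (suc n)) →
    expand (λ j → sum λ l → x l * M l j) (M ∘ fs) ≡ x fz * detℤ M
  detℤ-combine-row₀ M x = trans (expand-sum (λ l j → x l * M l j) (M ∘ fs))
    (trans (cong₂ _+_ (expand-* (x fz) (M fz) (M ∘ fs))
      (sum-zero (λ l → expand (λ j → x (fs l) * M (fs l) j) (M ∘ fs)) λ l → trans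
          (expand-* (x (fs l)) (M (fs l)) (M ∘ fs))
        (trans (cong (x (fs l) *_) (expand-dup (M (fs l)) (M ∘ fs) l (λ _ → refl))) (*-zeroʳ (x (fs l))))))
      (+-identityʳ (x fz * detℤ M)))

  NonZeroVec : ∀ {n} → Vector ℤ n → Set
  NonZeroVec x = ∃[ i ] x i ≢ 0ℤ

  nonzero? : ∀ {n} (x : Vector ℤ n) → NonZeroVec x ⊎ (∀ i → x i ≡ 0ℤ)
  nonzero? x with any? (λ i → ¬? (x i ≟ 0ℤ))
  ... | yes p = inj₁ p
  ... | no ¬p = inj₂ λ i → decidable-stable (x i ≟ 0ℤ) (λ xi≢0 → ¬p (i , xi≢0))

  *-nonzero : ∀ {a b} → a ≢ 0ℤ → b ≢ 0ℤ → a * b ≢ 0ℤ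
  *-nonzero {a} a≢0 b≢0 ab≡0 = [ a≢0 , b≢0 ]′ (i*j≡0⇒i≡0∨j≡0 a ab≡0)

  *-cancel-0 : ∀ {a b} → a ≢ 0ℤ → a * b ≡ 0ℤ → b ≡ 0ℤ
  *-cancel-0 {a} a≢0 ab≡0 = [ (λ a≡0 → contradiction a≡0 a≢0) , id ]′ (i*j≡0⇒i≡0∨j≡0 a ab≡0)

  ^ℤ-nonzero : ∀ {a} → a ≢ 0ℤ → ∀ k → a ^ℤ k ≢ 0ℤ
  ^ℤ-nonzero a≢0 zero    ()
  ^ℤ-nonzero a≢0 (suc k) = *-nonzero a≢0 (^ℤ-nonzero a≢0 k)

  Kernel : ∀ {m n} → Matrix m n → Vector ℤ n → Set
  Kernel M x = ∀ i → sum (λ j → M i j * x j) ≡ 0ℤ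

  -- Fraction-free Gaussian elimination. If column 0 is zero, the first unit vector works; otherwise
  -- a nonzero entry of it becomes the pivot, and a kernel vector of the condensed matrix is lifted.
  singular⇒kernel : ∀ {n} (M : Matrix n n) → detℤ M ≡ 0ℤ → ∃[ x ] NonZeroVec x × Kernel M x
  singular⇒kernel {zero}  M ()
  singular⇒kernel {suc n} M det≡0 with nonzero? (λ i → M i fz)
  ... | inj₂ col≡0 = (1ℤ ∷ λ _ → 0ℤ) , (fz , λ ()) , λ i →
    cong₂ _+_ (trans (*-identityʳ (M i fz)) (col≡0 i)) (sum-zero (λ j → M i (fs j) * 0ℤ) λ j → *-zeroʳ (M i (fs j)))
  ... | inj₁ (p , a≢0) = x , (fs (proj₁ y≢0) , *-nonzero a≢0 (proj₂ y≢0)) , λ i → subst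
      (λ l → sum (λ j → M l j * x j) ≡ 0ℤ) (rot-unrot p i) (kernel (unrot p i))
    where
    M′ : Matrix (suc n) (suc n)
    M′ k l = M (rot p k) l
    a = M′ fz fz
    N : Matrix n n
    N i j = a * M′ (fs i) (fs j) + - (M′ (fs i) fz) * M′ fz (fs j)
    detN≡0 : detℤ N ≡ 0ℤ
    detN≡0 = *-cancel-0 a≢0 (trans (sym (detℤ-pivot M′)) (trans (cong ((a ^ℤ n) *_)
      (trans (detℤ-rot-rows p M) (trans (cong (sgn (toℕ p) *_) det≡0) (*-zeroʳ (sgn (toℕ p)))))) (*-zeroʳ (a ^ℤ n))))
    rec = singular⇒kernel N detN≡0
    y = proj₁ rec
    y≢0 = proj₁ (proj₂ rec)
    b = sum λ k → M′ fz (fs k) * y k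
    x : Vector ℤ (suc n)
    -- Row 0 demands a x₀ + Σ M′₀ₖ xₖ = 0. Taking a y for the other coordinates makes the solution
    -- x₀ = - b integral.
    x = - b ∷ λ k → a * y k
    dot : ∀ i → sum (λ k → M′ i (fs k) * (a * y k)) ≡ a * sum (λ k → M′ i (fs k) * y k)
    dot i = trans (sum-cong-≗ λ k → swap (M′ i (fs k)) a (y k)) (sym (*-distribˡ-sum a (λ k → M′ i (fs k) * y k)))
      where
      swap : ∀ u v w → u * (v * w) ≡ v * (u * w)
      swap = solve-∀
    kernel : ∀ i → sum (λ j → M′ i j * x j) ≡ 0ℤ
    kernel fz = trans (cong (a * - b +_) (dot fz)) (cancel a b)
      where
      cancel : ∀ a b → a * - b + a * b ≡ 0ℤ
      cancel = solve-∀
    kernel (fs i) = begin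
      m * - b + sum (λ k → M′ (fs i) (fs k) * (a * y k))       ≡⟨ cong (m * - b +_) (dot (fs i)) ⟩
      m * - b + a * sum (λ k → M′ (fs i) (fs k) * y k)         ≡⟨ reorder m b a (sum λ k → M′ (fs i) (fs k) * y k) ⟩
      a * sum (λ k → M′ (fs i) (fs k) * y k) + - m * b         ≡⟨ cong₂ _+_
          (*-distribˡ-sum a (λ k → M′ (fs i) (fs k) * y k)) (*-distribˡ-sum (- m) (λ k → M′ fz (fs k) * y k)) ⟩
      sum (λ k → a * (M′ (fs i) (fs k) * y k)) + sum (λ k → - m * (M′ fz (fs k) * y k))
                                                                ≡⟨ sym (∑-distrib-+ (λ k → a *
                                                                    (M′ (fs i) (fs k) * y k)) (λ k → - m *
                                                                    (M′ fz (fs k) * y k))) ⟩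
      sum (λ k → a * (M′ (fs i) (fs k) * y k) + - m * (M′ fz (fs k) * y k))
                                                                ≡⟨ sum-cong-≗ (λ k → collect a (M′ (fs i) (fs k))
                                                                    (y k) (- m) (M′ fz (fs k))) ⟩
      sum (λ k → N i k * y k)                                   ≡⟨ proj₂ (proj₂ rec) i ⟩
      0ℤ ∎
      where
      open ≡-Reasoning
      m = M′ (fs i) fz
      reorder : ∀ m b a s → m * - b + a * s ≡ a * s + - m * b
      reorder = solve-∀
      collect : ∀ a u y m v → a * (u * y) + m * (v * y) ≡ (a * u + m * v) * y
      collect = solve-∀

  dependent⇒singular : ∀ {n} (M : Matrix n n) (x : Vector ℤ n) → NonZeroVec x →
    (∀ j → sum (λ i → x i * M i j) ≡ 0ℤ) → detℤ M ≡ 0ℤ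
  dependent⇒singular {suc n} M x (p , xp≢0) rel =
    trans (sym (detℤ-rot p M)) (*-cancel-0 xp≢0 (trans
        (sym (detℤ-combine-row₀ (λ k l → M (rot p k) (rot p l)) (x ∘ rot p)))
      (expand-0 (λ j → sum λ l → x (rot p l) * M (rot p l) (rot p j)) (λ k l → M (rot p (fs k)) (rot p l)) λ j → trans
          (sum-rot p (λ l → x l * M l (rot p j))) (rel (rot p j)))))

-- Splitting kernel vectors off a pencil with a positive definite form.

module Elimination where

  open Determinant
  open import Data.Integer renaming (+_ to pos) using (ℤ; -_; -[1+_]; _+_; _*_; 0ℤ; 1ℤ; _≟_; _<_; +<+)
  open import Data.Integer.Properties using (+-*-semiring; *-zeroʳ; *-identityˡ; *-identityʳ; +-identityʳ;
      +-identityˡ; *-comm; *-assoc; <-irrefl)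
  open import Data.Integer.Tactic.RingSolver using (solve-∀)
  open import Data.Vec.Functional using (Vector; _∷_)
  open import Algebra.Properties.Semiring.Sum +-*-semiring using
      (sum; sum-cong-≗; *-distribˡ-sum; *-distribʳ-sum; ∑-distrib-+; ∑-comm)

  Symmetric : ∀ {n} → Matrix n n → Set
  Symmetric M = ∀ i j → M i j ≡ M j i

  -- Tests the diagonal on values, exactly as `charPoly` does, so that one case distinction reduces
  -- both.
  δ : ∀ {m n} → Fin m → Fin n → ℤ
  δ i j = if toℕ i ℕ.≡ᵇ toℕ j then 1ℤ else 0ℤ

  sum-δʳ : ∀ {n} (f : Vector ℤ n) j → sum (λ a → f a * δ a j) ≡ f j
  sum-δʳ f fz     = trans (cong₂ _+_ (*-identityʳ (f fz)) (sum-zero (λ a → f (fs a) * 0ℤ) (λ a → *-zeroʳ (f (fs a)))))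
      (+-identityʳ (f fz))
  sum-δʳ f (fs j) = trans (cong₂ _+_ (*-zeroʳ (f fz)) (sum-δʳ (f ∘ fs) j)) (+-identityˡ (f (fs j)))

  sum-δˡ : ∀ {n} (f : Vector ℤ n) i → sum (λ j → δ i j * f j) ≡ f i
  sum-δˡ f fz     = trans (cong₂ _+_ (*-identityˡ (f fz)) (sum-zero (λ a → 0ℤ * f (fs a)) (λ a → refl)))
      (+-identityʳ (f fz))
  sum-δˡ f (fs i) = trans (cong (0ℤ * f fz +_) (sum-δˡ (f ∘ fs) i)) (+-identityˡ (f (fs i)))

  dot : ∀ {n} → Vector ℤ n → Vector ℤ n → ℤ
  dot x y = sum λ i → x i * y i

  dot-comm : ∀ {n} (x y : Vector ℤ n) → dot x y ≡ dot y x
  dot-comm x y = sum-cong-≗ λ i → *-comm (x i) (y i)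

  dot-linearʳ : ∀ {n} a b (v x y : Vector ℤ n) → dot v (λ i → a * x i + b * y i) ≡ a * dot v x + b * dot v y
  dot-linearʳ a b v x y = begin
    sum (λ i → v i * (a * x i + b * y i))
      ≡⟨ sum-cong-≗ (λ i → lemma (v i) a (x i) b (y i)) ⟩
    sum (λ i → a * (v i * x i) + b * (v i * y i))
      ≡⟨ ∑-distrib-+ (λ i → a * (v i * x i)) (λ i → b * (v i * y i)) ⟩
    sum (λ i → a * (v i * x i)) + sum (λ i → b * (v i * y i))
      ≡⟨ cong₂ _+_ (sym (*-distribˡ-sum a (λ i → v i * x i))) (sym (*-distribˡ-sum b (λ i → v i * y i))) ⟩
    a * dot v x + b * dot v y ∎
    where
    open ≡-Reasoning
    lemma : ∀ v a x b y → v * (a * x + b * y) ≡ a * (v * x) + b * (v * y)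
    lemma = solve-∀

  dot-linearˡ : ∀ {n} a b (x y v : Vector ℤ n) → dot (λ i → a * x i + b * y i) v ≡ a * dot x v + b * dot y v
  dot-linearˡ a b x y v = trans (dot-comm (λ i → a * x i + b * y i) v)
    (trans (dot-linearʳ a b v x y) (cong₂ (λ p q → a * p + b * q) (dot-comm v x) (dot-comm v y)))

  infixr 8 _·_
  _·_ : ∀ {m n} → Matrix m n → Vector ℤ n → Vector ℤ m
  (S · x) i = dot (S i) x

  dot-assoc : ∀ {m n} (x : Vector ℤ m) (A : Matrix m n) (y : Vector ℤ n) →
    dot x (A · y) ≡ dot (λ a → sum λ i → x i * A i a) y
  dot-assoc x A y = begin
    sum (λ i → x i * sum (λ a → A i a * y a))      ≡⟨ sum-cong-≗ (λ i → *-distribˡ-sum (x i) (λ a → A i a * y a)) ⟩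
    sum (λ i → sum λ a → x i * (A i a * y a))      ≡⟨ ∑-comm (λ i a → x i * (A i a * y a)) ⟩
    sum (λ a → sum λ i → x i * (A i a * y a))      ≡⟨ sum-cong-≗
        (λ a → trans (sum-cong-≗ λ i → sym (*-assoc (x i) (A i a) (y a)))
        (sym (*-distribʳ-sum (y a) (λ i → x i * A i a)))) ⟩
    sum (λ a → sum (λ i → x i * A i a) * y a)      ∎
    where open ≡-Reasoning

  dot-symmetric : ∀ {n} (S : Matrix n n) → Symmetric S → ∀ x y → dot x (S · y) ≡ dot y (S · x)
  dot-symmetric S symS x y = begin
    dot x (S · y)                         ≡⟨ dot-assoc x S y ⟩
    dot (λ a → sum λ i → x i * S i a) y   ≡⟨ dot-comm (λ a → sum λ i → x i * S i a) y ⟩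
    dot y (λ a → sum λ i → x i * S i a)   ≡⟨ sum-cong-≗
        (λ a → cong (y a *_) (sum-cong-≗ λ i → trans (*-comm (x i) (S i a)) (cong (_* x i) (symS i a)))) ⟩
    dot y (S · x) ∎
    where open ≡-Reasoning

  PosDef : ∀ {n} → Matrix n n → Set
  PosDef S = ∀ x → NonZeroVec x → 0ℤ < dot x (S · x)

  *-pos : ∀ {a b} → 0ℤ < a → 0ℤ < b → 0ℤ < a * b
  *-pos {pos (suc a)} {pos (suc b)} _ _ = +<+ (ℕ.s≤s ℕ.z≤n)
  *-pos {pos zero} (+<+ ()) _
  *-pos {pos (suc a)} {pos zero} _ (+<+ ())

  *-pos-cancelˡ : ∀ {a b} → 0ℤ < a → 0ℤ < a * b → 0ℤ < b
  *-pos-cancelˡ {pos (suc a)} {pos (suc b)} _ _ = +<+ (ℕ.s≤s ℕ.z≤n)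
  *-pos-cancelˡ {pos (suc a)} {pos zero}    _ p = ⊥-elim (<-irrefl (sym (*-zeroʳ (pos (suc a)))) p)
  *-pos-cancelˡ {pos zero} (+<+ ()) _

  ^ℤ-pos : ∀ {a} → 0ℤ < a → ∀ k → 0ℤ < a ^ℤ k
  ^ℤ-pos 0<a zero    = +<+ (ℕ.s≤s ℕ.z≤n)
  ^ℤ-pos 0<a (suc k) = *-pos 0<a (^ℤ-pos 0<a k)

  square-pos : ∀ {a} → a ≢ 0ℤ → 0ℤ < a * a
  square-pos {pos zero}    a≢0 = ⊥-elim (a≢0 refl)
  square-pos {pos (suc _)} a≢0 = +<+ (ℕ.s≤s ℕ.z≤n)
  square-pos { -[1+ _ ]}   a≢0 = +<+ (ℕ.s≤s ℕ.z≤n)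

  pos⇒≢0 : ∀ {a} → 0ℤ < a → a ≢ 0ℤ
  pos⇒≢0 0<a a≡0 = <-irrefl (sym a≡0) 0<a

  -- The bound rank M ≤ r as a factorisation through r columns; the nonzero `c` clears the
  -- denominators.
  record Factor {m n : ℕ} (r : ℕ) (M : Matrix m n) : Set where
    field
      c     : ℤ
      c≢0   : c ≢ 0ℤ
      A     : Matrix m r
      R     : Matrix r n
      split : ∀ i j → c * M i j ≡ sum λ a → A i a * R a j

  Factor-transpose : ∀ {m n r} {M : Matrix m n} → Factor r M → Factor r (λ i j → M j i)
  Factor-transpose F = record
    { c = c ; c≢0 = c≢0 ; A = λ i a → R a i ; R = λ a j → A j a
    ; split = λ i j → trans (split j i) (dot-comm (A j) (λ a → R a i)) }
    where open Factor F

  -- As x₀ is nonzero, the relation expresses x₀ times row 0 through the lower rows, so no new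
  -- column of the factorisation is needed.
  Factor-row : ∀ {m n r} (M : Matrix (suc m) n) (x : Vector ℤ (suc m)) → x fz ≢ 0ℤ →
    (∀ j → sum (λ i → x i * M i j) ≡ 0ℤ) → Factor r (M ∘ fs) → Factor r M
  Factor-row {m} {n} {r} M x x₀≢0 rel F = record
    { c = x fz * c ; c≢0 = *-nonzero x₀≢0 c≢0 ; A = A′ ; R = R ; split = split′ }
    where
    open Factor F
    open ≡-Reasoning
    y : Vector ℤ r
    y a = sum λ i → x (fs i) * A i a
    A′ : Matrix (suc m) r
    -- The zero summand only brings the row into the shape to which `dot-linearˡ` applies.
    A′ fz     a = - 1ℤ * y a + 0ℤ * y a
    A′ (fs i) a = x fz * A i a + 0ℤ * A i a
    cancel : ∀ a b c → a + b ≡ 0ℤ → c * a ≡ - 1ℤ * (c * b)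
    cancel a b c a+b≡0 = trans (lemma a b c) (trans (cong (λ z → c * z + - 1ℤ * (c * b)) a+b≡0)
        (trans (cong (_+ - 1ℤ * (c * b)) (*-zeroʳ c)) (+-identityˡ (- 1ℤ * (c * b)))))
      where
      lemma : ∀ a b c → c * a ≡ c * (a + b) + - 1ℤ * (c * b)
      lemma = solve-∀
    drop0 : ∀ p q → p + 0ℤ * q ≡ p
    drop0 = solve-∀
    rotate : ∀ a b c → (a * b) * c ≡ b * (a * c)
    rotate = solve-∀
    split′ : ∀ i j → (x fz * c) * M i j ≡ sum λ a → A′ i a * R a j
    split′ fz j = begin
      (x fz * c) * M fz j
        ≡⟨ rotate (x fz) c (M fz j) ⟩
      c * (x fz * M fz j)
        ≡⟨ cancel (x fz * M fz j) (sum λ i → x (fs i) * M (fs i) j) c (rel j) ⟩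
      - 1ℤ * (c * sum λ i → x (fs i) * M (fs i) j)
        ≡⟨ cong (- 1ℤ *_) (*-distribˡ-sum c (λ i → x (fs i) * M (fs i) j)) ⟩
      - 1ℤ * sum (λ i → c * (x (fs i) * M (fs i) j))
        ≡⟨ cong (- 1ℤ *_) (sum-cong-≗ λ i → trans (sym (rotate (x (fs i)) c (M (fs i) j)))
            (trans (*-assoc (x (fs i)) c (M (fs i) j)) (cong (x (fs i) *_) (split i j)))) ⟩
      - 1ℤ * dot (x ∘ fs) (A · λ a → R a j)
        ≡⟨ cong (- 1ℤ *_) (dot-assoc (x ∘ fs) A (λ a → R a j)) ⟩
      - 1ℤ * dot y (λ a → R a j)
        ≡⟨ sym (drop0 (- 1ℤ * dot y (λ a → R a j)) (dot y (λ a → R a j))) ⟩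
      - 1ℤ * dot y (λ a → R a j) + 0ℤ * dot y (λ a → R a j)
        ≡⟨ sym (dot-linearˡ (- 1ℤ) 0ℤ y y (λ a → R a j)) ⟩
      sum (λ a → A′ fz a * R a j) ∎
    split′ (fs i) j = begin
      (x fz * c) * M (fs i) j                            ≡⟨ *-assoc (x fz) c (M (fs i) j) ⟩
      x fz * (c * M (fs i) j)                            ≡⟨ cong (x fz *_) (split i j) ⟩
      x fz * dot (A i) (λ a → R a j)                     ≡⟨ sym
          (drop0 (x fz * dot (A i) (λ a → R a j)) (dot (A i) (λ a → R a j))) ⟩
      x fz * dot (A i) (λ a → R a j) + 0ℤ * dot (A i) (λ a → R a j)
                                                         ≡⟨ sym (dot-linearˡ (x fz) 0ℤ (A i) (A i) (λ a → R a j)) ⟩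
      sum (λ a → A′ (fs i) a * R a j) ∎

  -- By symmetry the kernel vector is a relation between the columns as well as between the rows, so
  -- restoring the column and then the row leaves the rank bound unchanged.
  Factor-border : ∀ {n r} (M : Matrix (suc n) (suc n)) → Symmetric M → ∀ x → x fz ≢ 0ℤ → Kernel M x →
    Factor r (λ i j → M (fs i) (fs j)) → Factor r M
  Factor-border M symM x x₀≢0 ker F =
    Factor-row M x x₀≢0 (λ j → rel j)
      (Factor-transpose (Factor-row (λ j i → M (fs i) j) x x₀≢0 (λ i → trans (dot-comm x (M (fs i))) (ker (fs i)))
        (Factor-transpose F)))
    where
    rel : ∀ j → sum (λ i → x i * M i j) ≡ 0ℤ
    rel j = trans (sum-cong-≗ λ i → trans (*-comm (x i) (M i j)) (cong (_* x i) (symM i j))) (ker j)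

  -- For S = I, d = 1, M = A + I and t = x + 1 this is x I - A, so the eigenvalue -1 sits at t = 0.
  -- The scalar `d` collects the scalings of later eliminations.
  shifted : ∀ {n} → ℤ → Matrix n n → ℤ → Matrix n n → Matrix n n
  shifted t S d M i j = t * S i j + - (d * M i j)

  module Eliminate {n : ℕ} (S M : Matrix (suc n) (suc n)) (symS : Symmetric S) (symM : Symmetric M) (posS : PosDef S)
    (x : Vector ℤ (suc n)) (x₀≢0 : x fz ≢ 0ℤ) (ker : Kernel M x) where

    w : Vector ℤ (suc n)
    w = S · x

    s : ℤ
    s = dot x w

    s>0 : 0ℤ < s
    s>0 = posS x (fz , x₀≢0)

    -- In the basis x, e₁, ..., eₙ the form S has corner s and border w; this is s times the Schur
    -- complement of that corner.
    S′ : Matrix n n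
    S′ i j = s * S (fs i) (fs j) + - (w (fs i)) * w (fs j)

    symS′ : Symmetric S′
    symS′ i j = trans (cong (λ z → s * z + - (w (fs i)) * w (fs j)) (symS (fs i) (fs j)))
        (lemma (s * S (fs j) (fs i)) (w (fs i)) (w (fs j)))
      where
      lemma : ∀ a b c → a + - b * c ≡ a + - c * b
      lemma = solve-∀

    -- The Cauchy–Schwarz argument: evaluate S at s ŷ − (w·ŷ) x, where ŷ extends y by zero.
    posS′ : PosDef S′
    posS′ y (k , yk≢0) = subst (0ℤ <_) (sym form) (*-pos-cancelˡ s>0 (subst (0ℤ <_) square (posS z z≢0)))
      where
      open ≡-Reasoning
      ŷ : Vector ℤ (suc n)
      ŷ = 0ℤ ∷ y
      q = dot w ŷ
      A = dot ŷ (S · ŷ)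
      z : Vector ℤ (suc n)
      z i = s * ŷ i + - q * x i
      z≢0 : NonZeroVec z
      z≢0 with q ≟ 0ℤ
      ... | yes q≡0 = fs k , λ eq → *-nonzero (pos⇒≢0 s>0) yk≢0
          (trans (lemma (s * y k) (x (fs k))) (trans (cong (λ u → s * y k + - u * x (fs k)) (sym q≡0)) eq))
        where
        lemma : ∀ a b → a ≡ a + - 0ℤ * b
        lemma = solve-∀
      ... | no  q≢0 = fz , λ eq → *-nonzero q≢0 x₀≢0 (trans (lemma s q (x fz)) (cong -_ eq))
        where
        lemma : ∀ s q x → q * x ≡ - (s * 0ℤ + - q * x)
        lemma = solve-∀
      square : dot z (S · z) ≡ s * (s * A + - q * q)
      square = begin
        dot z (S · z)
          ≡⟨ sum-cong-≗ (λ i → cong (z i *_) (dot-linearʳ s (- q) (S i) ŷ x)) ⟩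
        dot z (λ i → s * (S · ŷ) i + - q * w i)
          ≡⟨ dot-linearʳ s (- q) z (S · ŷ) w ⟩
        s * dot z (S · ŷ) + - q * dot z w
          ≡⟨ cong₂ (λ a b → s * a + - q * b) (dot-linearˡ s (- q) ŷ x (S · ŷ)) (dot-linearˡ s (- q) ŷ x w) ⟩
        s * (s * A + - q * dot x (S · ŷ)) + - q * (s * dot ŷ w + - q * s)
          ≡⟨ cong₂ (λ a b → s * (s * A + - q * a) + - q * (s * b + - q * s))
              (trans (dot-symmetric S symS x ŷ) (dot-comm ŷ w)) (dot-comm ŷ w) ⟩
        s * (s * A + - q * q) + - q * (s * q + - q * s)
          ≡⟨ lemma s A q ⟩
        s * (s * A + - q * q) ∎
        where
        lemma : ∀ s A q → s * (s * A + - q * q) + - q * (s * q + - q * s) ≡ s * (s * A + - q * q)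
        lemma = solve-∀
      row : ∀ i → (S′ · y) i ≡ s * (S · ŷ) (fs i) + - q * w (fs i)
      row i = begin
        dot (λ j → s * S (fs i) (fs j) + - (w (fs i)) * w (fs j)) y
          ≡⟨ dot-linearˡ s (- w (fs i)) (λ j → S (fs i) (fs j)) (w ∘ fs) y ⟩
        s * dot (λ j → S (fs i) (fs j)) y + - w (fs i) * dot (w ∘ fs) y
          ≡⟨ lemma s (S (fs i) fz) (dot (λ j → S (fs i) (fs j)) y) (w (fs i)) (w fz) (dot (w ∘ fs) y) ⟩
        s * (S · ŷ) (fs i) + - q * w (fs i) ∎
        where
        lemma : ∀ s p a u v b → s * a + - u * b ≡ s * (p * 0ℤ + a) + - (v * 0ℤ + b) * u
        lemma = solve-∀
      form : dot y (S′ · y) ≡ s * A + - q * q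
      form = begin
        dot y (S′ · y)
          ≡⟨ sum-cong-≗ (λ i → cong (y i *_) (row i)) ⟩
        dot y (λ i → s * (S · ŷ) (fs i) + - q * w (fs i))
          ≡⟨ dot-linearʳ s (- q) y ((S · ŷ) ∘ fs) (w ∘ fs) ⟩
        s * dot y ((S · ŷ) ∘ fs) + - q * dot y (w ∘ fs)
          ≡⟨ lemma s ((S · ŷ) fz) (dot y ((S · ŷ) ∘ fs)) q (w fz) (dot y (w ∘ fs)) ⟩
        s * A + - q * dot ŷ w
          ≡⟨ cong (λ u → s * A + - q * u) (dot-comm ŷ w) ⟩
        s * A + - q * q ∎
        where
        lemma : ∀ s p a q v b → s * a + - q * b ≡ s * (0ℤ * p + a) + - q * (0ℤ * v + b)
        lemma = solve-∀

    -- Multiplying the zeroth row and then the zeroth column by the kernel vector turns t S − d M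
    -- into a matrix whose zeroth row and column are t times those of S, which is then the pivot.
    det-eliminate : ∀ t d → ((s ^ℤ n) * (x fz * x fz)) * detℤ (shifted t S d M) ≡
      (t * s) * detℤ (shifted t S′ (s * d) (λ i j → M (fs i) (fs j)))
    det-eliminate t d = begin
      ((s ^ℤ n) * (x fz * x fz)) * detℤ T
        ≡⟨ lemma₁ (s ^ℤ n) (x fz) (detℤ T) ⟩
      ((s ^ℤ n) * x fz) * (x fz * detℤ T)
        ≡⟨ cong (((s ^ℤ n) * x fz) *_) row-step ⟩
      ((s ^ℤ n) * x fz) * (t * detℤ T₂)
        ≡⟨ lemma₂ (s ^ℤ n) (x fz) t (detℤ T₂) ⟩
      t * ((s ^ℤ n) * (x fz * detℤ T₂))
        ≡⟨ cong (λ z → t * ((s ^ℤ n) * z)) column-step ⟩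
      t * ((s ^ℤ n) * detℤ U)
        ≡⟨ cong (t *_) (detℤ-pivot U) ⟩
      t * (s * detℤ (λ i j → s * T (fs j) (fs i) + - w (fs i) * (t * w (fs j))))
        ≡⟨ sym (*-assoc t s (detℤ (λ i j → s * T (fs j) (fs i) + - w (fs i) * (t * w (fs j))))) ⟩
      (t * s) * detℤ (λ i j → s * T (fs j) (fs i) + - w (fs i) * (t * w (fs j)))
        ≡⟨ cong ((t * s) *_) (detℤ-cong entry) ⟩
      (t * s) * detℤ (shifted t S′ (s * d) (λ i j → M (fs i) (fs j))) ∎
      where
      open ≡-Reasoning
      T : Matrix (suc n) (suc n)
      T = shifted t S d M
      T₂ : Matrix (suc n) (suc n)
      T₂ = w ∷ (T ∘ fs)
      U : Matrix (suc n) (suc n)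
      U = (s ∷ λ k → t * w (fs k)) ∷ λ i j → T₂ j (fs i)
      lemma₁ : ∀ p x D → (p * (x * x)) * D ≡ (p * x) * (x * D)
      lemma₁ = solve-∀
      lemma₂ : ∀ p x t D → (p * x) * (t * D) ≡ t * (p * (x * D))
      lemma₂ = solve-∀
      negate : ∀ d m → - (d * m) ≡ - d * m
      negate = solve-∀
      Tx : ∀ i → dot x (T i) ≡ t * w i
      Tx i = begin
        dot x (T i)
          ≡⟨ sum-cong-≗ (λ j → cong (λ z → x j * (t * S i j + z)) (negate d (M i j))) ⟩
        dot x (λ j → t * S i j + - d * M i j)
          ≡⟨ dot-linearʳ t (- d) x (S i) (M i) ⟩
        t * dot x (S i) + - d * dot x (M i)
          ≡⟨ cong₂ (λ a b → t * a + - d * b) (dot-comm x (S i)) (trans (dot-comm x (M i)) (ker i)) ⟩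
        t * w i + - d * 0ℤ
          ≡⟨ lemma (t * w i) d ⟩
        t * w i ∎
        where
        lemma : ∀ a d → a + - d * 0ℤ ≡ a
        lemma = solve-∀
      symT : Symmetric T
      symT i j = cong₂ (λ a b → t * a + - (d * b)) (symS i j) (symM i j)
      row-step : x fz * detℤ T ≡ t * detℤ T₂
      row-step = begin
        x fz * detℤ T
          ≡⟨ sym (detℤ-combine-row₀ T x) ⟩
        expand (λ j → sum λ l → x l * T l j) (T ∘ fs)
          ≡⟨ expand-cong {r = λ j → sum λ l → x l * T l j} {λ j → t * w j} {T ∘ fs} {T ∘ fs}
               (λ j → trans (sum-cong-≗ λ l → cong (x l *_) (symT l j)) (Tx j)) (λ _ _ → refl) ⟩
        expand (λ j → t * w j) (T ∘ fs)
          ≡⟨ expand-* t w (T ∘ fs) ⟩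
        t * detℤ T₂ ∎
      column-step : x fz * detℤ T₂ ≡ detℤ U
      column-step = begin
        x fz * detℤ T₂
          ≡⟨ cong (x fz *_) (sym (detℤ-transpose T₂)) ⟩
        x fz * detℤ (λ i j → T₂ j i)
          ≡⟨ sym (detℤ-combine-row₀ (λ i j → T₂ j i) x) ⟩
        expand (λ j → dot x (T₂ j)) (λ i j → T₂ j (fs i))
          ≡⟨ expand-cong {r = λ j → dot x (T₂ j)} {s ∷ λ k → t * w (fs k)} {λ i j → T₂ j (fs i)} {λ i j → T₂ j (fs i)}
               (λ { fz → refl ; (fs k) → Tx (fs k) }) (λ _ _ → refl) ⟩
        detℤ U ∎
      entry : ∀ i j → s * T (fs j) (fs i) + - w (fs i) * (t * w (fs j)) ≡
        shifted t S′ (s * d) (λ i j → M (fs i) (fs j)) i j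
      entry i j = trans (cong (λ z → s * z + - w (fs i) * (t * w (fs j))) (symT (fs j) (fs i)))
        (lemma s t (S (fs i) (fs j)) d (M (fs i) (fs j)) (w (fs i)) (w (fs j)))
        where
        lemma : ∀ s t S d M u v → s * (t * S + - (d * M)) + - u * (t * v) ≡ t * (s * S + - u * v) + - ((s * d) * M)
        lemma = solve-∀

  minor : ∀ {m n} → Matrix n n → (Fin m → Fin n) → Matrix m m
  minor M I i j = M (I i) (I j)

  -- The outcome after k kernel vectors: `regular` and `factor` together say that M has rank r, and
  -- `identity` splits off tᵏ. What remains at t = 0 is, up to scalars, the minor on `I`; the signs
  -- of `a`, `b` and `d′` are recorded so that its sign can be read off.
  record Reduction {n : ℕ} (S : Matrix n n) (d : ℤ) (M : Matrix n n) : Set where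
    field
      k r      : ℕ
      k+r≡n    : k ℕ.+ r ≡ n
      I        : Fin r → Fin n
      regular  : detℤ (minor M I) ≢ 0ℤ
      factor   : Factor r M
      S′       : Matrix r r
      a b d′   : ℤ
      a>0      : 0ℤ < a
      b>0      : 0ℤ < b
      d′>0     : 0ℤ < d′
      identity : ∀ t → a * detℤ (shifted t S d M) ≡ b * ((t ^ℤ k) * detℤ (shifted t S′ d′ (minor M I)))

  Reduction-rot : ∀ {n} (p : Fin (suc n)) {S : Matrix (suc n) (suc n)} {d} {M : Matrix (suc n) (suc n)} →
    Reduction (minor S (rot p)) d (minor M (rot p)) → Reduction S d M
  Reduction-rot p {S} {d} {M} red = record
    { k = k ; r = r ; k+r≡n = k+r≡n ; I = rot p ∘ I ; regular = regular
    ; factor = record { c = F.c ; c≢0 = F.c≢0 ; A = F.A ∘ unrot p ; R = λ a j → F.R a (unrot p j)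
                      ; split = λ i j → trans (cong₂ (λ k l → F.c * M k l) (sym (rot-unrot p i))
                          (sym (rot-unrot p j))) (F.split (unrot p i) (unrot p j)) }
    ; S′ = S′ ; a = a ; b = b ; d′ = d′ ; a>0 = a>0 ; b>0 = b>0 ; d′>0 = d′>0
    ; identity = λ t → trans (cong (a *_) (sym (detℤ-rot p (shifted t S d M)))) (identity t) }
    where
    open Reduction red
    module F = Factor factor

  PosDef-rot : ∀ {n} (p : Fin (suc n)) {S : Matrix (suc n) (suc n)} → PosDef S → PosDef (minor S (rot p))
  PosDef-rot {n} p {S} posS x (i , xi≢0) = subst (0ℤ <_) eq
      (posS y (rot p i , λ yi≡0 → xi≢0 (trans (sym (y∘rot i)) yi≡0)))
    where
    open ≡-Reasoning
    y : Vector ℤ (suc n)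
    y = x ∘ unrot p
    y∘rot : ∀ i → y (rot p i) ≡ x i
    y∘rot i = cong x (unrot-rot p i)
    eq : dot y (S · y) ≡ dot x (minor S (rot p) · x)
    eq = begin
      dot y (S · y)
        ≡⟨ sym (sum-rot p (λ i → y i * (S · y) i)) ⟩
      sum (λ i → y (rot p i) * (S · y) (rot p i))
        ≡⟨ sum-cong-≗ (λ i → cong₂ _*_ (y∘rot i) (trans (sym (sum-rot p (λ j → S (rot p i) j * y j)))
            (sum-cong-≗ λ j → cong (S (rot p i) (rot p j) *_) (y∘rot j)))) ⟩
      dot x (minor S (rot p) · x) ∎

  reduce : ∀ n (S M : Matrix n n) → Symmetric S → Symmetric M → PosDef S → ∀ d → 0ℤ < d → Reduction S d M
  reduce n S M symS symM posS d d>0 with detℤ M ≟ 0ℤ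
  ... | no det≢0 = record
    { k = 0 ; r = n ; k+r≡n = refl ; I = id ; regular = det≢0
    ; factor = record { c = 1ℤ ; c≢0 = λ () ; A = M ; R = δ ; split = λ i j → trans (*-identityˡ (M i j))
        (sym (sum-δʳ (M i) j)) }
    ; S′ = S ; a = 1ℤ ; b = 1ℤ ; d′ = d ; a>0 = +<+ (ℕ.s≤s ℕ.z≤n) ; b>0 = +<+ (ℕ.s≤s ℕ.z≤n) ; d′>0 = d>0
    ; identity = λ t → cong (1ℤ *_) (sym (*-identityˡ (detℤ (shifted t S d M)))) }
  reduce zero    S M symS symM posS d d>0 | yes ()
  reduce (suc n) S M symS symM posS d d>0 | yes det≡0 with singular⇒kernel M det≡0
  ... | x , (p , xp≢0) , ker = Reduction-rot p record
    { k = suc k ; r = r ; k+r≡n = cong suc k+r≡n ; I = fs ∘ I ; regular = regular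
    ; factor = Factor-border M₀ symM₀ (x ∘ rot p) xp≢0 ker₀ factor
    -- The new factors of `a` and `b` are those of `det-eliminate`: powers of s and the square of
    -- the chosen coordinate, all positive.
    ; S′ = S₂ ; a = a * ((s ^ℤ n) * (x p * x p)) ; b = s * b ; d′ = d′
    ; a>0 = *-pos a>0 (*-pos (^ℤ-pos s>0 n) (square-pos xp≢0)) ; b>0 = *-pos s>0 b>0 ; d′>0 = d′>0
    ; identity = λ t → begin
        (a * ((s ^ℤ n) * (x p * x p))) * detℤ (shifted t S₀ d M₀)
          ≡⟨ *-assoc a ((s ^ℤ n) * (x p * x p)) (detℤ (shifted t S₀ d M₀)) ⟩
        a * (((s ^ℤ n) * (x p * x p)) * detℤ (shifted t S₀ d M₀))
          ≡⟨ cong (a *_) (det-eliminate t d) ⟩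
        a * ((t * s) * detℤ (shifted t E.S′ (s * d) (minor M₀ fs)))
          ≡⟨ lemma₁ a t s (detℤ (shifted t E.S′ (s * d) (minor M₀ fs))) ⟩
        (t * s) * (a * detℤ (shifted t E.S′ (s * d) (minor M₀ fs)))
          ≡⟨ cong ((t * s) *_) (identity t) ⟩
        (t * s) * (b * ((t ^ℤ k) * detℤ (shifted t S₂ d′ (minor M₀ (fs ∘ I)))))
          ≡⟨ lemma₂ t s b (t ^ℤ k) (detℤ (shifted t S₂ d′ (minor M₀ (fs ∘ I)))) ⟩
        (s * b) * ((t * (t ^ℤ k)) * detℤ (shifted t S₂ d′ (minor M₀ (fs ∘ I)))) ∎ }
    where
    open ≡-Reasoning
    S₀ = minor S (rot p)
    M₀ = minor M (rot p)
    symM₀ : Symmetric M₀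
    symM₀ i j = symM (rot p i) (rot p j)
    ker₀ : Kernel M₀ (x ∘ rot p)
    ker₀ i = trans (sum-rot p (λ j → M (rot p i) j * x j)) (ker (rot p i))
    module E = Eliminate S₀ M₀ (λ i j → symS (rot p i) (rot p j)) symM₀ (PosDef-rot p {S} posS) (x ∘ rot p) xp≢0 ker₀
    open E using (s; s>0; det-eliminate)
    open Reduction (reduce n E.S′ (minor M₀ fs) E.symS′ (λ i j → symM₀ (fs i) (fs j)) E.posS′ (s * d) (*-pos s>0 d>0))
        renaming (S′ to S₂)
    lemma₁ : ∀ a t s D → a * ((t * s) * D) ≡ (t * s) * (a * D)
    lemma₁ = solve-∀
    lemma₂ : ∀ t s b u D → (t * s) * (b * (u * D)) ≡ (s * b) * ((t * u) * D)
    lemma₂ = solve-∀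

-- From the reduction to vanishing minors and to the multiplicity of -1.

module Spectrum where

  open Determinant
  open Elimination
  open import Data.Integer renaming (+_ to pos) using (ℤ; -_; _+_; _*_; 0ℤ; 1ℤ; _≟_; _<_; _≤_; +<+; ∣_∣)
  open import Data.Integer.Properties using (+-*-semiring; *-zeroʳ; *-identityˡ; *-identityʳ; +-identityʳ;
      +-identityˡ; *-comm; *-assoc; ≤-refl; <⇒≤; +-mono-≤; +-mono-<-≤; +-mono-≤-<; abs-*; ∣-i∣≡∣i∣; ∣i∣≡0⇒i≡0)
  open import Data.Integer.Tactic.RingSolver using (solve-∀)
  open import Data.Fin.Properties using (splitAt-↑ˡ; splitAt-↑ʳ)
  open import Data.List using ([]; _∷_)
  open import Data.Vec.Functional using (Vector)
  open import Algebra.Properties.Semiring.Sum +-*-semiring using (sum; sum-cong-≗; *-distribˡ-sum)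

  -- The r columns of A (J i) are padded with zero columns to a singular square matrix, whose kernel
  -- gives a relation between the rows J i of M.
  wide-minor-singular : ∀ {n} {M : Matrix n n} r d → Factor r M → (J : Fin (r ℕ.+ suc d) → Fin n) → detℤ (minor M J) ≡
      0ℤ
  wide-minor-singular {n} {M} r d F J with singular⇒kernel P detP≡0
    where
    open Factor F
    P : Matrix (r ℕ.+ suc d) (r ℕ.+ suc d)
    P a i = [ A (J i) , (λ _ → 0ℤ) ]′ (splitAt r a)
    detP≡0 : detℤ P ≡ 0ℤ
    detP≡0 = detℤ-zero-row P (r ↑ʳ fz) (λ i → cong [ A (J i) , (λ _ → 0ℤ) ]′ (splitAt-↑ʳ r (suc d) fz))
  ... | x , x≢0 , ker = dependent⇒singular (minor M J) x x≢0 (λ j → *-cancel-0 c≢0 (begin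
      c * sum (λ i → x i * M (J i) (J j))
        ≡⟨ *-distribˡ-sum c (λ i → x i * M (J i) (J j)) ⟩
      sum (λ i → c * (x i * M (J i) (J j)))
        ≡⟨ sum-cong-≗ (λ i → trans (lemma c (x i) (M (J i) (J j))) (cong (x i *_) (split (J i) (J j)))) ⟩
      dot x (A ∘ J · λ a → R a (J j))
        ≡⟨ dot-assoc x (A ∘ J) (λ a → R a (J j)) ⟩
      sum (λ a → sum (λ i → x i * A (J i) a) * R a (J j))
        ≡⟨ sum-zero (λ a → sum (λ i → x i * A (J i) a) * R a (J j)) (λ a → cong (_* R a (J j)) (relation a)) ⟩
      0ℤ ∎))
    where
    open Factor F
    open ≡-Reasoning
    lemma : ∀ c x m → c * (x * m) ≡ x * (c * m)
    lemma = solve-∀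
    relation : ∀ a → sum (λ i → x i * A (J i) a) ≡ 0ℤ
    relation a = trans (sum-cong-≗ λ i → trans (*-comm (x i) (A (J i) a))
      (cong (λ s → [ A (J i) , (λ _ → 0ℤ) ]′ s * x i) (sym (splitAt-↑ˡ r a (suc d))))) (ker (a ↑ˡ suc d))

  minor-singular : ∀ {n} {M : Matrix n n} {r m} → Factor r M → r ℕ.< m → (J : Fin m → Fin n) → detℤ (minor M J) ≡ 0ℤ
  minor-singular {n} {M} {r} F r<m with ℕ.m≤n⇒∃[o]m+o≡n r<m
  ... | d , eq = subst (λ m → (J : Fin m → Fin n) → detℤ (minor M J) ≡ 0ℤ) (trans (ℕ.+-suc r d) eq)
      (wide-minor-singular r d F)

  square-nonneg : ∀ a → 0ℤ ≤ a * a
  square-nonneg a with a ≟ 0ℤ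
  ... | yes refl = ≤-refl
  ... | no a≢0   = <⇒≤ (square-pos a≢0)

  sum-squares-nonneg : ∀ {n} (x : Vector ℤ n) → 0ℤ ≤ sum (λ i → x i * x i)
  sum-squares-nonneg {zero}  x = ≤-refl
  sum-squares-nonneg {suc n} x = +-mono-≤ (square-nonneg (x fz)) (sum-squares-nonneg (x ∘ fs))

  sum-squares-pos : ∀ {n} (x : Vector ℤ n) i → x i ≢ 0ℤ → 0ℤ < sum (λ i → x i * x i)
  sum-squares-pos x fz     xi≢0 = +-mono-<-≤ (square-pos xi≢0) (sum-squares-nonneg (x ∘ fs))
  sum-squares-pos x (fs i) xi≢0 = +-mono-≤-< (square-nonneg (x fz)) (sum-squares-pos (x ∘ fs) i xi≢0)

  δ-posDef : ∀ {n} → PosDef (δ {n} {n})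
  δ-posDef x (i , xi≢0) = subst (0ℤ <_) (sum-cong-≗ λ i → cong (x i *_) (sym (sum-δˡ x i))) (sum-squares-pos x i xi≢0)

  δ-sym : ∀ {n} → Symmetric (δ {n} {n})
  δ-sym i j = cong (if_then 1ℤ else 0ℤ) (≡ᵇ-sym (toℕ i) (toℕ j))

  -- Integer polynomials through their values.

  eval : Poly → ℤ → ℤ
  eval []      x = 0ℤ
  eval (a ∷ p) x = a + x * eval p x

  eval-+p : ∀ p q x → eval (p +p q) x ≡ eval p x + eval q x
  eval-+p []      q       x = sym (+-identityˡ (eval q x))
  eval-+p (a ∷ p) []      x = sym (+-identityʳ (eval (a ∷ p) x))
  eval-+p (a ∷ p) (b ∷ q) x = trans (cong (λ e → a + b + x * e) (eval-+p p q x)) (lemma a b x (eval p x) (eval q x))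
    where
    lemma : ∀ a b x p q → a + b + x * (p + q) ≡ a + x * p + (b + x * q)
    lemma = solve-∀

  eval-scalep : ∀ c p x → eval (scalep c p) x ≡ c * eval p x
  eval-scalep c []      x = sym (*-zeroʳ c)
  eval-scalep c (a ∷ p) x = trans (cong (λ e → c * a + x * e) (eval-scalep c p x)) (lemma c a x (eval p x))
    where
    lemma : ∀ c a x p → c * a + x * (c * p) ≡ c * (a + x * p)
    lemma = solve-∀

  eval-*p : ∀ p q x → eval (p *p q) x ≡ eval p x * eval q x
  eval-*p []      q x = refl
  eval-*p (a ∷ p) q x = trans (eval-+p (scalep a q) (0ℤ ∷ (p *p q)) x)
    (trans (cong₂ (λ u v → u + (0ℤ + x * v)) (eval-scalep a q x) (eval-*p p q x)) (lemma a x (eval p x) (eval q x)))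
    where
    lemma : ∀ a x p q → a * q + (0ℤ + x * (p * q)) ≡ (a + x * p) * q
    lemma = solve-∀

  eval-^p : ∀ p k x → eval (p ^p k) x ≡ eval p x ^ℤ k
  eval-^p p zero    x = cong (1ℤ +_) (*-zeroʳ x)
  eval-^p p (suc k) x = trans (eval-*p p (p ^p k) x) (cong (eval p x *_) (eval-^p p k x))

  eval-sumP : ∀ {n} (f : Fin n → Poly) x → eval (sumP f) x ≡ sum (λ i → eval (f i) x)
  eval-sumP {zero}  f x = refl
  eval-sumP {suc n} f x = trans (eval-+p (f fz) (sumP (f ∘ fs)) x) (cong (eval (f fz) x +_) (eval-sumP (f ∘ fs) x))

  signP-sgn : ∀ k → signP k ≡ sgn k ∷ []
  signP-sgn zero          = refl
  signP-sgn (suc zero)    = refl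
  signP-sgn (suc (suc k)) = trans (signP-sgn k) (cong (_∷ []) (lemma (sgn k)))
    where
    lemma : ∀ a → a ≡ - - a
    lemma = solve-∀

  eval-det : ∀ n (M : Fin n → Fin n → Poly) x → eval (Defs.det n M) x ≡ detℤ (λ i j → eval (M i j) x)
  eval-det zero    M x = cong (1ℤ +_) (*-zeroʳ x)
  eval-det (suc n) M x = trans (eval-sumP (λ j → signP (toℕ j) *p (M fz j *p m j)) x) (sum-cong-≗ λ j → begin
    eval (signP (toℕ j) *p (M fz j *p m j)) x
      ≡⟨ eval-*p (signP (toℕ j)) (M fz j *p m j) x ⟩
    eval (signP (toℕ j)) x * eval (M fz j *p m j) x
      ≡⟨ cong₂ _*_ (trans (cong (λ p → eval p x) (signP-sgn (toℕ j))) (lemma (sgn (toℕ j)) x))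
           (trans (eval-*p (M fz j) (m j) x) (cong (eval (M fz j) x *_)
               (eval-det n (λ i k → M (fs i) (punchIn j k)) x))) ⟩
    sgn (toℕ j) * (eval (M fz j) x * detℤ (λ i k → eval (M (fs i) (punchIn j k)) x)) ∎)
    where
    open ≡-Reasoning
    m : Fin (suc n) → Poly
    m j = Defs.det n (λ i k → M (fs i) (punchIn j k))
    lemma : ∀ s x → s + x * 0ℤ ≡ s
    lemma = solve-∀

  coeff-+p : ∀ p q i → coeff (p +p q) i ≡ coeff p i + coeff q i
  coeff-+p []      q       i       = sym (+-identityˡ (coeff q i))
  coeff-+p (a ∷ p) []      i       = sym (+-identityʳ (coeff (a ∷ p) i))
  coeff-+p (a ∷ p) (b ∷ q) zero    = refl
  coeff-+p (a ∷ p) (b ∷ q) (suc i) = coeff-+p p q i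

  coeff-scalep : ∀ c p i → coeff (scalep c p) i ≡ c * coeff p i
  coeff-scalep c []      i       = sym (*-zeroʳ c)
  coeff-scalep c (a ∷ p) zero    = refl
  coeff-scalep c (a ∷ p) (suc i) = coeff-scalep c p i

  eval-≈[] : ∀ p → p ≈p [] → ∀ x → eval p x ≡ 0ℤ
  eval-≈[] []      p≈0 x = refl
  eval-≈[] (a ∷ p) p≈0 x = trans (cong₂ (λ u v → u + x * v) (p≈0 0) (eval-≈[] p (p≈0 ∘ suc) x))
      (trans (+-identityˡ (x * 0ℤ)) (*-zeroʳ x))

  eval-≈p : ∀ p q → p ≈p q → ∀ x → eval p x ≡ eval q x
  eval-≈p p       []      p≈q x = eval-≈[] p p≈q x
  eval-≈p []      (b ∷ q) p≈q x = sym (eval-≈[] (b ∷ q) (λ i → sym (p≈q i)) x)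
  eval-≈p (a ∷ p) (b ∷ q) p≈q x = cong₂ (λ u v → u + x * v) (p≈q 0) (eval-≈p p q (p≈q ∘ suc) x)

  neg-unique : ∀ {a b} → a + b ≡ 0ℤ → a ≡ - b
  neg-unique {a} {b} a+b≡0 = trans (lemma a b) (trans (cong (_+ - b) a+b≡0) (+-identityˡ (- b)))
    where
    lemma : ∀ a b → a ≡ (a + b) + - b
    lemma = solve-∀

  -- Once the constant term is known to vanish, a factor x can be cancelled at every positive point,
  -- and the same argument treats the next coefficient.
  vanishing⇒zero : ∀ p → (∀ t → eval p (pos (suc t)) ≡ 0ℤ) → ∀ i → coeff p i ≡ 0ℤ
  vanishing⇒zero []      p≡0 i = refl
  vanishing⇒zero (a ∷ p) p≡0 = λ { zero → a≡0 ; (suc i) → vanishing⇒zero p tail≡0 i }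
    where
    -- The constant term is a multiple of its successor |a| + 1.
    small : ∀ m k → m ≡ suc m ℕ.* k → m ≡ 0
    small m zero    eq = trans eq (ℕ.*-zeroʳ m)
    small m (suc k) eq = ⊥-elim (ℕ.<-irrefl eq (ℕ.m≤m*n (suc m) (suc k)))
    a≡0 : a ≡ 0ℤ
    a≡0 = ∣i∣≡0⇒i≡0 (small ∣ a ∣ ∣ eval p x ∣ (trans (cong ∣_∣ (neg-unique {a} {x * eval p x} (p≡0 ∣ a ∣)))
        (trans (∣-i∣≡∣i∣ (x * eval p x)) (abs-* x (eval p x)))))
      where
      x = pos (suc ∣ a ∣)
    tail≡0 : ∀ t → eval p (pos (suc t)) ≡ 0ℤ
    tail≡0 t = *-cancel-0 {pos (suc t)} (λ ()) (trans
        (sym (trans (cong (_+ pos (suc t) * eval p (pos (suc t))) a≡0)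
        (+-identityˡ (pos (suc t) * eval p (pos (suc t)))))) (p≡0 t))

  ≡⇒-≡0 : ∀ {a b} → a ≡ b → a + - 1ℤ * b ≡ 0ℤ
  ≡⇒-≡0 {a} refl = lemma a
    where
    lemma : ∀ a → a + - 1ℤ * a ≡ 0ℤ
    lemma = solve-∀

  -≡0⇒≡ : ∀ {a b} → a + - 1ℤ * b ≡ 0ℤ → a ≡ b
  -≡0⇒≡ {a} {b} eq = trans (neg-unique eq) (lemma b)
    where
    lemma : ∀ b → - (- 1ℤ * b) ≡ b
    lemma = solve-∀

  eval-injective : ∀ p q → (∀ t → eval p (pos (suc t)) ≡ eval q (pos (suc t))) → p ≈p q
  eval-injective p q eq i = -≡0⇒≡ (trans (sym (trans (coeff-+p p (scalep (- 1ℤ) q) i)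
      (cong (coeff p i +_) (coeff-scalep (- 1ℤ) q i))))
    (vanishing⇒zero (p +p scalep (- 1ℤ) q) (λ t → trans (eval-+p p (scalep (- 1ℤ) q) (pos (suc t)))
      (trans (cong (eval p (pos (suc t)) +_) (eval-scalep (- 1ℤ) q (pos (suc t)))) (≡⇒-≡0 (eq t)))) i))

  -- Needed at x = -1: the identities come from cancelling powers of x + 1, which is possible at
  -- positive x but not at -1 itself.
  eval-extend : ∀ p q → (∀ t → eval p (pos (suc t)) ≡ eval q (pos (suc t))) → ∀ x → eval p x ≡ eval q x
  eval-extend p q eq = eval-≈p p q (eval-injective p q eq)

  synthetic-division : ∀ p r → ∃[ q ] (∀ x → eval p x ≡ eval p r + (x + - r) * eval q x)
  synthetic-division []      r = [] , λ x → sym (trans (+-identityˡ ((x + - r) * 0ℤ)) (*-zeroʳ (x + - r)))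
  synthetic-division (a ∷ p) r with synthetic-division p r
  ... | q , eq = (eval p r ∷ q) , λ x → trans (cong (λ e → a + x * e) (eq x)) (lemma a x r (eval p r) (eval q x))
    where
    lemma : ∀ a x r e q → a + x * (e + (x + - r) * q) ≡ (a + r * e) + (x + - r) * (e + x * q)
    lemma = solve-∀

  *-cancelˡ : ∀ {c a b} → c ≢ 0ℤ → c * a ≡ c * b → a ≡ b
  *-cancelˡ {c} {a} {b} c≢0 eq = -≡0⇒≡ (*-cancel-0 c≢0 (trans (lemma c a b) (≡⇒-≡0 eq)))
    where
    lemma : ∀ c a b → c * (a + - 1ℤ * b) ≡ c * a + - 1ℤ * (c * b)
    lemma = solve-∀

  ^ℤ-+ : ∀ x m n → x ^ℤ (m ℕ.+ n) ≡ (x ^ℤ m) * (x ^ℤ n)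
  ^ℤ-+ x zero    n = sym (*-identityˡ (x ^ℤ n))
  ^ℤ-+ x (suc m) n = trans (cong (x *_) (^ℤ-+ x m n)) (sym (*-assoc x (x ^ℤ m) (x ^ℤ n)))

  x+1 : Poly
  x+1 = 1ℤ ∷ 1ℤ ∷ []

  eval-x+1 : ∀ x → eval x+1 x ≡ x + 1ℤ
  eval-x+1 = lemma
    where
    lemma : ∀ x → 1ℤ + x * (1ℤ + x * 0ℤ) ≡ x + 1ℤ
    lemma = solve-∀

  -- -1 is a root of P of multiplicity k; Q is a times the cofactor of (x+1)ᵏ.
  record RootOrder (P : Poly) (k : ℕ) : Set where
    field
      a        : ℤ
      a>0      : 0ℤ < a
      Q        : Poly
      identity : ∀ x → a * eval P x ≡ ((x + 1ℤ) ^ℤ k) * eval Q x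
      Q≢0      : eval Q (- 1ℤ) ≢ 0ℤ

  Divisible : ℕ → Poly → Set
  Divisible m P = ∃[ q ] (∀ x → eval P x ≡ eval q x * ((x + 1ℤ) ^ℤ m))

  ∣p⇒Divisible : ∀ m P → (x+1 ^p m) ∣p P → Divisible m P
  ∣p⇒Divisible m P (q , eq) = q , λ x → trans (eval-≈p P (q *p (x+1 ^p m)) eq x) (trans (eval-*p q (x+1 ^p m) x)
    (cong (eval q x *_) (trans (eval-^p x+1 m x) (cong (_^ℤ m) (eval-x+1 x)))))

  Divisible⇒∣p : ∀ m P → Divisible m P → (x+1 ^p m) ∣p P
  Divisible⇒∣p m P (q , eq) = q , eval-injective P (q *p (x+1 ^p m))
      (λ t → trans (eq (pos (suc t))) (sym (trans (eval-*p q (x+1 ^p m) (pos (suc t)))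
    (cong (eval q (pos (suc t)) *_) (trans (eval-^p x+1 m (pos (suc t))) (cong (_^ℤ m) (eval-x+1 (pos (suc t)))))))))

  module _ {P k} (o : RootOrder P k) where
    open RootOrder o
    open ≡-Reasoning

    -- If m exceeded k, cancelling (x + 1)ᵏ would leave a factor x + 1 in `Q`, contrary to `Q≢0`.
    Divisible⇒≤ : ∀ m → Divisible m P → m ℕ.≤ k
    Divisible⇒≤ m (q , eq) with m ℕ.≤? k
    ... | yes m≤k = m≤k
    ... | no  m≰k with ℕ.m≤n⇒∃[o]m+o≡n (ℕ.≰⇒> m≰k)
    ...   | j , refl = ⊥-elim (Q≢0 (trans (sym (eval-extend q′ Q agree (- 1ℤ)))
        (trans (eval-q′ (- 1ℤ)) (lemma a (eval q (- 1ℤ)) (0ℤ ^ℤ j)))))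
      where
      q′ : Poly
      q′ = scalep a (q *p (x+1 ^p suc j))
      eval-q′ : ∀ x → eval q′ x ≡ a * (eval q x * ((x + 1ℤ) * ((x + 1ℤ) ^ℤ j)))
      eval-q′ x = trans (eval-scalep a (q *p (x+1 ^p suc j)) x) (cong (a *_) (trans (eval-*p q (x+1 ^p suc j) x)
        (cong (eval q x *_) (trans (eval-^p x+1 (suc j) x) (cong (_^ℤ suc j) (eval-x+1 x))))))
      lemma : ∀ a q z → a * (q * (0ℤ * z)) ≡ 0ℤ
      lemma = solve-∀
      agree : ∀ t → eval q′ (pos (suc t)) ≡ eval Q (pos (suc t))
      agree t = *-cancelˡ (^ℤ-nonzero {y} (λ ()) k) (begin
        (y ^ℤ k) * eval q′ x                          ≡⟨ cong ((y ^ℤ k) *_) (eval-q′ x) ⟩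
        (y ^ℤ k) * (a * (eval q x * (y * (y ^ℤ j))))  ≡⟨ rearrange (y ^ℤ k) a (eval q x) y (y ^ℤ j) ⟩
        a * (eval q x * (y * ((y ^ℤ k) * (y ^ℤ j))))  ≡⟨ cong (λ z → a * (eval q x * (y * z))) (sym (^ℤ-+ y k j)) ⟩
        a * (eval q x * (y ^ℤ suc (k ℕ.+ j)))         ≡⟨ cong (a *_) (sym (eq x)) ⟩
        a * eval P x                                  ≡⟨ identity x ⟩
        (y ^ℤ k) * eval Q x ∎)
        where
        x = pos (suc t)
        y = x + 1ℤ
        rearrange : ∀ u a q y v → u * (a * (q * (y * v))) ≡ a * (q * (y * (u * v)))
        rearrange = solve-∀

    -- The scalar `a` cannot simply be divided out of `Q`, so the factors x + 1 are removed one at a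
    -- time. The current quotient q satisfies a q = (x + 1)^(j+1) Q, hence q(-1) = 0, and division
    -- by the monic x + 1 stays integral.
    ≤⇒Divisible : ∀ m → m ℕ.≤ k → Divisible m P
    ≤⇒Divisible zero    m≤k = P , λ x → sym (*-identityʳ (eval P x))
    ≤⇒Divisible (suc m) m≤k with ≤⇒Divisible m (ℕ.≤-trans (ℕ.n≤1+n m) m≤k) | ℕ.m≤n⇒∃[o]m+o≡n m≤k
    ... | q , eq | j , m+1+j≡k with synthetic-division q (- 1ℤ)
    ...   | q′ , eq′ = q′ , λ x → begin
      eval P x
        ≡⟨ eq x ⟩
      eval q x * ((x + 1ℤ) ^ℤ m)
        ≡⟨ cong (_* ((x + 1ℤ) ^ℤ m)) (eq′ x) ⟩
      (eval q (- 1ℤ) + (x + 1ℤ) * eval q′ x) * ((x + 1ℤ) ^ℤ m)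
        ≡⟨ cong (λ z → (z + (x + 1ℤ) * eval q′ x) * ((x + 1ℤ) ^ℤ m)) root ⟩
      (0ℤ + (x + 1ℤ) * eval q′ x) * ((x + 1ℤ) ^ℤ m)
        ≡⟨ rearrange (x + 1ℤ) (eval q′ x) ((x + 1ℤ) ^ℤ m) ⟩
      eval q′ x * ((x + 1ℤ) * ((x + 1ℤ) ^ℤ m)) ∎
      where
      rearrange : ∀ y q z → (0ℤ + y * q) * z ≡ q * (y * z)
      rearrange = solve-∀
      Q′ : Poly
      Q′ = (x+1 ^p suc j) *p Q
      eval-Q′ : ∀ x → eval Q′ x ≡ ((x + 1ℤ) * ((x + 1ℤ) ^ℤ j)) * eval Q x
      eval-Q′ x = trans (eval-*p (x+1 ^p suc j) Q x)
          (cong (_* eval Q x) (trans (eval-^p x+1 (suc j) x) (cong (_^ℤ suc j) (eval-x+1 x))))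
      agree : ∀ t → eval (scalep a q) (pos (suc t)) ≡ eval Q′ (pos (suc t))
      agree t = *-cancelˡ (^ℤ-nonzero {y} (λ ()) m) (begin
        (y ^ℤ m) * eval (scalep a q) x               ≡⟨ cong ((y ^ℤ m) *_) (eval-scalep a q x) ⟩
        (y ^ℤ m) * (a * eval q x)                    ≡⟨ swap (y ^ℤ m) a (eval q x) ⟩
        a * (eval q x * (y ^ℤ m))                    ≡⟨ cong (a *_) (sym (eq x)) ⟩
        a * eval P x                                 ≡⟨ identity x ⟩
        (y ^ℤ k) * eval Q x                          ≡⟨ cong (λ k → (y ^ℤ k) * eval Q x)
            (sym (trans (ℕ.+-suc m j) m+1+j≡k)) ⟩
        (y ^ℤ (m ℕ.+ suc j)) * eval Q x              ≡⟨ cong (_* eval Q x) (^ℤ-+ y m (suc j)) ⟩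
        ((y ^ℤ m) * (y * (y ^ℤ j))) * eval Q x       ≡⟨ *-assoc (y ^ℤ m) (y * (y ^ℤ j)) (eval Q x) ⟩
        (y ^ℤ m) * ((y * (y ^ℤ j)) * eval Q x)       ≡⟨ cong ((y ^ℤ m) *_) (sym (eval-Q′ x)) ⟩
        (y ^ℤ m) * eval Q′ x ∎)
        where
        x = pos (suc t)
        y = x + 1ℤ
        swap : ∀ u a q → u * (a * q) ≡ a * (q * u)
        swap = solve-∀
      root : eval q (- 1ℤ) ≡ 0ℤ
      root = *-cancel-0 (pos⇒≢0 a>0) (trans (sym (eval-scalep a q (- 1ℤ)))
          (trans (eval-extend (scalep a q) Q′ agree (- 1ℤ))
        (trans (eval-Q′ (- 1ℤ)) refl)))

    RootMult⇔≡ : ∀ m → RootMult (- 1ℤ) P m ⇔ (m ≡ k)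
    RootMult⇔≡ m = mk⇔
      (λ (div , ¬div) → ℕ.≤-antisym (Divisible⇒≤ m (∣p⇒Divisible m P div))
        (ℕ.≮⇒≥ λ m<k → ¬div (Divisible⇒∣p (suc m) P (≤⇒Divisible (suc m) m<k))))
      (λ { refl → Divisible⇒∣p k P (≤⇒Divisible k ℕ.≤-refl) , λ div → ℕ.<-irrefl refl
          (Divisible⇒≤ (suc k) (∣p⇒Divisible (suc k) P div)) })

  _+I : ∀ {n} → Matrix n n → Matrix n n
  (A +I) i j = A i j + δ i j

  eval-charPoly : ∀ {n} (A : Matrix n n) x → eval (charPoly n A) x ≡ detℤ (shifted (x + 1ℤ) δ 1ℤ (A +I))
  eval-charPoly {n} A x = trans (eval-det n (λ u v → if u ≡ᶠ v then (- A u v) ∷ (1ℤ ∷ []) else (- A u v) ∷ []) x)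
      (detℤ-cong entry)
    where
    diagonal : ∀ a x → - a + x * (1ℤ + x * 0ℤ) ≡ (x + 1ℤ) * 1ℤ + - (1ℤ * (a + 1ℤ))
    diagonal = solve-∀
    off : ∀ a x → - a + x * 0ℤ ≡ (x + 1ℤ) * 0ℤ + - (1ℤ * (a + 0ℤ))
    off = solve-∀
    entry : ∀ i j → eval (if i ≡ᶠ j then (- A i j) ∷ (1ℤ ∷ []) else (- A i j) ∷ []) x ≡ shifted (x + 1ℤ) δ 1ℤ (A +I) i
        j
    entry i j with i ≡ᶠ j
    ... | true  = diagonal (A i j) x
    ... | false = off (A i j) x

  module MinusOne {n : ℕ} (A : Matrix n n) (symA : Symmetric A) where

    M : Matrix n n
    M = A +I

    reduction : Reduction δ 1ℤ M
    reduction = reduce n δ M δ-sym (λ i j → cong₂ _+_ (symA i j) (δ-sym i j)) δ-posDef 1ℤ (+<+ (ℕ.s≤s ℕ.z≤n))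

    open Reduction reduction public using (k; r; k+r≡n; I; regular; factor; b; b>0; d′; d′>0)
    open Reduction reduction using (S′; identity)

    -- The right-hand side of `identity` at t = x + 1 without its power of t: each entry is (x + 1)
    -- S′ - d′ M, restricted to the block, sorted by powers of x.
    Q : Poly
    Q = scalep b (Defs.det r (λ i j → (S′ i j + - (d′ * minor M I i j)) ∷ S′ i j ∷ []))

    eval-Q : ∀ x → eval Q x ≡ b * detℤ (shifted (x + 1ℤ) S′ d′ (minor M I))
    eval-Q x = trans (eval-scalep b (Defs.det r (λ i j → (S′ i j + - (d′ * minor M I i j)) ∷ S′ i j ∷ [])) x)
      (cong (b *_) (trans (eval-det r (λ i j → (S′ i j + - (d′ * minor M I i j)) ∷ S′ i j ∷ []) x)
      (detℤ-cong λ i j → lemma (S′ i j) (- (d′ * minor M I i j)) x)))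
      where
      lemma : ∀ s m x → (s + m) + x * (s + x * 0ℤ) ≡ (x + 1ℤ) * s + m
      lemma = solve-∀

    -- At x = -1 the form S′ drops out and only a principal minor of M is left; this is where graph
    -- data enter the lowest coefficient.
    lowest : eval Q (- 1ℤ) ≡ b * (((- d′) ^ℤ r) * detℤ (minor M I))
    lowest = trans (eval-Q (- 1ℤ)) (cong (b *_) (trans (detℤ-cong λ i j → lemma (S′ i j) d′ (minor M I i j))
        (detℤ-scale (- d′) (minor M I))))
      where
      lemma : ∀ s d m → 0ℤ * s + - (d * m) ≡ - d * m
      lemma = solve-∀

    order : RootOrder (charPoly n A) k
    order = record
      { a = Reduction.a reduction ; a>0 = Reduction.a>0 reduction ; Q = Q
      ; identity = λ x → trans (cong (Reduction.a reduction *_) (eval-charPoly A x)) (trans (identity (x + 1ℤ))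
          (trans (lemma b ((x + 1ℤ) ^ℤ k) (detℤ (shifted (x + 1ℤ) S′ d′ (minor M I))))
              (cong (((x + 1ℤ) ^ℤ k) *_) (sym (eval-Q x)))))
      ; Q≢0 = λ eq → *-nonzero (pos⇒≢0 b>0) (*-nonzero (^ℤ-nonzero (λ -d≡0 → pos⇒≢0 d′>0 (neg d′ -d≡0)) r) regular)
          (trans (sym lowest) eq) }
      where
      lemma : ∀ b u D → b * (u * D) ≡ u * (b * D)
      lemma = solve-∀
      neg : ∀ d → - d ≡ 0ℤ → d ≡ 0ℤ
      neg d eq = trans (involutive d) (cong -_ eq)
        where
        involutive : ∀ d → d ≡ - - d
        involutive = solve-∀

  -- Degree and leading coefficient of the characteristic polynomial.

  data Short : Poly → Set where
    constant : ∀ a → Short (a ∷ [])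
    linear   : ∀ a b → Short (a ∷ b ∷ [])

  coeff-constant-*p : ∀ a q i → coeff ((a ∷ []) *p q) i ≡ a * coeff q i
  coeff-constant-*p a q i = trans (coeff-+p (scalep a q) (0ℤ ∷ []) i)
      (trans (cong₂ _+_ (coeff-scalep a q i) (zeros i)) (+-identityʳ (a * coeff q i)))
    where
    zeros : ∀ i → coeff (0ℤ ∷ []) i ≡ 0ℤ
    zeros zero    = refl
    zeros (suc i) = refl

  coeff-short-*p : ∀ {p} → Short p → ∀ q i → coeff (p *p q) (suc i) ≡ coeff p 0 * coeff q (suc i) + coeff p 1 * coeff
      q i
  coeff-short-*p (constant a) q i = trans (coeff-constant-*p a q (suc i)) (sym (+-identityʳ (a * coeff q (suc i))))
  coeff-short-*p (linear a b) q i = trans (coeff-+p (scalep a q) (0ℤ ∷ ((b ∷ []) *p q)) (suc i))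
      (cong₂ _+_ (coeff-scalep a q (suc i)) (coeff-constant-*p b q i))

  coeff-sumP : ∀ {n} (f : Fin n → Poly) i → coeff (sumP f) i ≡ sum (λ j → coeff (f j) i)
  coeff-sumP {zero}  f i = refl
  coeff-sumP {suc n} f i = trans (coeff-+p (f fz) (sumP (f ∘ fs)) i)
      (cong (coeff (f fz) i +_) (coeff-sumP (f ∘ fs) i))

  coeff-det : ∀ n (M : Fin (suc n) → Fin (suc n) → Poly) → (∀ i j → Short (M i j)) → ∀ e → coeff (Defs.det (suc n) M)
      (suc e) ≡
    sum (λ j → sgn (toℕ j) * (coeff (M fz j) 0 * coeff (Defs.det n (λ i k → M (fs i) (punchIn j k))) (suc e)
                            + coeff (M fz j) 1 * coeff (Defs.det n (λ i k → M (fs i) (punchIn j k))) e))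
  coeff-det n M short e = trans (coeff-sumP (λ j → signP (toℕ j) *p (M fz j *p m j)) (suc e)) (sum-cong-≗ λ j →
    trans (cong (λ s → coeff (s *p (M fz j *p m j)) (suc e)) (signP-sgn (toℕ j)))
    (trans (coeff-constant-*p (sgn (toℕ j)) (M fz j *p m j) (suc e))
        (cong (sgn (toℕ j) *_) (coeff-short-*p (short fz j) (m j) e))))
    where
    m : Fin (suc n) → Poly
    m j = Defs.det n (λ i k → M (fs i) (punchIn j k))

  det-degree : ∀ n (M : Fin n → Fin n → Poly) → (∀ i j → Short (M i j)) → ∀ e → coeff (Defs.det n M) (suc (n ℕ.+ e)) ≡
      0ℤ
  det-degree zero    M short e = refl
  det-degree (suc n) M short e = trans (coeff-det n M short (suc (n ℕ.+ e))) (sum-zero _ λ j →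
    trans (cong₂ (λ u v → sgn (toℕ j) * (coeff (M fz j) 0 * u + coeff (M fz j) 1 * v))
      (trans (cong (λ z → coeff (Defs.det n (λ i k → M (fs i) (punchIn j k))) (suc z)) (sym (ℕ.+-suc n e)))
          (det-degree n (λ i k → M (fs i) (punchIn j k)) (λ i k → short (fs i) (punchIn j k)) (suc e)))
      (det-degree n (λ i k → M (fs i) (punchIn j k)) (λ i k → short (fs i) (punchIn j k)) e))
    (lemma (sgn (toℕ j)) (coeff (M fz j) 0) (coeff (M fz j) 1)))
    where
    lemma : ∀ s a b → s * (a * 0ℤ + b * 0ℤ) ≡ 0ℤ
    lemma = solve-∀

  det-leading : ∀ n (M : Fin n → Fin n → Poly) → (∀ i j → Short (M i j)) → coeff (Defs.det n M) n ≡ detℤ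
      (λ i j → coeff (M i j) 1)
  det-leading zero    M short = refl
  det-leading (suc n) M short = trans (coeff-det n M short n) (sum-cong-≗ λ j →
    cong (sgn (toℕ j) *_) (trans (cong₂ (λ u v → coeff (M fz j) 0 * u + coeff (M fz j) 1 * v)
      (trans (cong (λ z → coeff (Defs.det n (λ i k → M (fs i) (punchIn j k))) (suc z)) (sym (ℕ.+-identityʳ n)))
          (det-degree n (λ i k → M (fs i) (punchIn j k)) (λ i k → short (fs i) (punchIn j k)) 0))
      (det-leading n (λ i k → M (fs i) (punchIn j k)) (λ i k → short (fs i) (punchIn j k))))
    (lemma (coeff (M fz j) 0) (coeff (M fz j) 1 * detℤ (λ i k → coeff (M (fs i) (punchIn j k)) 1)))))
    where
    lemma : ∀ a b → a * 0ℤ + b ≡ b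
    lemma = solve-∀

  detℤ-δ : ∀ n → detℤ (δ {n} {n}) ≡ 1ℤ
  detℤ-δ zero    = refl
  detℤ-δ (suc n) = trans (cong₂ (λ u v → 1ℤ * (1ℤ * u) + v) (detℤ-δ n)
    (sum-zero {n} (λ j → sgn (toℕ (fs j)) * (0ℤ * detℤ {n} (λ i k → δ (fs i) (punchIn (fs j) k))))
        (λ j → *-zeroʳ (sgn (toℕ (fs j)))))) refl

  charPoly-short : ∀ {n} (A : Matrix n n) u v → Short (if u ≡ᶠ v then (- A u v) ∷ (1ℤ ∷ []) else (- A u v) ∷ [])
  charPoly-short A u v with u ≡ᶠ v
  ... | true  = linear (- A u v) 1ℤ
  ... | false = constant (- A u v)

  charPoly-monic : ∀ {n} (A : Matrix n n) → coeff (charPoly n A) n ≡ 1ℤ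
  charPoly-monic {n} A = trans (det-leading n _ (charPoly-short A)) (trans (detℤ-cong {n} entry) (detℤ-δ n))
    where
    entry : ∀ u v → coeff (if u ≡ᶠ v then (- A u v) ∷ (1ℤ ∷ []) else (- A u v) ∷ []) 1 ≡ δ u v
    entry u v with u ≡ᶠ v
    ... | true  = refl
    ... | false = refl

  -- If m < n, the leading coefficient 1 of the second polynomial would stand at an index beyond the
  -- degree of the first. Cospectral graphs therefore have the same order.
  charPoly-degree : ∀ {m n} (A : Matrix m m) (B : Matrix n n) → charPoly m A ≈p charPoly n B → n ℕ.≤ m
  charPoly-degree {m} {n} A B eq = ℕ.≮⇒≥ λ m<n → absurd (ℕ.m≤n⇒∃[o]m+o≡n m<n)
    where
    absurd : ∃[ e ] suc m ℕ.+ e ≡ n → ⊥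
    absurd (e , refl) with trans (sym (charPoly-monic B))
        (trans (sym (eq (suc (m ℕ.+ e)))) (det-degree m _ (charPoly-short A) e))
    ... | ()

-- Walks, the graph metric and eccentricities.

module Distance where

  open import Data.Bool.Properties using (∨-zeroʳ)
  open import Data.Nat using (_+_; _≤_; _<_; z≤n; s≤s; _≡ᵇ_)
  open import Data.Nat.Properties
  open import Data.Fin.Properties using (toℕ-injective)

  -- The loop in dist is local to its definition; unification with an unfolding of dist names it.
  mutual
    search : ∀ {n} → Graph n → Fin n → Fin n → ℕ → ℕ → ℕ
    search = _

    dist-unfold : ∀ {n} (G : Graph (suc n)) (u v : Fin (suc n)) →
      dist G u v ≡ (if within G 0 u v then 0 else search G u v n 1)
    dist-unfold {n} G u v with suc n | G | u | v | 1
    ... | m | G′ | u′ | v′ | k = refl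

  -- The index bounds the number of steps from above, in agreement with `within`; hence `here`
  -- exists for every `k`.
  data Path {n} (G : Graph n) : ℕ → Fin n → Fin n → Set where
    here : ∀ {k u} → Path G k u u
    step : ∀ {k u w v} → adj G u w ≡ true → Path G k w v → Path G (suc k) u v

  ≡ᵇ-true : ∀ a b → (a ≡ᵇ b) ≡ true → a ≡ b
  ≡ᵇ-true zero    zero    _  = refl
  ≡ᵇ-true (suc a) (suc b) eq = cong suc (≡ᵇ-true a b eq)

  ≡ᵇ-false : ∀ a b → a ≢ b → (a ≡ᵇ b) ≡ false
  ≡ᵇ-false a b a≢b with a ≡ᵇ b in eq
  ... | true  = ⊥-elim (a≢b (≡ᵇ-true a b eq))
  ... | false = refl

  ∨-true : ∀ a b → a ∨ b ≡ true → a ≡ true ⊎ b ≡ true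
  ∨-true true  b eq = inj₁ refl
  ∨-true false b eq = inj₂ eq

  ∧-true : ∀ a b → a ∧ b ≡ true → a ≡ true × b ≡ true
  ∧-true true true eq = refl , refl

  anyFin-true : ∀ {n} (f : Fin n → Bool) → anyFin f ≡ true → ∃[ i ] f i ≡ true
  anyFin-true {suc n} f eq with ∨-true (f fz) (anyFin (f ∘ fs)) eq
  ... | inj₁ p = fz , p
  ... | inj₂ p with anyFin-true (f ∘ fs) p
  ...   | i , q = fs i , q

  true-anyFin : ∀ {n} (f : Fin n → Bool) i → f i ≡ true → anyFin f ≡ true
  true-anyFin f fz     eq rewrite eq = refl
  true-anyFin f (fs i) eq rewrite true-anyFin (f ∘ fs) i eq = ∨-zeroʳ (f fz)

  maxFin-≥ : ∀ {n} (f : Fin n → ℕ) i → f i ≤ maxFin f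
  maxFin-≥ f fz     = m≤m⊔n (f fz) (maxFin (f ∘ fs))
  maxFin-≥ f (fs i) = ≤-trans (maxFin-≥ (f ∘ fs) i) (m≤n⊔m (f fz) (maxFin (f ∘ fs)))

  maxFin-≤ : ∀ {n} (f : Fin n → ℕ) k → (∀ i → f i ≤ k) → maxFin f ≤ k
  maxFin-≤ {zero}  f k f≤k = z≤n
  maxFin-≤ {suc n} f k f≤k = ⊔-lub (f≤k fz) (maxFin-≤ (f ∘ fs) k (f≤k ∘ fs))

  maxFin-attained : ∀ {n} (f : Fin (suc n) → ℕ) → ∃[ i ] f i ≡ maxFin f
  maxFin-attained {zero}  f = fz , sym (⊔-identityʳ (f fz))
  maxFin-attained {suc n} f with maxFin-attained (f ∘ fs) | ⊔-sel (f fz) (maxFin (f ∘ fs))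
  ... | i , eq | inj₁ p = fz , sym p
  ... | i , eq | inj₂ p = fs i , trans eq (sym p)

  module _ {n} (G : Graph n) where

    within⇒Path : ∀ k {u v} → within G k u v ≡ true → Path G k u v
    within⇒Path zero    {u} {v} eq with toℕ-injective (≡ᵇ-true (toℕ u) (toℕ v) eq)
    ... | refl = here
    within⇒Path (suc k) {u} {v} eq with ∨-true (within G k u v) _ eq
    ... | inj₁ p = weaken (within⇒Path k p)
      where
      weaken : ∀ {k u v} → Path G k u v → Path G (suc k) u v
      weaken here       = here
      weaken (step a p) = step a (weaken p)
    ... | inj₂ p with anyFin-true (λ w → adj G u w ∧ within G k w v) p
    ...   | w , q with ∧-true (adj G u w) (within G k w v) q
    ...     | a , r = step a (within⇒Path k r)

    Path⇒within : ∀ {k u v} → Path G k u v → within G k u v ≡ true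
    Path⇒within {zero}  {u} here = ≡ᵇ-refl (toℕ u)
    Path⇒within {suc k} {u} here rewrite Path⇒within {k} {u} here = refl
    Path⇒within {suc k} {u} {v} (step {w = w} a p) =
      trans (cong (within G k u v ∨_) (true-anyFin (λ w → adj G u w ∧ within G k w v) w
        (cong₂ _∧_ a (Path⇒within p)))) (∨-zeroʳ (within G k u v))

    Path-≤ : ∀ {k l u v} → k ≤ l → Path G k u v → Path G l u v
    Path-≤ k≤l       here       = here
    Path-≤ (s≤s k≤l) (step a p) = step a (Path-≤ k≤l p)

    Path-++ : ∀ {k l u v w} → Path G k u v → Path G l v w → Path G (k + l) u w
    Path-++ {k} {l} here q = Path-≤ (m≤n+m l k) q
    Path-++ (step a p)   q = step a (Path-++ p q)

    Path-sym : ∀ {k u v} → Path G k u v → Path G k v u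
    Path-sym here = here
    Path-sym {suc k} {u} {v} (step {w = w} a p) =
      subst (λ l → Path G l v u) (+-comm k 1) (Path-++ (Path-sym p) (step (trans (adj-sym G w u) a) here))

    search-min : ∀ f k j {u v} → k ≤ j → Path G j u v → search G u v f k ≤ j
    search-min zero    k j k≤j p = k≤j
    search-min (suc f) k j {u} {v} k≤j p with within G k u v in eq
    ... | true  = k≤j
    ... | false with m≤n⇒m<n∨m≡n k≤j
    ...   | inj₁ k<j  = search-min f (suc k) j k<j p
    ...   | inj₂ refl with trans (sym eq) (Path⇒within p)
    ...     | ()

    -- Fuel plus counter is invariant, so when the fuel runs out the counter has reached a length
    -- for which a path is already known. Connectedness supplies that path at the start.
    search-path : ∀ f k {u v} → Path G (f + k) u v → Path G (search G u v f k) u v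
    search-path zero    k p = p
    search-path (suc f) k {u} {v} p with within G k u v in eq
    ... | true  = within⇒Path k eq
    ... | false = search-path f (suc k) (subst (λ l → Path G l u v) (sym (+-suc f k)) p)

  module Metric {n} (G : Graph n) (conn : Connected G) where

    d : Fin n → Fin n → ℕ
    d = dist G

    ε : Fin n → ℕ
    ε = ecc G

    d-path : ∀ u v → Path G (d u v) u v
    d-path u v = search-path G n 0 (subst (λ l → Path G l u v) (sym (+-identityʳ n)) (within⇒Path G n (conn u v)))

    d-min : ∀ {k u v} → Path G k u v → d u v ≤ k
    d-min {k} p = search-min G n 0 k z≤n p

    d-refl : ∀ u → d u u ≡ 0
    d-refl u = n≤0⇒n≡0 (d-min {0} {u} here)

    d-sym-≤ : ∀ u v → d u v ≤ d v u
    d-sym-≤ u v = d-min (Path-sym G (d-path v u))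

    d-sym : ∀ u v → d u v ≡ d v u
    d-sym u v = ≤-antisym (d-sym-≤ u v) (d-sym-≤ v u)

    d-triangle : ∀ u w v → d u v ≤ d u w + d w v
    d-triangle u w v = d-min (Path-++ G (d-path u w) (d-path w v))

    adj⇒≢ : ∀ {u v} → adj G u v ≡ true → u ≢ v
    adj⇒≢ {u} a refl with trans (sym a) (irrefl G u)
    ... | ()

    adj⇒d≤1 : ∀ {u v} → adj G u v ≡ true → d u v ≤ 1
    adj⇒d≤1 a = d-min (step a here)

    d≤1⇒adj : ∀ {u v} → d u v ≤ 1 → u ≢ v → adj G u v ≡ true
    d≤1⇒adj {u} {v} d≤1 u≢v with Path-≤ G d≤1 (d-path u v)
    ... | here        = ⊥-elim (u≢v refl)
    ... | step a here = a

    d≡0⇒≡ : ∀ {u v} → d u v ≡ 0 → u ≡ v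
    d≡0⇒≡ {u} {v} d≡0 with subst (λ k → Path G k u v) d≡0 (d-path u v)
    ... | here = refl

    ≢⇒d>0 : ∀ {u v} → u ≢ v → 0 < d u v
    ≢⇒d>0 u≢v = n≢0⇒n>0 (u≢v ∘ d≡0⇒≡)

    d>0⇒≢ : ∀ {u v k} → suc k ≤ d u v → u ≢ v
    d>0⇒≢ {u} d>0 refl with subst (_ ≤_) (d-refl u) d>0
    ... | ()

    d-step : ∀ {u v k} → d u v ≡ suc k → ∃[ w ] (adj G u w ≡ true × d w v ≡ k)
    d-step {u} {v} {k} eq with subst (λ l → Path G l u v) eq (d-path u v)
    ... | here with trans (sym (d-refl u)) eq
    ...   | ()
    d-step {u} {v} {k} eq | step {w = w} a p = w , a , ≤-antisym (d-min p)
      (≤-pred (subst (_≤ suc (d w v)) eq (d-min (step a (d-path w v)))))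

    d≤ε : ∀ u v → d u v ≤ ε u
    d≤ε u v = maxFin-≥ (d u) v

    d≤ε′ : ∀ u v → d u v ≤ ε v
    d≤ε′ u v = subst (_≤ ε v) (d-sym v u) (d≤ε v u)

    ε≤ : ∀ {u k} → (∀ v → d u v ≤ k) → ε u ≤ k
    ε≤ {u} {k} d≤k = maxFin-≤ (d u) k d≤k

  ε-attained : ∀ {n} (G : Graph n) u → ∃[ v ] dist G u v ≡ ecc G u
  ε-attained {suc n} G u = maxFin-attained (dist G u)

open Determinant
open Elimination
open Spectrum
open Distance
open import Data.Nat using (_⊓_; _∸_; _≤_; _<_; z≤n; s≤s; _≤?_; _≡ᵇ_; _≤ᵇ_)
open import Data.Nat.Divisibility using (_∣_; divides; ∣1⇒≡1; _∣?_)
open import Data.Integer renaming (+_ to pos; _≤_ to _≤ℤ_; _<_ to _<ℤ_; _≤?_ to _≤?ℤ_) using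
    (ℤ; -_; _+_; _*_; 0ℤ; 1ℤ; ∣_∣)
open import Data.Integer.Properties using (+-*-semiring; *-zeroʳ; *-identityʳ; +-identityʳ; +-identityˡ; <-irrefl;
    +-mono-<; ≤∧≢⇒<; abs-*; ∣-i∣≡∣i∣)
open import Data.Integer.Tactic.RingSolver using (solve-∀)
open import Data.Fin using () renaming (_<_ to _<ᶠ_)
open import Data.Fin.Properties using (toℕ-injective; suc-injective; toℕ-fromℕ<; toℕ<n; any?; all?; pigeonhole)
    renaming (_≟_ to _≟ᶠ_; <⇒≢ to <ᶠ⇒≢)
open import Data.Fin.Patterns
open import Data.Fin.Permutation using (Permutation′; transpose; _∘ₚ_; _⟨$⟩ʳ_; _⟨$⟩ˡ_; inverseˡ; inverseʳ)
open import Data.Vec.Functional using (Vector; _∷_; [])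
open import Algebra.Properties.Semiring.Sum +-*-semiring using (sum)

-- Opaque, so that 5 × 5 determinants are not expanded during type checking.
opaque
  Det : ∀ {n} → Matrix n n → ℤ
  Det = detℤ

  Det≡detℤ : ∀ {n} (M : Matrix n n) → Det M ≡ detℤ M
  Det≡detℤ M = refl

Det-cong : ∀ {n} {M N : Matrix n n} → (∀ i j → M i j ≡ N i j) → Det M ≡ Det N
Det-cong {n} {M} {N} eq = trans (Det≡detℤ M) (trans (detℤ-cong eq) (sym (Det≡detℤ N)))

-- Congruences of determinants, a pigeonhole principle and small determinants.

_≡_[mod_] : ℤ → ℤ → ℤ → Set
a ≡ b [mod e ] = ∃[ q ] a ≡ b + e * q

sum-mod : ∀ {n} e (f g : Vector ℤ n) → (∀ i → f i ≡ g i [mod e ]) → sum f ≡ sum g [mod e ]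
sum-mod {zero}  e f g eq = 0ℤ , sym (trans (+-identityˡ (e * 0ℤ)) (*-zeroʳ e))
sum-mod {suc n} e f g eq with eq fz | sum-mod e (f ∘ fs) (g ∘ fs) (eq ∘ fs)
... | p , fp | q , fq = p + q , trans (cong₂ _+_ fp fq) (lemma (g fz) (sum (g ∘ fs)) e p q)
  where
  lemma : ∀ a b e p q → a + e * p + (b + e * q) ≡ a + b + e * (p + q)
  lemma = solve-∀

detℤ-mod : ∀ {n} e (M L : Matrix n n) → (∀ i j → M i j ≡ L i j [mod e ]) → detℤ M ≡ detℤ L [mod e ]
detℤ-mod {zero}  e M L eq = 0ℤ , sym (trans (cong (1ℤ +_) (*-zeroʳ e)) refl)
detℤ-mod {suc n} e M L eq = sum-mod e
  (λ j → sgn (toℕ j) * (M fz j * cofactor (M ∘ fs) j)) (λ j → sgn (toℕ j) * (L fz j * cofactor (L ∘ fs) j)) term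
  where
  term : ∀ j → (sgn (toℕ j) * (M fz j * cofactor (M ∘ fs) j)) ≡ (sgn (toℕ j) * (L fz j * cofactor (L ∘ fs) j)) [mod e
      ]
  term j with eq fz j | detℤ-mod e (λ i k → M (fs i) (punchIn j k)) (λ i k → L (fs i) (punchIn j k))
      (λ i k → eq (fs i) (punchIn j k))
  ... | p , mp | q , mq = sgn (toℕ j) * (p * D + l * q + e * (p * q)) ,
    trans (cong₂ (λ u v → sgn (toℕ j) * (u * v)) mp mq) (lemma (sgn (toℕ j)) l p e D q)
    where
    l = L fz j
    D = cofactor (L ∘ fs) j
    lemma : ∀ s l p e D q → s * ((l + e * p) * (D + e * q)) ≡ s * (l * D) + e * (s * (p * D + l * q + e * (p * q)))
    lemma = solve-∀

Det-mod : ∀ {n} e (M L : Matrix n n) → (∀ i j → M i j ≡ L i j [mod e ]) → Det M ≡ Det L [mod e ]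
Det-mod e M L eq with detℤ-mod e M L eq
... | q , p = q , trans (Det≡detℤ M) (trans p (cong (_+ e * q) (sym (Det≡detℤ L))))

≢0-mod : ∀ {a b e} → a ≡ b [mod e ] → ¬ (∣ e ∣ ∣ ∣ b ∣) → a ≢ 0ℤ
≢0-mod {a} {b} {e} (q , a≡) e∤b a≡0 = e∤b (divides ∣ q ∣
    (trans (cong ∣_∣ (neg-unique {b} {e * q} (trans (sym a≡) a≡0)))
  (trans (∣-i∣≡∣i∣ (e * q)) (trans (abs-* e q) (ℕ.*-comm ∣ e ∣ ∣ q ∣)))))

Injective : ∀ {m n} → (Fin m → Fin n) → Set
Injective J = ∀ {i j} → J i ≡ J j → i ≡ j

Choice : ∀ {n} → (Fin n → Bool) → Bool → ℕ → Set
Choice {n} P b m = Σ (Fin m → Fin n) λ J → Injective J × (∀ i → P (J i) ≡ b)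

Choice-suc : ∀ {n P b m} → Choice {n} (P ∘ fs) b m → Choice P b m
Choice-suc (J , inj , all) = fs ∘ J , (λ eq → inj (suc-injective eq)) , all

Choice-cons : ∀ {n P b m} → P fz ≡ b → Choice {n} (P ∘ fs) b m → Choice P b (suc m)
Choice-cons {n} {P} {b} {m} eq (J , inj , all) = J′ , inj′ , λ { fz → eq ; (fs i) → all i }
  where
  J′ : Fin (suc m) → Fin (suc n)
  J′ = fz ∷ (fs ∘ J)
  inj′ : Injective J′
  inj′ {fz}   {fz}   _   = refl
  inj′ {fs i} {fs j} J≡J = cong fs (inj (suc-injective J≡J))

-- Pigeonhole in the form p + q - 1 ≤ n, by inspecting one element at a time and lowering the target
-- of its side.
bipartition : ∀ {n} (P : Fin n → Bool) p q → p ℕ.+ q ≤ suc n → Choice P true p ⊎ Choice P false q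
bipartition P zero q le = inj₁ ((λ ()) , (λ { {()} }) , λ ())
bipartition P (suc p) zero le = inj₂ ((λ ()) , (λ { {()} }) , λ ())
bipartition {zero} P (suc p) (suc q) (s≤s le) with subst (_≤ 0) (ℕ.+-suc p q) le
... | ()
bipartition {suc n} P (suc p) (suc q) (s≤s le) with P fz in eq
... | true with bipartition (P ∘ fs) p (suc q) le
...   | inj₁ c = inj₁ (Choice-cons {P = P} eq c)
...   | inj₂ c = inj₂ (Choice-suc {P = P} c)
bipartition {suc n} P (suc p) (suc q) (s≤s le) | false with bipartition (P ∘ fs) (suc p) q
    (subst (_≤ suc n) (ℕ.+-suc p q) le)
...   | inj₁ c = inj₁ (Choice-suc {P = P} c)
...   | inj₂ c = inj₂ (Choice-cons {P = P} eq c)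

unit-symmetric : (ab ac ad ae bc bd be cd ce de : ℤ) → Matrix 5 5
unit-symmetric ab ac ad ae bc bd be cd ce de =
  (1ℤ ∷ ab ∷ ac ∷ ad ∷ ae ∷ []) ∷
  (ab ∷ 1ℤ ∷ bc ∷ bd ∷ be ∷ []) ∷
  (ac ∷ bc ∷ 1ℤ ∷ cd ∷ ce ∷ []) ∷
  (ad ∷ bd ∷ cd ∷ 1ℤ ∷ de ∷ []) ∷
  (ae ∷ be ∷ ce ∷ de ∷ 1ℤ ∷ []) ∷ []

unit-symmetric-rows : ∀ (M : Matrix 5 5) → Symmetric M → (∀ i → M i i ≡ 1ℤ) → ∀ i j →
  M i j ≡ unit-symmetric (M 0F 1F) (M 0F 2F) (M 0F 3F) (M 0F 4F) (M 1F 2F) (M 1F 3F) (M 1F 4F) (M 2F 3F) (M 2F 4F)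
      (M 3F 4F) i j
unit-symmetric-rows M symM unit 0F 0F = unit 0F
unit-symmetric-rows M symM unit 0F 1F = refl
unit-symmetric-rows M symM unit 0F 2F = refl
unit-symmetric-rows M symM unit 0F 3F = refl
unit-symmetric-rows M symM unit 0F 4F = refl
unit-symmetric-rows M symM unit 1F 0F = symM 1F 0F
unit-symmetric-rows M symM unit 1F 1F = unit 1F
unit-symmetric-rows M symM unit 1F 2F = refl
unit-symmetric-rows M symM unit 1F 3F = refl
unit-symmetric-rows M symM unit 1F 4F = refl
unit-symmetric-rows M symM unit 2F 0F = symM 2F 0F
unit-symmetric-rows M symM unit 2F 1F = symM 2F 1F
unit-symmetric-rows M symM unit 2F 2F = unit 2F
unit-symmetric-rows M symM unit 2F 3F = refl
unit-symmetric-rows M symM unit 2F 4F = refl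
unit-symmetric-rows M symM unit 3F 0F = symM 3F 0F
unit-symmetric-rows M symM unit 3F 1F = symM 3F 1F
unit-symmetric-rows M symM unit 3F 2F = symM 3F 2F
unit-symmetric-rows M symM unit 3F 3F = unit 3F
unit-symmetric-rows M symM unit 3F 4F = refl
unit-symmetric-rows M symM unit 4F 0F = symM 4F 0F
unit-symmetric-rows M symM unit 4F 1F = symM 4F 1F
unit-symmetric-rows M symM unit 4F 2F = symM 4F 2F
unit-symmetric-rows M symM unit 4F 3F = symM 4F 3F
unit-symmetric-rows M symM unit 4F 4F = unit 4F

opaque
 unfolding Det

 -- The third index splits off and the others form a path with weights x, z, y, so the determinant
 -- is (1 - x²)(1 - y²) - z². The first product is 1, -8 or 64 and z² is 0, 9 or 16, so they never
 -- agree.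
 path-matrix-regular : ∀ {x y z} → (x ≡ 0ℤ ⊎ x ≡ pos 3) → (y ≡ 0ℤ ⊎ y ≡ pos 3) → (z ≡ 0ℤ ⊎ z ≡ pos 3 ⊎ z ≡ pos 4) →
   Det (unit-symmetric 0ℤ 0ℤ x z 0ℤ 0ℤ y 0ℤ 0ℤ 0ℤ) ≢ 0ℤ
 path-matrix-regular (inj₁ refl) (inj₁ refl) (inj₁ refl)        ()
 path-matrix-regular (inj₁ refl) (inj₁ refl) (inj₂ (inj₁ refl)) ()
 path-matrix-regular (inj₁ refl) (inj₁ refl) (inj₂ (inj₂ refl)) ()
 path-matrix-regular (inj₁ refl) (inj₂ refl) (inj₁ refl)        ()
 path-matrix-regular (inj₁ refl) (inj₂ refl) (inj₂ (inj₁ refl)) ()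
 path-matrix-regular (inj₁ refl) (inj₂ refl) (inj₂ (inj₂ refl)) ()
 path-matrix-regular (inj₂ refl) (inj₁ refl) (inj₁ refl)        ()
 path-matrix-regular (inj₂ refl) (inj₁ refl) (inj₂ (inj₁ refl)) ()
 path-matrix-regular (inj₂ refl) (inj₁ refl) (inj₂ (inj₂ refl)) ()
 path-matrix-regular (inj₂ refl) (inj₂ refl) (inj₁ refl)        ()
 path-matrix-regular (inj₂ refl) (inj₂ refl) (inj₂ (inj₁ refl)) ()
 path-matrix-regular (inj₂ refl) (inj₂ refl) (inj₂ (inj₂ refl)) ()

-- Entries and minors of A + I for a connected graph.

module EccMatrix {n} (G : Graph n) (conn : Connected G) where
  open Metric G conn public

  A : Matrix n n
  A = eccMatrix G

  A-sym : Symmetric A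
  A-sym u v rewrite d-sym u v | ℕ.⊓-comm (ε u) (ε v) = refl

  M : Matrix n n
  M = A +I

  M-sym : Symmetric M
  M-sym u v = cong₂ _+_ (A-sym u v) (δ-sym u v)

  M-diagonal : ∀ u → M u u ≡ 1ℤ
  M-diagonal u rewrite d-refl u | ≡ᵇ-refl (toℕ u) with 0 ≡ᵇ (ε u ⊓ ε u)
  ... | true  = refl
  ... | false = refl

  δ-off : ∀ {u v : Fin n} → u ≢ v → δ u v ≡ 0ℤ
  δ-off {u} {v} u≢v rewrite ≡ᵇ-false (toℕ u) (toℕ v) (u≢v ∘ toℕ-injective) = refl

  M-distance : ∀ {u v} → u ≢ v → d u v ≡ ε u ⊓ ε v → M u v ≡ pos (d u v)
  M-distance {u} {v} u≢v eq rewrite δ-off u≢v | sym eq | ≡ᵇ-refl (d u v) = +-identityʳ (pos (d u v))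

  M-zero : ∀ {u v} → u ≢ v → d u v ≢ ε u ⊓ ε v → M u v ≡ 0ℤ
  M-zero {u} {v} u≢v neq rewrite δ-off u≢v | ≡ᵇ-false (d u v) (ε u ⊓ ε v) neq = refl

  M-zero-< : ∀ {u v k} → u ≢ v → d u v ≤ k → suc k ≤ ε u → suc k ≤ ε v → M u v ≡ 0ℤ
  M-zero-< u≢v d≤k k<u k<v = M-zero u≢v λ eq → ℕ.<-irrefl eq (ℕ.≤-trans (s≤s d≤k) (ℕ.⊓-glb k<u k<v))

  M-equal-ε : ∀ {u v e} → u ≢ v → ε u ≡ e → ε v ≡ e → M u v ≡ 0ℤ ⊎ M u v ≡ pos e
  M-equal-ε {u} {v} {e} u≢v εu εv with d u v ℕ.≟ (ε u ⊓ ε v)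
  ... | yes eq = inj₂ (trans (M-distance u≢v eq) (cong pos (trans eq (trans (cong₂ _⊓_ εu εv) (ℕ.⊓-idem e)))))
  ... | no neq = inj₁ (M-zero u≢v neq)

  M-min : ∀ {u v} → u ≢ v → ε u ≤ d u v → M u v ≡ pos (d u v)
  M-min {u} {v} u≢v ε≤d = M-distance u≢v (ℕ.≤-antisym (ℕ.⊓-glb (d≤ε u v) (d≤ε′ u v))
      (ℕ.≤-trans (ℕ.m⊓n≤m (ε u) (ε v)) ε≤d))

  quint : (a b c d e : Fin n) → Fin 5 → Fin n
  quint a b c d e = a ∷ b ∷ c ∷ d ∷ e ∷ []

  Det-quint : ∀ {a b c d e} {ab ac ad ae bc bd be cd ce de : ℤ} →
    M a b ≡ ab → M a c ≡ ac → M a d ≡ ad → M a e ≡ ae → M b c ≡ bc →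
    M b d ≡ bd → M b e ≡ be → M c d ≡ cd → M c e ≡ ce → M d e ≡ de →
    Det (minor M (quint a b c d e)) ≡ Det (unit-symmetric ab ac ad ae bc bd be cd ce de)
  Det-quint {a} {b} {c} {d} {e} refl refl refl refl refl refl refl refl refl refl = Det-cong {5} {minor M J}
    {unit-symmetric (M a b) (M a c) (M a d) (M a e) (M b c) (M b d) (M b e) (M c d) (M c e) (M d e)}
    (unit-symmetric-rows (minor M J) (λ i j → M-sym (J i) (J j)) (λ i → M-diagonal (J i)))
    where
    J = quint a b c d e

  Rank≤4 : Set
  Rank≤4 = ∀ J → Det {5} (minor M J) ≡ 0ℤ

  -- M restricted to vertices of the common eccentricity e is the identity modulo e.
  equal-ε-regular : ∀ {m} (J : Fin m → Fin n) → Injective J → ∀ e → 2 ≤ e → (∀ i → ε (J i) ≡ e) → Det (minor M J) ≢ 0ℤ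
  equal-ε-regular {m} J inj e 2≤e ε≡e = ≢0-mod {b = Det (δ {m} {m})} {e = pos e} (Det-mod (pos e) (minor M J) δ entry)
    λ e∣1 → ℕ.<-irrefl (sym (∣1⇒≡1 (subst (e ∣_) (cong ∣_∣ (trans (Det≡detℤ (δ {m} {m})) (detℤ-δ m))) e∣1))) 2≤e
    where
    entry : ∀ i j → M (J i) (J j) ≡ δ i j [mod pos e ]
    entry i j with i ≟ᶠ j
    ... | yes refl = 0ℤ , trans (M-diagonal (J i))
        (trans (sym (cong (if_then 1ℤ else 0ℤ) (≡ᵇ-refl (toℕ i))))
        (sym (trans (cong (δ i i +_) (*-zeroʳ (pos e))) (+-identityʳ (δ i i)))))
    ... | no i≢j with M-equal-ε {J i} {J j} (i≢j ∘ inj) (ε≡e i) (ε≡e j)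
    ...   | inj₁ eq = 0ℤ , trans eq (sym (trans (cong₂ _+_ δ≡0 (*-zeroʳ (pos e))) refl))
      where
      δ≡0 : δ i j ≡ 0ℤ
      δ≡0 = cong (if_then 1ℤ else 0ℤ) (≡ᵇ-false (toℕ i) (toℕ j) (i≢j ∘ toℕ-injective))
    ...   | inj₂ eq = 1ℤ , trans eq (sym (trans (cong₂ _+_ δ≡0 (*-identityʳ (pos e))) (+-identityˡ (pos e))))
      where
      δ≡0 : δ i j ≡ 0ℤ
      δ≡0 = cong (if_then 1ℤ else 0ℤ) (≡ᵇ-false (toℕ i) (toℕ j) (i≢j ∘ toℕ-injective))

  ≤1+ : ∀ {u v w k l} → d u v ≤ k → d v w ≤ l → d u w ≤ k ℕ.+ l
  ≤1+ {u} {v} {w} p q = ℕ.≤-trans (d-triangle u v w) (ℕ.+-mono-≤ p q)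

  ≢-d : ∀ {u v w k} → d w u ≤ k → suc k ≤ d w v → u ≢ v
  ≢-d p q refl = ℕ.<-irrefl refl (ℕ.≤-trans (s≤s p) q)

  -- All eccentricities at least 3: no path on five vertices.

  module Radius≥3 (far : ∀ u → 3 ≤ ε u) (rank : Rank≤4) where

    near : ∀ {u v} → u ≢ v → d u v ≤ 2 → M u v ≡ 0ℤ
    near u≢v d≤2 = M-zero-< u≢v d≤2 (far _) (far _)

    within-3 : ∀ {u v} → u ≢ v → d u v ≤ 3 → M u v ≡ 0ℤ ⊎ M u v ≡ pos 3
    within-3 {u} {v} u≢v d≤3 with d u v ℕ.≟ (ε u ⊓ ε v)
    ... | no neq = inj₁ (M-zero u≢v neq)
    ... | yes eq = inj₂ (trans (M-distance u≢v eq)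
        (cong pos (ℕ.≤-antisym d≤3 (subst (3 ≤_) (sym eq) (ℕ.⊓-glb (far u) (far v))))))

    within-4 : ∀ {u v} → u ≢ v → d u v ≤ 4 → M u v ≡ 0ℤ ⊎ M u v ≡ pos 3 ⊎ M u v ≡ pos 4
    within-4 {u} {v} u≢v d≤4 with ℕ.m≤n⇒m<n∨m≡n d≤4
    ... | inj₁ (s≤s d≤3) with within-3 u≢v d≤3
    ...   | inj₁ eq = inj₁ eq
    ...   | inj₂ eq = inj₂ (inj₁ eq)
    within-4 {u} {v} u≢v d≤4 | inj₂ d≡4 with d u v ℕ.≟ (ε u ⊓ ε v)
    ... | no neq = inj₁ (M-zero u≢v neq)
    ... | yes eq = inj₂ (inj₂ (trans (M-distance u≢v eq) (cong pos d≡4)))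

    -- The path need not be induced. Vertices at most two steps apart are closer than every
    -- eccentricity, so their entries vanish and only the pairs 14, 25 and 15 can contribute.
    no-path : ∀ {v₁ v₂ v₃ v₄ v₅} → adj G v₁ v₂ ≡ true → adj G v₂ v₃ ≡ true → adj G v₃ v₄ ≡ true → adj G v₄ v₅ ≡ true →
      v₁ ≢ v₃ → v₁ ≢ v₄ → v₁ ≢ v₅ → v₂ ≢ v₄ → v₂ ≢ v₅ → v₃ ≢ v₅ → ⊥
    no-path {v₁} {v₂} {v₃} {v₄} {v₅} a₁₂ a₂₃ a₃₄ a₄₅ n₁₃ n₁₄ n₁₅ n₂₄ n₂₅ n₃₅ =
      path-matrix-regular (within-3 n₁₄ d₁₄) (within-3 n₂₅ d₂₅) (within-4 n₁₅ d₁₅)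
        (trans (sym (Det-quint (near (adj⇒≢ a₁₂) (1≤2 a₁₂)) (near n₁₃ d₁₃) refl refl (near (adj⇒≢ a₂₃) (1≤2 a₂₃))
                                (near n₂₄ d₂₄) refl (near (adj⇒≢ a₃₄) (1≤2 a₃₄)) (near n₃₅ d₃₅)
                                    (near (adj⇒≢ a₄₅) (1≤2 a₄₅))))
               (rank (quint v₁ v₂ v₃ v₄ v₅)))
      where
      1≤2 : ∀ {u v} → adj G u v ≡ true → d u v ≤ 2
      1≤2 a = ℕ.≤-trans (adj⇒d≤1 a) (s≤s z≤n)
      d₁₃ = ≤1+ (adj⇒d≤1 a₁₂) (adj⇒d≤1 a₂₃)
      d₂₄ = ≤1+ (adj⇒d≤1 a₂₃) (adj⇒d≤1 a₃₄)
      d₃₅ = ≤1+ (adj⇒d≤1 a₃₄) (adj⇒d≤1 a₄₅)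
      d₁₄ = ≤1+ (adj⇒d≤1 a₁₂) d₂₄
      d₂₅ = ≤1+ (adj⇒d≤1 a₂₃) d₃₅
      d₁₅ = ≤1+ (adj⇒d≤1 a₁₂) d₂₅

    -- The first three steps of a geodesic from `u`; the lower bounds are there to keep the vertices
    -- of the later path apart.
    record Geodesic (u : Fin n) : Set where
      field
        {p q y} : Fin n
        up : adj G u p ≡ true
        pq : adj G p q ≡ true
        qy : adj G q y ≡ true
        uq : 2 ≤ d u q
        uy : 3 ≤ d u y

    geodesic : ∀ u → Geodesic u
    geodesic u with ε-attained G u
    ... | v , dv with ℕ.m≤n⇒∃[o]m+o≡n (subst (3 ≤_) (sym dv) (far u))
    ...   | k , 3+k≡d with d-step (sym 3+k≡d)
    ...     | p , up , e₁ with d-step e₁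
    ...       | q , pq , e₂ with d-step e₂
    ...         | y , qy , e₃ = record { up = up ; pq = pq ; qy = qy ; uq = lower 2 q e₂ (sym 3+k≡d) ; uy = lower 3 y
        e₃ (sym 3+k≡d) }
      where
      lower : ∀ i w {l} → d w v ≡ l → d u v ≡ i ℕ.+ l → i ≤ d u w
      lower i w {l} e eq = ℕ.+-cancelʳ-≤ l i (d u w)
          (subst (_≤ d u w ℕ.+ l) eq (subst (λ l → d u v ≤ d u w ℕ.+ l) e (d-triangle u w v)))

    adj-sym′ : ∀ {u v} → adj G u v ≡ true → adj G v u ≡ true
    adj-sym′ {u} {v} a = trans (adj-sym G v u) a

    d-refl-≤ : ∀ u → d u u ≤ 0
    d-refl-≤ u = ℕ.≤-reflexive (d-refl u)

    2≤3 : ∀ {k} → 3 ≤ k → 2 ≤ k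
    2≤3 = ℕ.≤-trans (s≤s (s≤s z≤n))

    1≤2 : ∀ {k} → 2 ≤ k → 1 ≤ k
    1≤2 = ℕ.≤-trans (s≤s z≤n)

    -- A geodesic of length 3 from the neighbour p of v extends to a path on 5 vertices through v.
    extend : ∀ {v} (g : Geodesic v) → Geodesic (Geodesic.p g) → ⊥
    extend {v} g h with v ≟ᶠ Geodesic.p h
    ... | no v≢x = no-path g.up h.up h.pq h.qy
            v≢x (≢-d (adj⇒d≤1 (adj-sym′ g.up)) h.uq) (≢-d (adj⇒d≤1 (adj-sym′ g.up)) (2≤3 h.uy))
            (≢-d (d-refl-≤ g.p) (1≤2 h.uq)) (≢-d (d-refl-≤ g.p) (1≤2 (2≤3 h.uy))) (≢-d (adj⇒d≤1 h.up) (2≤3 h.uy))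
      where
      module g = Geodesic g
      module h = Geodesic h
    -- Here the second geodesic runs back through v, so the path starts further out on the first
    -- one: q, p, v, followed by the last two vertices of the second.
    ... | yes v≡x = no-path (adj-sym′ g.pq) (adj-sym′ g.up) vq h.qy
            (≢-d (d-refl-≤ v) (1≤2 g.uq) ∘ sym) (≢-d (adj⇒d≤1 vq) g.uq ∘ sym) (≢-d (adj⇒d≤1 g.pq) (2≤3 h.uy))
            (≢-d (d-refl-≤ g.p) (1≤2 h.uq)) (≢-d (d-refl-≤ g.p) (1≤2 (2≤3 h.uy)))
                (≢-d (adj⇒d≤1 (adj-sym′ g.up)) (2≤3 h.uy))
      where
      module g = Geodesic g
      module h = Geodesic h
      vq : adj G v h.q ≡ true
      vq = subst (λ x → adj G x h.q ≡ true) (sym v≡x) h.pq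

    contradiction : Fin n → ⊥
    contradiction v = extend (geodesic v) (geodesic _)

  -- A vertex of eccentricity 2 together with two vertices at distance 4.

  module Diameter4 {c z : Fin n} (εc : ε c ≡ 2) (4≤εz : 4 ≤ ε z) (rank : Rank≤4) where

    dc≤2 : ∀ u → d c u ≤ 2
    dc≤2 u = subst (d c u ≤_) εc (d≤ε c u)

    d≤2c : ∀ u → d u c ≤ 2
    d≤2c u = subst (_≤ 2) (d-sym c u) (dc≤2 u)

    z′ : Fin n
    z′ = proj₁ (ε-attained G z)

    4≤dzz′ : 4 ≤ d z z′
    4≤dzz′ = subst (4 ≤_) (sym (proj₂ (ε-attained G z))) 4≤εz

    4≤dz′z : 4 ≤ d z′ z
    4≤dz′z = subst (4 ≤_) (d-sym z z′) 4≤dzz′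

    ε≤4 : ∀ u → ε u ≤ 4
    ε≤4 u = ε≤ λ v → ≤1+ (d≤2c u) (dc≤2 v)

    2≤ : ∀ {u v} → 4 ≤ d u v → 2 ≤ d u c
    2≤ {u} {v} 4≤d = ℕ.+-cancelʳ-≤ 2 2 (d u c) (ℕ.≤-trans 4≤d
        (ℕ.≤-trans (d-triangle u c v) (ℕ.+-monoʳ-≤ (d u c) (dc≤2 v))))

    -- The middle vertex between u and the centre, seen from the opposite end v.
    record Middle (u v : Fin n) : Set where
      field
        {a} : Fin n
        ua  : adj G u a ≡ true
        ac  : adj G a c ≡ true
        av  : d a v ≡ 3
        εa  : ε a ≡ 3

    -- A neighbour of c has eccentricity at most 1 + 2, while a neighbour of u has distance at least
    -- 4 - 1 from v; both bounds are therefore attained.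
    middle : ∀ {u v} → 4 ≤ d u v → Middle u v
    middle {u} {v} 4≤d with d-step (ℕ.≤-antisym (d≤2c u) (2≤ 4≤d))
    ... | a , ua , ac = record { ua = ua ; ac = d≤1⇒adj (ℕ.≤-reflexive ac) (d>0⇒≢ (ℕ.≤-reflexive (sym ac))) ; av = dav
        ; εa = ℕ.≤-antisym (ε≤ a≤3) (subst (_≤ ε a) dav (d≤ε a v)) }
      where
      a≤3 : ∀ w → d a w ≤ 3
      a≤3 w = ≤1+ (ℕ.≤-reflexive ac) (dc≤2 w)
      dav : d a v ≡ 3
      dav = ℕ.≤-antisym (a≤3 v) (ℕ.≤-pred (ℕ.≤-trans 4≤d (≤1+ (adj⇒d≤1 ua) ℕ.≤-refl)))

    module p = Middle (middle 4≤dzz′)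
    module q = Middle (middle 4≤dz′z)

    opaque
      unfolding Det
      -- The three inner indices have zero entries between them. Clearing with them turns the block
      -- of the two ends into diag(-12, -12), so the determinant is 144.
      regular : Det (unit-symmetric 0ℤ (pos 2) (pos 3) (pos 4) 0ℤ 0ℤ (pos 3) 0ℤ (pos 2) 0ℤ) ≢ 0ℤ
      regular ()

    M-end : ∀ {u v} → 4 ≤ d u v → M u c ≡ pos 2
    M-end {u} {v} 4≤d = trans (M-sym u c) (trans (M-min (d>0⇒≢ 2≤d) (subst (_≤ d c u) (sym εc) 2≤d))
      (cong pos (ℕ.≤-antisym (dc≤2 u) 2≤d)))
      where
      2≤d : 2 ≤ d c u
      2≤d = subst (2 ≤_) (d-sym u c) (2≤ 4≤d)

    M-middle : ∀ {u v} → d u v ≡ 3 → ε u ≡ 3 → M u v ≡ pos 3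
    M-middle duv εu = trans (M-min (d>0⇒≢ (ℕ.≤-reflexive (sym duv))) (ℕ.≤-reflexive (trans εu (sym duv))))
        (cong pos duv)

    M-adj : ∀ {u v} → adj G u v ≡ true → 2 ≤ ε u → 2 ≤ ε v → M u v ≡ 0ℤ
    M-adj a = M-zero-< (adj⇒≢ a) (adj⇒d≤1 a)

    2≤ε : ∀ {u k} → ε u ≡ suc (suc k) → 2 ≤ ε u
    2≤ε eq = subst (2 ≤_) (sym eq) (s≤s (s≤s z≤n))

    2≤εend : ∀ {u v} → 4 ≤ d u v → 2 ≤ ε u
    2≤εend {u} {v} 4≤d = ℕ.≤-trans (s≤s (s≤s z≤n)) (ℕ.≤-trans 4≤d (d≤ε u v))

    contradiction : ⊥
    contradiction = regular (trans (sym (Det-quint {z} {p.a} {c} {q.a} {z′}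
      (M-adj p.ua (2≤εend 4≤dzz′) (2≤ε p.εa))
      (M-end 4≤dzz′)
      (trans (M-sym z q.a) (M-middle q.av q.εa))
      (trans (M-min (d>0⇒≢ 4≤dzz′) (ℕ.≤-trans (ε≤4 z) 4≤dzz′))
          (cong pos (ℕ.≤-antisym (ℕ.≤-trans (d≤ε z z′) (ε≤4 z)) 4≤dzz′)))
      (M-adj p.ac (2≤ε p.εa) (2≤ε εc))
      (M-zero-< p≢q (≤1+ (adj⇒d≤1 p.ac) (subst (_≤ 1) (d-sym q.a c) (adj⇒d≤1 q.ac))) (ℕ.≤-reflexive (sym p.εa))
          (ℕ.≤-reflexive (sym q.εa)))
      (M-middle p.av p.εa)
      (trans (M-sym c q.a) (M-adj q.ac (2≤ε q.εa) (2≤ε εc)))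
      (trans (M-sym c z′) (M-end 4≤dz′z))
      (trans (M-sym q.a z′) (M-adj q.ua (2≤εend 4≤dz′z) (2≤ε q.εa)))))
      (rank (quint z p.a c q.a z′)))
      where
      p≢q : p.a ≢ q.a
      p≢q eq = ℕ.<-irrefl refl (ℕ.≤-trans (s≤s (adj⇒d≤1 q.ua))
          (ℕ.≤-trans (ℕ.n≤1+n 2) (ℕ.≤-reflexive (sym
          (trans (d-sym z′ q.a) (trans (cong (λ w → d w z′) (sym eq)) p.av))))))

  radius≤1 : 9 ≤ n → Rank≤4 → ∃[ u ] ε u ≤ 1
  radius≤1 9≤n rank with any? (λ u → ε u ≤? 1)
  ... | yes found = found
  ... | no  none with any? (λ u → ε u ℕ.≟ 2)
  ...   | no none₂ = ⊥-elim (Radius≥3.contradiction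
      (λ u → ℕ.≤∧≢⇒< (ℕ.≰⇒> (λ ε≤1 → none (u , ε≤1))) (λ eq → none₂ (u , sym eq))) rank (first 9≤n))
    where
    first : ∀ {n} → 9 ≤ n → Fin n
    first (s≤s _) = fz
  ...   | yes (c , εc) with any? (λ z → 4 ≤? ε z)
  ...     | yes (z , 4≤εz) = ⊥-elim (Diameter4.contradiction εc 4≤εz rank)
  -- Now every eccentricity is 2 or 3. Five vertices of the same kind are guaranteed from 9 = 5 + 5
  -- - 1 vertices on, which is the origin of the bound on n.
  ...     | no none₄ with bipartition (λ u → ε u ≡ᵇ 2) 5 5 (s≤s 9≤n)
  ...       | inj₁ (J , inj , all) = ⊥-elim (equal-ε-regular J inj 2 ℕ.≤-refl (λ i → ≡ᵇ-true (ε (J i)) 2 (all i))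
      (rank J))
  ...       | inj₂ (J , inj , all) = ⊥-elim (equal-ε-regular J inj 3 (ℕ.n≤1+n 2) three (rank J))
    where
    three : ∀ i → ε (J i) ≡ 3
    three i = ℕ.≤-antisym (ℕ.≤-pred (ℕ.≰⇒> (λ 4≤ε → none₄ (J i , 4≤ε))))
      (ℕ.≤∧≢⇒< (ℕ.≰⇒> (λ ε≤1 → none (J i , ε≤1))) λ 2≡ε → absurd (ε (J i)) (sym 2≡ε) (all i))
      where
      absurd : ∀ e → e ≡ 2 → (e ≡ᵇ 2) ≡ false → ⊥
      absurd .2 refl ()

-- The complement of G is a triangle or a path on {a,b,c}, according to e, plus isolated vertices.
record Cone {n} (G : Graph n) (e : Bool) : Set where
  field
    {a b c}   : Fin n
    a≢b       : a ≢ b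
    a≢c       : a ≢ c
    b≢c       : b ≢ c
    ab        : adj G a b ≡ e
    ac        : adj G a c ≡ false
    bc        : adj G b c ≡ false
    dominates : ∀ {u v} → u ≢ a → u ≢ b → u ≢ c → u ≢ v → adj G u v ≡ true

-- Graphs with a dominating vertex.

module Radius≤1 {n} (G : Graph n) (conn : Connected G) {o : Fin n} (εo : ecc G o ≤ 1) where
  open EccMatrix G conn

  M-dominating : ∀ {u} v → ε u ≤ 1 → M u v ≡ 1ℤ
  M-dominating {u} v εu with u ≟ᶠ v
  ... | yes refl = M-diagonal u
  ... | no u≢v   = trans (M-min u≢v (ℕ.≤-trans εu (≢⇒d>0 u≢v)))
      (cong pos (ℕ.≤-antisym (ℕ.≤-trans (d≤ε u v) εu) (≢⇒d>0 u≢v)))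

  dominating-adj : ∀ {u v} → ε u ≤ 1 → u ≢ v → adj G u v ≡ true
  dominating-adj {u} {v} εu = d≤1⇒adj (ℕ.≤-trans (d≤ε u v) εu)

  d≤2 : ∀ u v → d u v ≤ 2
  d≤2 u v = ≤1+ (ℕ.≤-trans (d≤ε′ u o) εo) (ℕ.≤-trans (d≤ε o v) εo)

  Peripheral : Fin n → Set
  Peripheral u = ¬ (ε u ≤ 1)

  ε-peripheral : ∀ {u} → Peripheral u → ε u ≡ 2
  ε-peripheral {u} pu = ℕ.≤-antisym (ε≤ (d≤2 u)) (ℕ.≰⇒> pu)

  M-peripheral : ∀ {u v} → Peripheral u → Peripheral v → u ≢ v → M u v ≡ (if adj G u v then 0ℤ else pos 2)
  M-peripheral {u} {v} pu pv u≢v with adj G u v in eq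
  ... | true  = M-zero-< u≢v (adj⇒d≤1 eq) (ℕ.≤-reflexive (sym (ε-peripheral pu)))
      (ℕ.≤-reflexive (sym (ε-peripheral pv)))
  ... | false = trans (M-min u≢v (ℕ.≤-trans (ℕ.≤-reflexive (ε-peripheral pu)) 2≤d))
      (cong pos (ℕ.≤-antisym (d≤2 u v) 2≤d))
    where
    2≤d : 2 ≤ d u v
    2≤d = ℕ.≰⇒> λ d≤1 → case-absurd (trans (sym eq) (d≤1⇒adj d≤1 u≢v))
      where
      case-absurd : false ≡ true → ⊥
      case-absurd ()

  -- Modulo 2 the entries between peripheral vertices vanish, leaving the identity bordered by ones;
  -- its determinant is 1 - 4 = -3.
  four-peripheral : Rank≤4 → ∀ {w₁ w₂ w₃ w₄} → Peripheral w₁ → Peripheral w₂ → Peripheral w₃ → Peripheral w₄ →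
    w₁ ≢ w₂ → w₁ ≢ w₃ → w₁ ≢ w₄ → w₂ ≢ w₃ → w₂ ≢ w₄ → w₃ ≢ w₄ → ⊥
  four-peripheral rank {w₁} {w₂} {w₃} {w₄} p₁ p₂ p₃ p₄ n₁₂ n₁₃ n₁₄ n₂₃ n₂₄ n₃₄ =
    ≢0-mod {b = Det L} {e = pos 2} (Det-mod (pos 2) N L mod2) odd
        (trans (sym (Det-quint (M-dominating w₁ εo) (M-dominating w₂ εo) (M-dominating w₃ εo) (M-dominating w₄ εo)
      refl refl refl refl refl refl)) (rank (quint o w₁ w₂ w₃ w₄)))
    where
    N L : Matrix 5 5
    N = unit-symmetric 1ℤ 1ℤ 1ℤ 1ℤ (M w₁ w₂) (M w₁ w₃) (M w₁ w₄) (M w₂ w₃) (M w₂ w₄) (M w₃ w₄)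
    L = unit-symmetric 1ℤ 1ℤ 1ℤ 1ℤ 0ℤ 0ℤ 0ℤ 0ℤ 0ℤ 0ℤ
    opaque
      unfolding Det
      odd : ¬ (2 ∣ ∣ Det L ∣)
      odd = toWitnessFalse {a? = 2 ∣? ∣ Det L ∣} _
    even : ∀ {u v} → Peripheral u → Peripheral v → u ≢ v → M u v ≡ 0ℤ [mod pos 2 ]
    even {u} {v} pu pv u≢v with M-equal-ε u≢v (ε-peripheral pu) (ε-peripheral pv)
    ... | inj₁ eq = 0ℤ , eq
    ... | inj₂ eq = 1ℤ , eq
    same : ∀ {a} → a ≡ a [mod pos 2 ]
    same {a} = 0ℤ , sym (+-identityʳ a)
    mod2 : ∀ i j → N i j ≡ L i j [mod pos 2 ]
    mod2 0F 0F = same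
    mod2 0F 1F = same
    mod2 0F 2F = same
    mod2 0F 3F = same
    mod2 0F 4F = same
    mod2 1F 0F = same
    mod2 1F 1F = same
    mod2 1F 2F = even p₁ p₂ n₁₂
    mod2 1F 3F = even p₁ p₃ n₁₃
    mod2 1F 4F = even p₁ p₄ n₁₄
    mod2 2F 0F = same
    mod2 2F 1F = even p₁ p₂ n₁₂
    mod2 2F 2F = same
    mod2 2F 3F = even p₂ p₃ n₂₃
    mod2 2F 4F = even p₂ p₄ n₂₄
    mod2 3F 0F = same
    mod2 3F 1F = even p₁ p₃ n₁₃
    mod2 3F 2F = even p₂ p₃ n₂₃
    mod2 3F 3F = same
    mod2 3F 4F = even p₃ p₄ n₃₄
    mod2 4F 0F = same
    mod2 4F 1F = even p₁ p₄ n₁₄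
    mod2 4F 2F = even p₂ p₄ n₂₄
    mod2 4F 3F = even p₃ p₄ n₃₄
    mod2 4F 4F = same

  module Classify (rank : Rank≤4) (I : Fin 4 → Fin n) (regular : Det (minor M I) ≢ 0ℤ) where

    rows-differ : ∀ {i j} → i ≢ j → ¬ (∀ v → M (I i) v ≡ M (I j) v)
    rows-differ {i} {j} i≢j eq = regular (trans (Det≡detℤ (minor M I))
        (detℤ-dup (minor M I) i j i≢j (λ k → eq (I k))))

    I≢ : ∀ {i j} → i ≢ j → I i ≢ I j
    I≢ i≢j Ii≡Ij = rows-differ i≢j (λ v → cong (λ u → M u v) Ii≡Ij)

    -- Every dominating vertex has a row of ones, so a nonsingular block contains at most one of
    -- them; at least three of its four vertices are peripheral.
    peripheral : ∀ {i j} → i ≢ j → ε (I i) ≤ 1 → Peripheral (I j)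
    peripheral i≢j εi εj = rows-differ i≢j (λ v → trans (M-dominating v εi) (sym (M-dominating v εj)))

    module _ {a b c} (pa : Peripheral a) (pb : Peripheral b) (pc : Peripheral c) (a≢b : a ≢ b) (a≢c : a ≢ c)
        (b≢c : b ≢ c) where

      dominates : ∀ {u v} → u ≢ a → u ≢ b → u ≢ c → u ≢ v → adj G u v ≡ true
      dominates {u} u≢a u≢b u≢c with ε u ≤? 1
      ... | yes εu = dominating-adj εu
      ... | no  pu = ⊥-elim (four-peripheral rank pa pb pc pu a≢b a≢c (u≢a ∘ sym) b≢c (u≢b ∘ sym) (u≢c ∘ sym))

      -- Adjacent to y and z as well as to all others, x would itself be dominating. Hence at most
      -- one edge runs inside the peripheral triple.
      non-neighbour : ∀ {x y z} → Peripheral x → (∀ {u} → u ≢ x → u ≢ y → u ≢ z → adj G u x ≡ true) →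
        adj G x y ≡ true → adj G x z ≡ true → ⊥
      non-neighbour {x} {y} {z} px dom xy xz = px (ε≤ bound)
        where
        bound : ∀ v → d x v ≤ 1
        bound v with v ≟ᶠ x | v ≟ᶠ y | v ≟ᶠ z
        ... | yes refl | _        | _        = ℕ.≤-trans (ℕ.≤-reflexive (d-refl x)) z≤n
        ... | no _     | yes refl | _        = adj⇒d≤1 xy
        ... | no _     | no _     | yes refl = adj⇒d≤1 xz
        ... | no v≢x   | no v≢y   | no v≢z   = adj⇒d≤1 (trans (adj-sym G x v) (dom v≢x v≢y v≢z))

      classify : ∃[ e ] Cone G e
      classify with adj G a b in ab | adj G a c in ac | adj G b c in bc
      ... | false | false | false = false , record
          { a≢b = a≢b ; a≢c = a≢c ; b≢c = b≢c ; ab = ab ; ac = ac ; bc = bc ; dominates = dominates }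
      ... | true  | false | false = true , record { a≢b = a≢b ; a≢c = a≢c ; b≢c = b≢c ; ab = ab ; ac = ac ; bc = bc ;
          dominates = dominates }
      -- The only edge of the triple is renamed to `ab`, as `Cone` requires.
      ... | false | true  | false = true , record { a≢b = a≢c ; a≢c = a≢b ; b≢c = b≢c ∘ sym ; ab = ac ; ac = ab ; bc =
          trans (adj-sym G c b) bc ; dominates = λ n₁ n₂ n₃ → dominates n₁ n₃ n₂ }
      ... | false | false | true  = true , record { a≢b = b≢c ; a≢c = a≢b ∘ sym ; b≢c = a≢c ∘ sym ; ab = bc ; ac =
          trans (adj-sym G b a) ab ; bc = trans (adj-sym G c a) ac ; dominates = λ n₁ n₂ n₃ → dominates n₃ n₁ n₂ }
      ... | true  | true  | _     = ⊥-elim (non-neighbour pa (λ n₁ n₂ n₃ → dominates n₁ n₂ n₃ n₁) ab ac)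
      ... | true  | false | true  = ⊥-elim (non-neighbour pb (λ n₁ n₂ n₃ → dominates n₂ n₁ n₃ n₁)
          (trans (adj-sym G b a) ab) bc)
      ... | false | true  | true  = ⊥-elim (non-neighbour pc (λ n₁ n₂ n₃ → dominates n₂ n₃ n₁ n₁)
          (trans (adj-sym G c a) ac) (trans (adj-sym G c b) bc))

    cone : ∃[ e ] Cone G e
    cone with ε (I 0F) ≤? 1 | ε (I 1F) ≤? 1 | ε (I 2F) ≤? 1
    ... | yes ε₀ | _      | _      = classify (peripheral {0F} {1F} (λ ()) ε₀) (peripheral {0F} {2F} (λ ()) ε₀)
        (peripheral {0F} {3F} (λ ()) ε₀) (I≢ λ ()) (I≢ λ ()) (I≢ λ ())
    ... | no p₀  | yes ε₁ | _      = classify p₀ (peripheral {1F} {2F} (λ ()) ε₁) (peripheral {1F} {3F} (λ ()) ε₁)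
        (I≢ λ ()) (I≢ λ ()) (I≢ λ ())
    ... | no p₀  | no p₁  | yes ε₂ = classify p₀ p₁ (peripheral {2F} {3F} (λ ()) ε₂) (I≢ λ ()) (I≢ λ ()) (I≢ λ ())
    ... | no p₀  | no p₁  | no p₂  = classify p₀ p₁ p₂ (I≢ λ ()) (I≢ λ ()) (I≢ λ ())

-- From rank four to the shape of the graph.

module EccSpectrum {n} (G : Graph n) (conn : Connected G) where
  open EccMatrix G conn public
  open MinusOne A A-sym public hiding (M)

  rank-4⇒Cone : 9 ≤ n → r ≡ 4 → ∃[ e ] Cone G e
  rank-4⇒Cone 9≤n r≡4 = Radius≤1.Classify.cone G conn (proj₂ (radius≤1 9≤n rank)) rank (proj₁ I₄) (proj₂ I₄)
    where
    rank : Rank≤4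
    rank J = trans (Det≡detℤ (minor M J)) (minor-singular factor (ℕ.≤-reflexive (cong suc r≡4)) J)
    I₄ : Σ (Fin 4 → Fin n) λ I → Det (minor M I) ≢ 0ℤ
    I₄ = subst (λ r → Σ (Fin r → Fin n) λ I → Det (minor M I) ≢ 0ℤ) r≡4
        (I , λ eq → regular (trans (sym (Det≡detℤ (minor M I))) eq))

module ConeClass {n} {G : Graph n} {e} (cone : Cone G e) where
  open Cone cone public

  -- Evidence instead of equations κ u ≡ i: matching on it exposes u ≡ a and the like, so that the
  -- tables below are plain case lists.
  data Class (u : Fin n) : Fin 4 → Set where
    isA     : u ≡ a → Class u 0F
    isB     : u ≡ b → Class u 1F
    isC     : u ≡ c → Class u 2F
    outside : u ≢ a → u ≢ b → u ≢ c → Class u 3F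

  κΣ : ∀ u → Σ (Fin 4) (Class u)
  κΣ u with u ≟ᶠ a | u ≟ᶠ b | u ≟ᶠ c
  ... | yes u≡a | _       | _       = 0F , isA u≡a
  ... | no _    | yes u≡b | _       = 1F , isB u≡b
  ... | no _    | no _    | yes u≡c = 2F , isC u≡c
  ... | no u≢a  | no u≢b  | no u≢c  = 3F , outside u≢a u≢b u≢c

  κ : Fin n → Fin 4
  κ u = proj₁ (κΣ u)

  class : ∀ u → Class u (κ u)
  class u = proj₂ (κΣ u)

  adjacency : Fin 4 → Fin 4 → Bool
  adjacency 3F _  = true
  adjacency _  3F = true
  adjacency 0F 1F = e
  adjacency 1F 0F = e
  adjacency _  _  = false

  adj-class : ∀ {u v i j} → u ≢ v → Class u i → Class v j → adj G u v ≡ adjacency i j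
  adj-class u≢v (isA refl) (isA refl) = ⊥-elim (u≢v refl)
  adj-class u≢v (isA refl) (isB refl) = ab
  adj-class u≢v (isA refl) (isC refl) = ac
  adj-class u≢v (isB refl) (isA refl) = trans (adj-sym G b a) ab
  adj-class u≢v (isB refl) (isB refl) = ⊥-elim (u≢v refl)
  adj-class u≢v (isB refl) (isC refl) = bc
  adj-class u≢v (isC refl) (isA refl) = trans (adj-sym G c a) ac
  adj-class u≢v (isC refl) (isB refl) = trans (adj-sym G c b) bc
  adj-class u≢v (isC refl) (isC refl) = ⊥-elim (u≢v refl)
  adj-class u≢v (outside p q r) _ = dominates p q r u≢v
  adj-class {u} {v} u≢v (isA _) (outside p q r) = trans (adj-sym G u v) (dominates p q r (u≢v ∘ sym))
  adj-class {u} {v} u≢v (isB _) (outside p q r) = trans (adj-sym G u v) (dominates p q r (u≢v ∘ sym))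
  adj-class {u} {v} u≢v (isC _) (outside p q r) = trans (adj-sym G u v) (dominates p q r (u≢v ∘ sym))

  -- Two of five vertices share one of the four classes, and the classes of a, b and c are
  -- singletons.
  outside-exists : 5 ≤ n → ∃[ o ] Class o 3F
  outside-exists 5≤n with pigeonhole 5≤n κ
  ... | i , j , i<j , κi≡κj = i , both (class i) (subst (Class j) (sym κi≡κj) (class j))
    where
    both : ∀ {k} → Class i k → Class j k → Class i 3F
    both (isA refl) (isA refl) = ⊥-elim (<ᶠ⇒≢ i<j refl)
    both (isB refl) (isB refl) = ⊥-elim (<ᶠ⇒≢ i<j refl)
    both (isC refl) (isC refl) = ⊥-elim (<ᶠ⇒≢ i<j refl)
    both (outside p q r) _     = outside p q r

  connected : 5 ≤ n → Connected G
  connected 5≤n u v = Path⇒within G (Path-≤ G (ℕ.≤-trans (s≤s (s≤s z≤n)) 5≤n) (through u v))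
    where
    o = proj₁ (outside-exists 5≤n)
    dom : ∀ {v} → o ≢ v → adj G o v ≡ true
    dom with proj₂ (outside-exists 5≤n)
    ... | outside p q r = dominates p q r
    from-o : ∀ v → Path G 1 o v
    from-o v with o ≟ᶠ v
    ... | yes refl = here
    ... | no o≢v   = step (dom o≢v) here
    through : ∀ u v → Path G 2 u v
    through u v = Path-++ G (Path-sym G (from-o u)) (from-o v)

-- A + I between the vertices a, b, c and any dominating vertex, in this order.
model : Bool → Matrix 4 4
model e = (1ℤ ∷ x ∷ pos 2 ∷ 1ℤ ∷ []) ∷ (x ∷ 1ℤ ∷ pos 2 ∷ 1ℤ ∷ []) ∷ (pos 2 ∷ pos 2 ∷ 1ℤ ∷ 1ℤ ∷ []) ∷
    (1ℤ ∷ 1ℤ ∷ 1ℤ ∷ 1ℤ ∷ []) ∷ []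
  where
  x : ℤ
  x = if e then 0ℤ else pos 2

-- The sign of `Det (model e)`: subtracting the row of ones leaves a symmetric 3 × 3 matrix with
-- zero diagonal and off-diagonal entries 1, except for the entry -1 at ab when e is true, so the
-- value is -2 or 2.
σ : Bool → ℤ
σ true  = - 1ℤ
σ false = 1ℤ

quad : (a b c d : Fin 4) → Fin 4 → Fin 4
quad a b c d = a ∷ b ∷ c ∷ d ∷ []

quad-η : ∀ (f : Fin 4 → Fin 4) i → f i ≡ quad (f 0F) (f 1F) (f 2F) (f 3F) i
quad-η f 0F = refl
quad-η f 1F = refl
quad-η f 2F = refl
quad-η f 3F = refl

opaque
  unfolding Det

  Det-model : ∀ e → Det (model e) ≢ 0ℤ
  Det-model true  ()
  Det-model false ()

  -- The block found by `reduce` has unknown classes, so all 256 choices are evaluated: a repeated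
  -- class gives 0, and a permutation acts on rows and columns alike and keeps the determinant.
  Det-quad : ∀ e a b c d → 0ℤ ≤ℤ σ e * Det (minor (model e) (quad a b c d))
  Det-quad true  = toWitness {a? = all? λ a → all? λ b → all? λ c → all? λ d → 0ℤ ≤?ℤ
      (σ true * Det (minor (model true) (quad a b c d)))} _
  Det-quad false = toWitness {a? = all? λ a → all? λ b → all? λ c → all? λ d → 0ℤ ≤?ℤ
      (σ false * Det (minor (model false) (quad a b c d)))} _

σ-nonzero : ∀ e → σ e ≢ 0ℤ
σ-nonzero true  ()
σ-nonzero false ()

Det-model-sign : ∀ e {r} → r ≡ 4 → (f : Fin r → Fin 4) → Det (minor (model e) f) ≢ 0ℤ → 0ℤ <ℤ σ e * Det
    (minor (model e) f)
Det-model-sign e refl f D≢0 = ≤∧≢⇒< (subst (λ D → 0ℤ ≤ℤ σ e * D)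
    (sym (Det-cong λ i j → cong₂ (model e) (quad-η f i) (quad-η f j)))
  (Det-quad e (f 0F) (f 1F) (f 2F) (f 3F))) (λ eq → *-nonzero (σ-nonzero e) D≢0 (sym eq))

-- Rank and lowest coefficient of the two target graphs.

module ConeSpectrum {n} (G : Graph n) (conn : Connected G) {e} (cone : Cone G e) (5≤n : 5 ≤ n) where
  open EccSpectrum G conn public renaming (b to β; b>0 to β>0)
  open ConeClass cone

  o : Fin n
  o = proj₁ (outside-exists 5≤n)

  o-outside : Class o 3F
  o-outside = proj₂ (outside-exists 5≤n)

  dominating : ∀ {u} → Class u 3F → ε u ≤ 1
  dominating {u} (outside p q r) = ε≤ bound
    where
    bound : ∀ v → d u v ≤ 1
    bound v with u ≟ᶠ v
    ... | yes refl = ℕ.≤-trans (ℕ.≤-reflexive (d-refl u)) z≤n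
    ... | no u≢v   = adj⇒d≤1 (dominates p q r u≢v)

  open Radius≤1 G conn (dominating o-outside)

  non-adjacent : ∀ {u v} → u ≢ v → adj G u v ≡ false → Peripheral u
  non-adjacent u≢v nadj εu with trans (sym nadj) (dominating-adj εu u≢v)
  ... | ()

  pa : Peripheral a
  pa = non-adjacent a≢c ac

  pb : Peripheral b
  pb = non-adjacent b≢c bc

  pc : Peripheral c
  pc = non-adjacent (a≢c ∘ sym) (trans (adj-sym G c a) ac)

  M-class : ∀ {u v i j} → Class u i → Class v j → M u v ≡ model e i j
  M-class (isA refl) (isA refl) = M-diagonal a
  M-class (isB refl) (isB refl) = M-diagonal b
  M-class (isC refl) (isC refl) = M-diagonal c
  M-class (isA refl) (isB refl) = trans (M-peripheral pa pb a≢b) (cong (if_then 0ℤ else pos 2) ab)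
  M-class (isA refl) (isC refl) = trans (M-peripheral pa pc a≢c) (cong (if_then 0ℤ else pos 2) ac)
  M-class (isB refl) (isC refl) = trans (M-peripheral pb pc b≢c) (cong (if_then 0ℤ else pos 2) bc)
  M-class (isB refl) (isA refl) = trans (M-sym b a) (M-class (isA refl) (isB refl))
  M-class (isC refl) (isA refl) = trans (M-sym c a) (M-class (isA refl) (isC refl))
  M-class (isC refl) (isB refl) = trans (M-sym c b) (M-class (isB refl) (isC refl))
  M-class {u} {v} q@(outside _ _ _) (isA _) = M-dominating v (dominating q)
  M-class {u} {v} q@(outside _ _ _) (isB _) = M-dominating v (dominating q)
  M-class {u} {v} q@(outside _ _ _) (isC _) = M-dominating v (dominating q)
  M-class {u} {v} q@(outside _ _ _) (outside _ _ _) = M-dominating v (dominating q)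
  M-class {u} {v} (isA _) q@(outside _ _ _) = trans (M-sym u v) (M-dominating u (dominating q))
  M-class {u} {v} (isB _) q@(outside _ _ _) = trans (M-sym u v) (M-dominating u (dominating q))
  M-class {u} {v} (isC _) q@(outside _ _ _) = trans (M-sym u v) (M-dominating u (dominating q))

  M-model : ∀ u v → M u v ≡ model e (κ u) (κ v)
  M-model u v = M-class (class u) (class v)

  -- More than four indices would include two of the same class, hence two equal rows in a
  -- nonsingular block.
  r≤4 : r ≤ 4
  r≤4 = ℕ.≮⇒≥ λ 4<r → repeated (pigeonhole 4<r (κ ∘ I))
    where
    repeated : ∃[ i ] ∃[ j ] (i <ᶠ j × κ (I i) ≡ κ (I j)) → ⊥
    repeated (i , j , i<j , eq) = regular (detℤ-dup (minor M I) i j (<ᶠ⇒≢ i<j)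
      (λ k → trans (M-model (I i) (I k)) (trans (cong (λ q → model e q (κ (I k))) eq) (sym (M-model (I j) (I k))))))

  -- The vertices a, b, c, o realise the nonsingular `model e`, which a factorisation through fewer
  -- than four columns forbids.
  r≥4 : 4 ≤ r
  r≥4 = ℕ.≮⇒≥ λ r<4 → Det-model e (trans (Det-cong (λ i j → sym (M-class (J-class i) (J-class j))))
      (trans (Det≡detℤ (minor M J)) (minor-singular factor r<4 J)))
    where
    J : Fin 4 → Fin n
    J = a ∷ b ∷ c ∷ o ∷ []
    J-class : ∀ i → Class (J i) i
    J-class 0F = isA refl
    J-class 1F = isB refl
    J-class 2F = isC refl
    J-class 3F = o-outside

  r≡4 : r ≡ 4
  r≡4 = ℕ.≤-antisym r≤4 r≥4

  k≡n∸4 : k ≡ n ∸ 4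
  k≡n∸4 = trans (sym (ℕ.m+n∸n≡m k 4)) (cong (_∸ 4) (trans (cong (k ℕ.+_) (sym r≡4)) k+r≡n))

  -- Since r = 4 is even, the power of - d′ is positive, and so is the scalar `β`; the sign is that
  -- of the minor alone.
  Q-sign : 0ℤ <ℤ σ e * eval Q (- 1ℤ)
  Q-sign = subst (0ℤ <ℤ_) (sym (trans (cong (σ e *_) lowest) (rearrange (σ e) β ((- d′) ^ℤ r) (detℤ (minor M I)))))
    (*-pos β>0 (*-pos (even-power r≡4) (subst (λ D → 0ℤ <ℤ σ e * D) Det≡
        (Det-model-sign e r≡4 (κ ∘ I) (λ eq → regular (trans (sym Det≡) eq))))))
    where
    rearrange : ∀ s b p D → s * (b * (p * D)) ≡ b * (p * (s * D))
    rearrange = solve-∀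
    fourth-power : ∀ d → - d * (- d * (- d * (- d * 1ℤ))) ≡ (d * d) * (d * d)
    fourth-power = solve-∀
    even-power : ∀ {r} → r ≡ 4 → 0ℤ <ℤ (- d′) ^ℤ r
    even-power refl = subst (0ℤ <ℤ_) (sym (fourth-power d′)) (*-pos (*-pos d′>0 d′>0) (*-pos d′>0 d′>0))
    Det≡ : Det (minor (model e) (κ ∘ I)) ≡ detℤ (minor M I)
    Det≡ = trans (Det-cong (λ i j → sym (M-model (I i) (I j)))) (Det≡detℤ (minor M I))

-- The lowest nonzero coefficient of the characteristic polynomial at -1 has the sign of σ e.
charPoly-distinguishes : ∀ {n} (G H : Graph n) → Connected G → Connected H → ∀ {e f} → Cone G e → Cone H f → 5 ≤ n →
  eccCharPoly G ≈p eccCharPoly H → e ≡ f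
charPoly-distinguishes {n} G H connG connH {e} {f} coneG coneH 5≤n P≈ = signs e f X.Q-sign Y.Q-sign
  where
  module X = ConeSpectrum G connG coneG 5≤n
  module Y = ConeSpectrum H connH coneH 5≤n
  module OX = RootOrder X.order
  module OY = RootOrder Y.order
  open ≡-Reasoning
  agree : ∀ t → eval (scalep OY.a X.Q) (pos (suc t)) ≡ eval (scalep OX.a Y.Q) (pos (suc t))
  agree t = *-cancelˡ (^ℤ-nonzero {y} (λ ()) X.k) (begin
    (y ^ℤ X.k) * eval (scalep OY.a X.Q) x     ≡⟨ cong ((y ^ℤ X.k) *_) (eval-scalep OY.a X.Q x) ⟩
    (y ^ℤ X.k) * (OY.a * eval X.Q x)          ≡⟨ swap (y ^ℤ X.k) OY.a (eval X.Q x) ⟩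
    OY.a * ((y ^ℤ X.k) * eval X.Q x)          ≡⟨ cong (OY.a *_) (sym (OX.identity x)) ⟩
    OY.a * (OX.a * eval (eccCharPoly G) x)    ≡⟨ swap OY.a OX.a (eval (eccCharPoly G) x) ⟩
    OX.a * (OY.a * eval (eccCharPoly G) x)    ≡⟨ cong (λ z → OX.a * (OY.a * z))
        (eval-≈p (eccCharPoly G) (eccCharPoly H) P≈ x) ⟩
    OX.a * (OY.a * eval (eccCharPoly H) x)    ≡⟨ cong (OX.a *_) (OY.identity x) ⟩
    OX.a * ((y ^ℤ Y.k) * eval Y.Q x)          ≡⟨ cong (λ k → OX.a * ((y ^ℤ k) * eval Y.Q x))
        (trans Y.k≡n∸4 (sym X.k≡n∸4)) ⟩
    OX.a * ((y ^ℤ X.k) * eval Y.Q x)          ≡⟨ swap OX.a (y ^ℤ X.k) (eval Y.Q x) ⟩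
    (y ^ℤ X.k) * (OX.a * eval Y.Q x)          ≡⟨ cong ((y ^ℤ X.k) *_) (sym (eval-scalep OX.a Y.Q x)) ⟩
    (y ^ℤ X.k) * eval (scalep OX.a Y.Q) x ∎)
    where
    x = pos (suc t)
    y = x + 1ℤ
    swap : ∀ a b c → a * (b * c) ≡ b * (a * c)
    swap = solve-∀
  p q : ℤ
  p = eval X.Q (- 1ℤ)
  q = eval Y.Q (- 1ℤ)
  equal : OY.a * p ≡ OX.a * q
  equal = trans (sym (eval-scalep OY.a X.Q (- 1ℤ)))
      (trans (eval-extend (scalep OY.a X.Q) (scalep OX.a Y.Q) agree (- 1ℤ)) (eval-scalep OX.a Y.Q (- 1ℤ)))
  opposite : ∀ s → 0ℤ <ℤ s * p → 0ℤ <ℤ - s * q → ⊥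
  opposite s sp -sq = <-irrefl (lemma (OX.a * (s * q))) (<-trans′ (*-pos OX.a>0 -sq) (*-pos OY.a>0 sp))
    where
    lemma : ∀ a → 0ℤ ≡ - a + a
    lemma = solve-∀
    <-trans′ : 0ℤ <ℤ OX.a * (- s * q) → 0ℤ <ℤ OY.a * (s * p) → 0ℤ <ℤ - (OX.a * (s * q)) + OX.a * (s * q)
    <-trans′ u v = +-mono-< (subst (0ℤ <ℤ_) (neg OX.a s q) u) (subst (0ℤ <ℤ_) move v)
      where
      neg : ∀ a s q → a * (- s * q) ≡ - (a * (s * q))
      neg = solve-∀
      swap : ∀ a b c → a * (b * c) ≡ b * (a * c)
      swap = solve-∀
      move : OY.a * (s * p) ≡ OX.a * (s * q)
      move = trans (swap OY.a s p) (trans (cong (s *_) equal) (swap s OX.a q))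
  signs : ∀ e f → 0ℤ <ℤ σ e * p → 0ℤ <ℤ σ f * q → e ≡ f
  signs true  true  _ _ = refl
  signs false false _ _ = refl
  signs true  false u v = ⊥-elim (opposite (- 1ℤ) u v)
  signs false true  u v = ⊥-elim (opposite 1ℤ u v)

-- Isomorphisms between cones of the same type.

transpose-left : ∀ {n} (i j : Fin n) → transpose i j ⟨$⟩ʳ i ≡ j
transpose-left i j with i ≟ᶠ i
... | yes _  = refl
... | no i≢i = ⊥-elim (i≢i refl)

transpose-fixes : ∀ {n} (i j : Fin n) {k} → k ≢ i → k ≢ j → transpose i j ⟨$⟩ʳ k ≡ k
transpose-fixes i j {k} k≢i k≢j with k ≟ᶠ i
... | yes k≡i = ⊥-elim (k≢i k≡i)
... | no _ with k ≟ᶠ j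
...   | yes k≡j = ⊥-elim (k≢j k≡j)
...   | no _    = refl

⟨$⟩ʳ-injective : ∀ {n} (π : Permutation′ n) {u v} → π ⟨$⟩ʳ u ≡ π ⟨$⟩ʳ v → u ≡ v
⟨$⟩ʳ-injective π {u} {v} eq = trans (sym (inverseˡ π)) (trans (cong (π ⟨$⟩ˡ_) eq) (inverseˡ π))

-- Three transpositions in turn; by injectivity each of them avoids the points that are already in
-- place.
move-triple : ∀ {n} {a b c a′ b′ c′ : Fin n} → a ≢ b → a ≢ c → b ≢ c → a′ ≢ b′ → a′ ≢ c′ → b′ ≢ c′ →
  Σ (Permutation′ n) λ π → π ⟨$⟩ʳ a ≡ a′ × π ⟨$⟩ʳ b ≡ b′ × π ⟨$⟩ʳ c ≡ c′
move-triple {n} {a} {b} {c} {a′} {b′} {c′} a≢b a≢c b≢c a′≢b′ a′≢c′ b′≢c′ = π₁ ∘ₚ (π₂ ∘ₚ π₃) , πa , πb , transpose-left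
    c₂ c′
  where
  π₁ π₂ π₃ : Permutation′ n
  b₁ c₂ : Fin n
  π₁ = transpose a a′
  b₁ = π₁ ⟨$⟩ʳ b
  π₂ = transpose b₁ b′
  c₂ = π₂ ⟨$⟩ʳ (π₁ ⟨$⟩ʳ c)
  π₃ = transpose c₂ c′
  a₁ : π₁ ⟨$⟩ʳ a ≡ a′
  a₁ = transpose-left a a′
  a₂ : π₂ ⟨$⟩ʳ (π₁ ⟨$⟩ʳ a) ≡ a′
  a₂ = trans (cong (π₂ ⟨$⟩ʳ_) a₁) (transpose-fixes b₁ b′ (λ eq → a≢b (⟨$⟩ʳ-injective π₁ (trans a₁ eq))) a′≢b′)
  b₂ : π₂ ⟨$⟩ʳ b₁ ≡ b′
  b₂ = transpose-left b₁ b′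
  πa : π₃ ⟨$⟩ʳ (π₂ ⟨$⟩ʳ (π₁ ⟨$⟩ʳ a)) ≡ a′
  πa = trans (cong (π₃ ⟨$⟩ʳ_) a₂) (transpose-fixes c₂ c′ (λ eq → a≢c (⟨$⟩ʳ-injective (π₁ ∘ₚ π₂) (trans a₂ eq))) a′≢c′)
  πb : π₃ ⟨$⟩ʳ (π₂ ⟨$⟩ʳ (π₁ ⟨$⟩ʳ b)) ≡ b′
  πb = trans (cong (π₃ ⟨$⟩ʳ_) b₂) (transpose-fixes c₂ c′ (λ eq → b≢c (⟨$⟩ʳ-injective (π₁ ∘ₚ π₂) (trans b₂ eq))) b′≢c′)

-- Adjacency of distinct vertices depends only on their classes, so any permutation that matches the
-- two triples is an isomorphism.
Cone⇒Iso : ∀ {n} {G H : Graph n} {e} → Cone G e → Cone H e → Iso G H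
Cone⇒Iso {n} {G} {H} {e} coneG coneH with move-triple (Cone.a≢b coneG) (Cone.a≢c coneG) (Cone.b≢c coneG)
    (Cone.a≢b coneH) (Cone.a≢c coneH) (Cone.b≢c coneH)
... | π , πa , πb , πc = record
  { to = π ⟨$⟩ʳ_ ; from = π ⟨$⟩ˡ_ ; from-to = λ u → inverseˡ π ; to-from = λ v → inverseʳ π ; preserves = preserves }
  where
  module X = ConeClass coneG
  module Y = ConeClass coneH
  transfer : ∀ {u i} → X.Class u i → Y.Class (π ⟨$⟩ʳ u) i
  transfer (X.isA refl) = Y.isA πa
  transfer (X.isB refl) = Y.isB πb
  transfer (X.isC refl) = Y.isC πc
  transfer (X.outside p q r) = Y.outside
    (λ eq → p (⟨$⟩ʳ-injective π (trans eq (sym πa)))) (λ eq → q (⟨$⟩ʳ-injective π (trans eq (sym πb))))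
        (λ eq → r (⟨$⟩ʳ-injective π (trans eq (sym πc))))
  same-table : ∀ i j → X.adjacency i j ≡ Y.adjacency i j
  same-table 0F 0F = refl
  same-table 0F 1F = refl
  same-table 0F 2F = refl
  same-table 0F 3F = refl
  same-table 1F 0F = refl
  same-table 1F 1F = refl
  same-table 1F 2F = refl
  same-table 1F 3F = refl
  same-table 2F 0F = refl
  same-table 2F 1F = refl
  same-table 2F 2F = refl
  same-table 2F 3F = refl
  same-table 3F _  = refl
  preserves : ∀ u v → adj G u v ≡ adj H (π ⟨$⟩ʳ u) (π ⟨$⟩ʳ v)
  preserves u v with u ≟ᶠ v
  ... | yes refl = trans (irrefl G u) (sym (irrefl H (π ⟨$⟩ʳ u)))
  ... | no u≢v   = trans (X.adj-class u≢v (X.class u) (X.class v)) (trans (same-table (X.κ u) (X.κ v))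
    (sym (Y.adj-class (u≢v ∘ ⟨$⟩ʳ-injective π) (transfer (X.class u)) (transfer (X.class v)))))

Iso⇒Cone : ∀ {m n} {G : Graph m} {H : Graph n} {e} → Iso G H → Cone H e → Cone G e
Iso⇒Cone {G = G} {H} iso cone = record
  { a = from a ; b = from b ; c = from c
  ; a≢b = a≢b ∘ from-injective ; a≢c = a≢c ∘ from-injective ; b≢c = b≢c ∘ from-injective
  ; ab = trans (pulled a b) ab ; ac = trans (pulled a c) ac ; bc = trans (pulled b c) bc
  ; dominates = λ {u} {v} p q r u≢v → trans (preserves u v)
      (dominates (p ∘ back) (q ∘ back) (r ∘ back) (u≢v ∘ to-injective)) }
  where
  open Iso iso
  open Cone cone
  from-injective : ∀ {x y} → from x ≡ from y → x ≡ y
  from-injective {x} {y} eq = trans (sym (to-from x)) (trans (cong to eq) (to-from y))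
  to-injective : ∀ {x y} → to x ≡ to y → x ≡ y
  to-injective {x} {y} eq = trans (sym (from-to x)) (trans (cong from eq) (from-to y))
  back : ∀ {u x} → to u ≡ x → u ≡ from x
  back {u} eq = trans (sym (from-to u)) (cong from eq)
  pulled : ∀ x y → adj G (from x) (from y) ≡ adj H x y
  pulled x y = trans (preserves (from x) (from y)) (cong₂ (adj H) (to-from x) (to-from y))

-- The two joins as cones.

≤ᵇ-true : ∀ {m n} → m ≤ n → (m ≤ᵇ n) ≡ true
≤ᵇ-true {zero}  {n}     m≤n       = refl
≤ᵇ-true {suc m} {suc n} m≤n = lemma m (suc n) m≤n
  where
  lemma : ∀ m n → suc m ≤ n → (m ℕ.<ᵇ n) ≡ true
  lemma zero    (suc n) _         = refl
  lemma (suc m) (suc n) (s≤s m<n) = lemma m n m<n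

≤ᵇ-false : ∀ {m n} → n < m → (m ≤ᵇ n) ≡ false
≤ᵇ-false {suc m} {n} (s≤s n≤m) = lemma m n n≤m
  where
  lemma : ∀ m n → n ≤ m → (m ℕ.<ᵇ n) ≡ false
  lemma m       zero    _         = refl
  lemma (suc m) (suc n) (s≤s n≤m) = lemma m n n≤m

join : ∀ n → Bool → Graph n
join n e = record { adj = adjJoin n e ; sym = adjJoin-sym n e ; irrefl = adjJoin-irrefl n e }

join-Cone : ∀ n e → 3 ≤ n → Cone (join n e) e
-- Writing the order as m + 3 lets the truncated differences n ∸ 3 and n ∸ 2 in `adjJoin` compute.
join-Cone (suc (suc (suc m))) e (s≤s (s≤s (s≤s _))) = record
  { a = a ; b = b ; c = c
  ; a≢b = differ a-val b-val (ℕ.<⇒≢ ℕ.≤-refl)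
  ; a≢c = differ a-val c-val (ℕ.<⇒≢ (ℕ.n≤1+n (suc m)))
  ; b≢c = differ b-val c-val (ℕ.<⇒≢ ℕ.≤-refl)
  ; ab = ab′ a-val b-val ; ac = ac′ a-val c-val ; bc = bc′ b-val c-val ; dominates = dominates }
  where
  n : ℕ
  n = suc (suc (suc m))
  a<n : m < n
  a<n = ℕ.≤-trans (ℕ.n≤1+n (suc m)) (ℕ.n≤1+n (suc (suc m)))
  a b c : Fin n
  a = fromℕ< {m} a<n
  b = fromℕ< {suc m} (ℕ.n≤1+n (suc (suc m)))
  c = fromℕ< {suc (suc m)} ℕ.≤-refl
  a-val : toℕ a ≡ m
  a-val = toℕ-fromℕ< a<n
  b-val : toℕ b ≡ suc m
  b-val = toℕ-fromℕ< (ℕ.n≤1+n (suc (suc m)))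
  c-val : toℕ c ≡ suc (suc m)
  c-val = toℕ-fromℕ< {suc (suc m)} {n} ℕ.≤-refl
  differ : ∀ {u v : Fin n} {i j} → toℕ u ≡ i → toℕ v ≡ j → i ≢ j → u ≢ v
  differ refl refl i≢j refl = i≢j refl
  m<1+m : m ≢ suc m
  m<1+m = ℕ.<⇒≢ ℕ.≤-refl
  m<2+m : m ≢ suc (suc m)
  m<2+m = ℕ.<⇒≢ (ℕ.n≤1+n (suc m))
  false-∧ : ∀ e → e ∧ false ≡ false
  false-∧ true  = refl
  false-∧ false = refl
  true-∧ : ∀ e → e ∧ true ≡ e
  true-∧ true  = refl
  true-∧ false = refl
  ab′ : ∀ {u v} → toℕ u ≡ m → toℕ v ≡ suc m → adjJoin n e u v ≡ e
  ab′ u-val v-val rewrite u-val | v-val | ≡ᵇ-false m (suc m) m<1+m | ≤ᵇ-true (ℕ.≤-refl {m}) | ≤ᵇ-true (ℕ.n≤1+n m) |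
      ≡ᵇ-refl m = true-∧ e
  ac′ : ∀ {u v} → toℕ u ≡ m → toℕ v ≡ suc (suc m) → adjJoin n e u v ≡ false
  ac′ u-val v-val rewrite u-val | v-val | ≡ᵇ-false m (suc (suc m)) m<2+m | ≤ᵇ-true (ℕ.≤-refl {m}) | ≤ᵇ-true
      (ℕ.≤-trans (ℕ.n≤1+n m) (ℕ.n≤1+n (suc m))) | ≡ᵇ-refl m
    | ≡ᵇ-false (suc m) m (m<1+m ∘ sym) | ≡ᵇ-false (suc (suc m)) m (m<2+m ∘ sym) = false-∧ e
  bc′ : ∀ {u v} → toℕ u ≡ suc m → toℕ v ≡ suc (suc m) → adjJoin n e u v ≡ false
  bc′ u-val v-val rewrite u-val | v-val | ≡ᵇ-false m (suc m) m<1+m | ≤ᵇ-true (ℕ.n≤1+n m) | ≤ᵇ-true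
      (ℕ.≤-trans (ℕ.n≤1+n m) (ℕ.n≤1+n (suc m))) | ≡ᵇ-refl m
    | ≡ᵇ-false (suc m) m (m<1+m ∘ sym) | ≡ᵇ-false (suc (suc m)) m (m<2+m ∘ sym) = false-∧ e
  small : ∀ {u : Fin n} → u ≢ a → u ≢ b → u ≢ c → toℕ u < m
  small {u} u≢a u≢b u≢c = shrink (shrink (shrink (toℕ<n u) c-val u≢c) b-val u≢b) a-val u≢a
    where
    shrink : ∀ {k v} → toℕ u < suc k → toℕ v ≡ k → u ≢ v → toℕ u < k
    shrink (s≤s u≤k) refl u≢v = ℕ.≤∧≢⇒< u≤k (u≢v ∘ toℕ-injective)
  dominates : ∀ {u v} → u ≢ a → u ≢ b → u ≢ c → u ≢ v → adjJoin n e u v ≡ true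
  dominates {u} {v} u≢a u≢b u≢c u≢v
    rewrite ≡ᵇ-false (toℕ u) (toℕ v) (u≢v ∘ toℕ-injective) | ≤ᵇ-false (small u≢a u≢b u≢c) = refl

-- Multiplicity n - 4 and determination by the spectrum.

RootMult-resp-≈p : ∀ {r} P R k → P ≈p R → RootMult r R k → RootMult r P k
RootMult-resp-≈p P R k P≈R ((q , eq) , none) =
  (q , λ i → trans (P≈R i) (eq i)) , λ (q′ , eq′) → none (q′ , λ i → trans (sym (P≈R i)) (eq′ i))

module _ {n} (9≤n : 9 ≤ n) where

  5≤n : 5 ≤ n
  5≤n = ℕ.≤-trans (ℕ.m≤n+m 5 4) 9≤n

  3≤n : 3 ≤ n
  3≤n = ℕ.≤-trans (ℕ.m≤n+m 3 6) 9≤n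

  Cone⇔mult : (G : Graph n) → Connected G → MultMinusOne G (n ∸ 4) ⇔ (∃[ e ] Cone G e)
  Cone⇔mult G conn = mk⇔ forward backward
    where
    open EccSpectrum G conn
    forward : MultMinusOne G (n ∸ 4) → ∃[ e ] Cone G e
    -- As n is at least 4, the truncated difference is genuine, and k + r = n with k = n ∸ 4 leaves
    -- r = 4.
    forward mult = rank-4⇒Cone 9≤n (ℕ.+-cancelˡ-≡ k r 4
        (trans k+r≡n (sym (trans (cong (ℕ._+ 4) (sym n∸4≡k)) (ℕ.m∸n+n≡m (ℕ.≤-trans (ℕ.m≤n+m 4 5) 9≤n))))))
      where
      n∸4≡k : n ∸ 4 ≡ k
      n∸4≡k = Equivalence.to (RootMult⇔≡ order (n ∸ 4)) mult
    backward : ∃[ e ] Cone G e → MultMinusOne G (n ∸ 4)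
    backward (e , cone) = Equivalence.from (RootMult⇔≡ order (n ∸ 4)) (sym (ConeSpectrum.k≡n∸4 G conn cone 5≤n))

  -- The spectrum fixes in turn the order (by the degree), the cone structure (by the multiplicity
  -- of -1) and the type of the cone (by the sign at -1).
  join-determined : ∀ e → DeterminedByEccSpectrum (join n e)
  join-determined e m H conn P≈ with ℕ.≤-antisym (charPoly-degree (eccMatrix (join n e)) (eccMatrix H)
      (λ i → sym (P≈ i))) (charPoly-degree (eccMatrix H) (eccMatrix (join n e)) P≈)
  ... | refl = found (Equivalence.to (Cone⇔mult H conn) multH)
    where
    coneJ : Cone (join n e) e
    coneJ = join-Cone n e 3≤n
    connJ : Connected (join n e)
    connJ = ConeClass.connected coneJ 5≤n
    multH : MultMinusOne H (n ∸ 4)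
    multH = RootMult-resp-≈p { - 1ℤ} (eccCharPoly H) (eccCharPoly (join n e)) (n ∸ 4) P≈
        (Equivalence.from (Cone⇔mult (join n e) connJ) (e , coneJ))
    found : ∃[ f ] Cone H f → Iso H (join n e)
    found (f , coneH) = Cone⇒Iso (subst (Cone H) (charPoly-distinguishes H (join n e) conn connJ coneH coneJ 5≤n P≈)
        coneH) coneJ

theorem3p4 : ∀ (n : ℕ) → 9 ≤ n → (G : Graph n) → Connected G →
    (MultMinusOne G (n ∸ 4) ⇔ (Iso G (KjoinK2K1 n) ⊎ Iso G (Kjoin3K1 n)))
    × DeterminedByEccSpectrum (KjoinK2K1 n)
    × DeterminedByEccSpectrum (Kjoin3K1 n)
theorem3p4 n 9≤n G conn = mk⇔ (forward ∘ Equivalence.to equiv) (Equivalence.from equiv ∘ backward) ,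
  join-determined 9≤n true , join-determined 9≤n false
  where
  equiv = Cone⇔mult 9≤n G conn
  forward : ∃[ e ] Cone G e → Iso G (KjoinK2K1 n) ⊎ Iso G (Kjoin3K1 n)
  forward (true  , cone) = inj₁ (Cone⇒Iso cone (join-Cone n true (3≤n 9≤n)))
  forward (false , cone) = inj₂ (Cone⇒Iso cone (join-Cone n false (3≤n 9≤n)))
  backward : Iso G (KjoinK2K1 n) ⊎ Iso G (Kjoin3K1 n) → ∃[ e ] Cone G e
  backward (inj₁ iso) = true  , Iso⇒Cone iso (join-Cone n true (3≤n 9≤n))
  backward (inj₂ iso) = false , Iso⇒Cone iso (join-Cone n false (3≤n 9≤n))
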